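{- Let $(g,c,n)$ be a v-admissible triplet of integers with $5\le g\le c\le n$. (i) If $c<3g-4$, then $g/4\le A(g,c,n)\le (2g-1)/4$. (ii) If $c=3g-4$, then $g/4\le A(g,c,n)\le (g+2)/4$ when $g$ is even, and $g/4\le A(g,c,n)\le (g+3)/4$ when $g$ is odd. (iii) If $c>3g-4$, then $g/4\le A(g,c,n)\le (3g+5)/8$ when $g$ is even, and $g/4\le A(g,c,n)\le (3g+7)/8$ when $g$ is odd.
   Context: All graphs are finite, simple and connected. A graph $G$ is regarded as a geodesic metric space by identifying each edge isometrically with $[0,1]$; points are vertices and interior points of edges, $d$ is the shortest-path length. A geodesic triangle $T=\{x,y,z\}$ is a union of three geodesics $[xy],[yz],[zx]$; $\delta(T)$ is the infimum of $\delta\ge0$ such that each side lies in the $\delta$-neighbourhood of the union of the other two; $\delta(G)=\sup_T\delta(T)$ over geodesic triangles. Girth $g(G)$ / circumference $c(G)$: length of a shortest / longest cycle. $\mathcal{G}(g,c,n)$ is the set of graphs with girth $g$, circumference $c$ and $n$ vertices, and $A(g,c,n)=\min\{\delta(G):G\in\mathcal{G}(g,c,n)\}$. A triplet $(g,c,n)$ is v-admissible if $\mathcal{G}(g,c,n)\ne\emptyset$.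
   Formalization: Points on the edges of the graph, hence the vertices of geodesic triangles and the points of their sides, have rational positions, and geodesics are isometries of the rational points of [0,L]; δ(G) is the supremum over such rational triangles. -}

module Defs where

open import Data.Bool using (Bool; true; false)
open import Data.Nat as ℕ using (ℕ; zero; suc)
open import Data.Fin using (Fin; zero; suc; inject₁; fromℕ)
open import Data.Integer using (+_)
open import Data.Rational using (ℚ; 0ℚ; 1ℚ; _+_; _-_; ∣_∣; _≤_; _<_; _/_)
open import Data.Product using (Σ; ∃; _×_; _,_)
open import Data.Sum using (_⊎_)
open import Relation.Binary.PropositionalEquality using (_≡_; _≢_)
open import Function.Definitions using (Injective)
import Data.Rational.Properties

record Graph (n : ℕ) : Set where
  field
    adj     : Fin n → Fin n → Bool
    symm    : ∀ u v → adj u v ≡ adj v u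
    loopless : ∀ v → adj v v ≡ false

module _ {n : ℕ} (G : Graph n) where
  open Graph G

  data Walk : ℕ → Fin n → Fin n → Set where
    []  : ∀ {u} → Walk zero u u
    _∷_ : ∀ {k u w v} → adj u w ≡ true → Walk k w v → Walk (suc k) u v

  Connected : Set
  Connected = ∀ u v → ∃ λ k → Walk k u v

  record Cycle (m : ℕ) : Set where
    field
      long  : 3 ℕ.≤ suc m
      vs    : Fin (suc m) → Fin n
      inj   : Injective _≡_ _≡_ vs
      step  : ∀ (i : Fin m) → adj (vs (inject₁ i)) (vs (suc i)) ≡ true
      close : adj (vs (fromℕ m)) (vs zero) ≡ true

  HasCycleOfLength : ℕ → Set
  HasCycleOfLength k = ∃ λ m → suc m ≡ k × Cycle m

  Girth : ℕ → Set
  Girth g = HasCycleOfLength g × (∀ k → HasCycleOfLength k → g ℕ.≤ k)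

  Circumference : ℕ → Set
  Circumference c = HasCycleOfLength c × (∀ k → HasCycleOfLength k → k ℕ.≤ c)

  -- The graph as a metric space (points with rational coordinates).
  -- A point is given by an edge (a , b) and t ∈ [0,1]: the point at
  -- distance t from a (and 1 - t from b) on that edge.  A vertex v is
  -- represented by (v , b , 0) for any neighbour b (or (a , v , 1));
  -- all notions below only use distances, so this is harmless.

  record Point : Set where
    field
      a b  : Fin n
      edge : adj a b ≡ true
      t    : ℚ
      t≥0  : 0ℚ ≤ t
      t≤1  : t ≤ 1ℚ

  open Point

  ℕ→ℚ : ℕ → ℚ
  ℕ→ℚ k = + k / 1

  Exit : Point → Fin n → ℚ → Set
  Exit p v c = (v ≡ a p × c ≡ t p) ⊎ (v ≡ b p × c ≡ 1ℚ - t p)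

  Route : Point → Point → ℚ → Set
  Route p q ℓ =
      (∃ λ v → ∃ λ w → ∃ λ k → ∃ λ c → ∃ λ c' →
         Exit p v c × Exit q w c' × Walk k v w × ℓ ≡ c + ℕ→ℚ k + c')
    ⊎ (a p ≡ a q × b p ≡ b q × ℓ ≡ ∣ t p - t q ∣)
    ⊎ (a p ≡ b q × b p ≡ a q × ℓ ≡ ∣ t p - (1ℚ - t q) ∣)

  IsDist : Point → Point → ℚ → Set
  IsDist p q r = Route p q r × (∀ ℓ → Route p q ℓ → r ≤ ℓ)

  DistLe : Point → Point → ℚ → Set
  DistLe p q r = ∃ λ ℓ → Route p q ℓ × ℓ ≤ r

  DistGt : Point → Point → ℚ → Set
  DistGt p q r = ∀ ℓ → Route p q ℓ → r < ℓ

  SamePoint : Point → Point → Set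
  SamePoint p q = IsDist p q 0ℚ

  record Geodesic (x y : Point) : Set where
    field
      L    : ℚ
      L≥0  : 0ℚ ≤ L
      γ    : (s : ℚ) → 0ℚ ≤ s → s ≤ L → Point
      start : SamePoint (γ 0ℚ (Data.Rational.Properties.≤-refl) L≥0) x
      end   : SamePoint (γ L L≥0 (Data.Rational.Properties.≤-refl)) y
      iso   : ∀ s s' (h₁ : 0ℚ ≤ s) (h₂ : s ≤ L) (h₁' : 0ℚ ≤ s') (h₂' : s' ≤ L) →
              IsDist (γ s h₁ h₂) (γ s' h₁' h₂') ∣ s - s' ∣

  OnGeodesic : ∀ {x y} → Geodesic x y → Point → Set
  OnGeodesic {x} {y} geo p =
    ∃ λ s → Σ (0ℚ ≤ s) λ h₁ → Σ (s ≤ Geodesic.L geo) λ h₂ →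
      SamePoint p (Geodesic.γ geo s h₁ h₂)

  record Triangle : Set where
    field
      x y z : Point
      xy : Geodesic x y
      yz : Geodesic y z
      zx : Geodesic z x

  OnSide : Triangle → Fin 3 → Point → Set
  OnSide T zero             p = OnGeodesic (Triangle.xy T) p
  OnSide T (suc zero)       p = OnGeodesic (Triangle.yz T) p
  OnSide T (suc (suc zero)) p = OnGeodesic (Triangle.zx T) p

  δT≤ : Triangle → ℚ → Set
  δT≤ T r = ∀ (ε : ℚ) → 0ℚ < ε → ∀ (i : Fin 3) (p : Point) → OnSide T i p →
            ∃ λ (j : Fin 3) → j ≢ i × ∃ λ q → OnSide T j q × DistLe p q (r + ε)

  δ≤ : ℚ → Set
  δ≤ r = ∀ (T : Triangle) → δT≤ T r

  δ≥ : ℚ → Set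
  δ≥ r = ∀ (ε : ℚ) → 0ℚ < ε →
         ∃ λ (T : Triangle) → ∃ λ (i : Fin 3) → ∃ λ (p : Point) → OnSide T i p ×
           (∀ (j : Fin 3) (q : Point) → j ≢ i → OnSide T j q → DistGt p q (r - ε))

-- The class 𝒢(g,c,n) and bounds on A(g,c,n) = min { δ(G) : G ∈ 𝒢(g,c,n) }

InClass : (g c n : ℕ) → Graph n → Set
InClass g c n G = Connected G × Girth G g × Circumference G c

VAdmissible : ℕ → ℕ → ℕ → Set
VAdmissible g c n = ∃ λ (G : Graph n) → InClass g c n G

-- lo ≤ A(g,c,n) ≤ hi   (𝒢(g,c,n) is finite, so the minimum is attained)
ABounds : (g c n : ℕ) → ℚ → ℚ → Set
ABounds g c n lo hi =
  (∀ (G : Graph n) → InClass g c n G → δ≥ G lo) ×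
  (∃ λ (G : Graph n) → InClass g c n G × δ≤ G hi)

-- Lower bound.  A shortest cycle is isometrically embedded: among all walks between two of its vertices that are
-- shorter than both arcs, a shortest one would close up with one of the arcs to a cycle of length < g.  A bigon formed
-- by two complementary halves of that cycle then has a point at distance g/4 from the opposite side.
--
-- Upper bounds.  Let p on the side [xy] be farther than ρ from the other two sides.  The points x', y' of [xy] at
-- distance ρ from p are joined outside the open ball of radius ρ around p: along [xy] to x and y and then along the
-- other sides.  Together with the segment [x'y'] this yields a simple cycle of length ≥ 4ρ, so δ(G) ≤ c/4 for
-- every G, which settles c < 2g - 2.  For larger c the extremal graph is a fan: a path of c - 1 vertices and a hub
-- joined to some of them, so that the cells between consecutive spokes have lengths in [g, ℓ], and n - c leaves at the
-- hub.  In a fan the cycle above can be shortcut through the spokes bounding the cell of p, which gives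
-- 4ρ ≤ ℓ + 2, hence δ ≤ (ℓ + 2)/4.  One cell has length g, and ℓ ≤ 2g - 3, ℓ = g, ℓ ≤ (3g - 2)/2 can be reached in the
-- cases (i), (ii), (iii).
module Submission where

open import Defs
import Data.Nat as ℕ
import Data.Nat.Properties as ℕ
import Data.Integer as ℤ
import Data.Integer.Properties as ℤ
import Data.Rational as ℚ
import Data.Rational.Properties as ℚ
import Data.Rational.Unnormalised as ℚᵘ
import Data.Rational.Unnormalised.Properties as ℚᵘ
import Data.Bool as Bool
import Data.Bool.Properties as Bool
import Data.Fin.Properties as Fin
import Data.Vec as Vec
import Data.Vec.Properties as Vec
import Data.List as List
open import Algebra.Bundles using (CommutativeMonoid)
open import Algebra.Properties.CommutativeSemigroup (CommutativeMonoid.commutativeSemigroup ℚ.+-0-commutativeMonoid) using (interchange)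
open import Data.Bool using (Bool; true; false; _∧_; _∨_; if_then_else_; T)
open import Data.Empty using (⊥; ⊥-elim)
open import Data.Fin as Fin using (Fin; zero; suc; toℕ; fromℕ<; _↑ˡ_; _↑ʳ_)
open import Data.List using (List; []; _∷_)
open import Data.List.Relation.Unary.All using (All; []; _∷_)
open import Data.Nat using (ℕ; zero; suc; z≤n; s≤s; ⌊_/2⌋; ⌈_/2⌉)
open import Data.Nat.DivMod using (_%_; m%n<n; m≡m%n+[m/n]*n; m<n⇒m%n≡m; %-distribˡ-+; [m+n]%n≡m%n; n%n≡0)
open import Data.Nat.Divisibility using (_∣_)
open import Data.Nat.Induction using (<-wellFounded)
open import Data.Nat.ListAction using (sum)
open import Data.Product using (∃; _×_; _,_; proj₁; proj₂)
open import Data.Rational using (ℚ; mkℚ; 0ℚ; 1ℚ)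
open import Data.Sum using (_⊎_; inj₁; inj₂; [_,_]′)
open import Data.Unit using (⊤; tt)
open import Data.Vec using (Vec; []; _∷_; _++_; lookup; replicate; zipWith)
open import Induction.WellFounded using (Acc; acc)
open import Relation.Binary using (tri<; tri≈; tri>)
open import Relation.Binary.PropositionalEquality
open import Relation.Nullary using (¬_; Dec; yes; no)
open import Relation.Nullary.Decidable using (map′; _×-dec_)

-- Distances are given through route lengths between points with rational parameters, and a side is
-- an arbitrary function on a rational interval, so that being joined outside a ball cannot rest on
-- continuity. The sides are sampled with a step η < 1: consecutive samples lie on one edge or on
-- two edges with a common vertex, which turns a sampled curve into a walk through vertices at
-- distance at least ρ - η from p. The estimates for the resulting cycle carry multiples of η, at
-- most 8η in a bound for 4ρ; they are absorbed because the bound r is refuted at ρ = r + κ with 2η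
-- < κ. The summand 2 in (ℓ + 2)/4 arises when the segment [x'y'] leaves the cell of p at one end.
-- The part of it inside the cell is a geodesic on a closed path of length ℓ, hence at most ℓ/2. If
-- the hub is outside the ball, the segment continues beyond the spoke by at most one edge, the
-- length of that spoke. Thus 2ρ ≤ ℓ/2 + 1. The remaining positions of the hub and of the spokes
-- give no worse bound.

-- A verified procedure for linear inequalities over naturals and rationals.

module LinearArithmetic where
  open import Data.Integer using (ℤ; +_; -[1+_])

  ι : ℕ → ℚ
  ι k = + k ℚ./ 1

  private
    toℚᵘ-ι : ∀ k → ℚ.toℚᵘ (ι k) ℚᵘ.≃ ℚᵘ.mkℚᵘ (+ k) 0
    toℚᵘ-ι k = ℚ.toℚᵘ-fromℚᵘ (ℚᵘ.mkℚᵘ (+ k) 0)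

  ι-+ : ∀ a b → ι (a ℕ.+ b) ≡ ι a ℚ.+ ι b
  ι-+ a b = ℚ.toℚᵘ-injective (ℚᵘ.≃-trans (toℚᵘ-ι (a ℕ.+ b)) (ℚᵘ.≃-sym
    (ℚᵘ.≃-trans (ℚ.toℚᵘ-homo-+ (ι a) (ι b)) (ℚᵘ.≃-trans (ℚᵘ.+-cong (toℚᵘ-ι a) (toℚᵘ-ι b))
    (ℚᵘ.*≡* (cong (ℤ._* + 1) (cong₂ ℤ._+_ (ℤ.*-identityʳ (+ a)) (ℤ.*-identityʳ (+ b)))))))))

  ι-* : ∀ a b → ι (a ℕ.* b) ≡ ι a ℚ.* ι b
  ι-* a b = ℚ.toℚᵘ-injective (ℚᵘ.≃-trans (toℚᵘ-ι (a ℕ.* b)) (ℚᵘ.≃-sym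
    (ℚᵘ.≃-trans (ℚ.toℚᵘ-homo-* (ι a) (ι b)) (ℚᵘ.≃-trans (ℚᵘ.*-cong (toℚᵘ-ι a) (toℚᵘ-ι b))
    (ℚᵘ.*≡* (cong (ℤ._* + 1) (sym (ℤ.pos-* a b))))))))

  ι-mono : ∀ {a b} → a ℕ.≤ b → ι a ℚ.≤ ι b
  ι-mono {a} {b} h = ℚ.toℚᵘ-cancel-≤ (ℚᵘ.≤-respˡ-≃ (ℚᵘ.≃-sym (toℚᵘ-ι a)) (ℚᵘ.≤-respʳ-≃ (ℚᵘ.≃-sym (toℚᵘ-ι b))
    (ℚᵘ.*≤* (ℤ.*-monoʳ-≤-nonNeg (+ 1) (ℤ.+≤+ h)))))

  ι-nonneg : ∀ a → 0ℚ ℚ.≤ ι a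
  ι-nonneg a = ι-mono {0} {a} ℕ.z≤n

  -- Two sorts in one language let a single sequent mix lengths of walks, which are naturals, with
  -- rational distances; `↑` stands for the embedding `ι`.
  data Sort : Set where
    nat rat : Sort

  infixl 6 _⊕_ _⊖_
  infixl 7 _·_
  data Expr (m k : ℕ) : Sort → Set where
    nv : Fin m → Expr m k nat
    rv : Fin k → Expr m k rat
    # : ℕ → Expr m k nat
    _⊕_ : ∀ {s} → Expr m k s → Expr m k s → Expr m k s
    _⊖_ : Expr m k rat → Expr m k rat → Expr m k rat
    _·_ : ℕ → Expr m k nat → Expr m k nat
    ↑ : Expr m k nat → Expr m k rat

  infix 4 _≤'_ _<'_ _≡'_
  infixr 3 _⇒_ ⊢_
  data Atom (m k : ℕ) : Set where
    _≤'_ _<'_ _≡'_ : ∀ {s} → Expr m k s → Expr m k s → Atom m k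
    ⊥' : Atom m k

  data Sequent (m k : ℕ) : Set where
    ⊢_ : Atom m k → Sequent m k
    _⇒_ : Atom m k → Sequent m k → Sequent m k

  module Semantics {m k : ℕ} (ns : Vec ℕ m) (xs : Vec ℚ k) where
    Val : Sort → Set
    Val nat = ℕ
    Val rat = ℚ

    ⟦_⟧ : ∀ {s} → Expr m k s → Val s
    ⟦ nv i ⟧ = lookup ns i
    ⟦ rv i ⟧ = lookup xs i
    ⟦ # c ⟧ = c
    ⟦ _⊕_ {nat} a b ⟧ = ⟦ a ⟧ ℕ.+ ⟦ b ⟧
    ⟦ _⊕_ {rat} a b ⟧ = ⟦ a ⟧ ℚ.+ ⟦ b ⟧
    ⟦ a ⊖ b ⟧ = ⟦ a ⟧ ℚ.- ⟦ b ⟧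
    ⟦ c · a ⟧ = c ℕ.* ⟦ a ⟧
    ⟦ ↑ a ⟧ = ι ⟦ a ⟧

    ⟦_⟧ₐ : Atom m k → Set
    ⟦ _≤'_ {nat} a b ⟧ₐ = ⟦ a ⟧ ℕ.≤ ⟦ b ⟧
    ⟦ _≤'_ {rat} a b ⟧ₐ = ⟦ a ⟧ ℚ.≤ ⟦ b ⟧
    ⟦ _<'_ {nat} a b ⟧ₐ = ⟦ a ⟧ ℕ.< ⟦ b ⟧
    ⟦ _<'_ {rat} a b ⟧ₐ = ⟦ a ⟧ ℚ.< ⟦ b ⟧
    ⟦ a ≡' b ⟧ₐ = ⟦ a ⟧ ≡ ⟦ b ⟧
    ⟦ ⊥' ⟧ₐ = ⊥

    ⟦_⟧ₛ : Sequent m k → Set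
    ⟦ ⊢ a ⟧ₛ = ⟦ a ⟧ₐ
    ⟦ a ⇒ s ⟧ₛ = ⟦ a ⟧ₐ → ⟦ s ⟧ₛ

  -- A linear form has natural coefficients: the constant one first, then those of the ℕ-atoms and of the ℚ-atoms.
  Form : ℕ → Set
  Form n = Vec ℕ n

  _+ᶠ_ : ∀ {n} → Form n → Form n → Form n
  _+ᶠ_ = zipWith ℕ._+_

  _*ᶠ_ : ∀ {n} → ℕ → Form n → Form n
  c *ᶠ f = Vec.map (c ℕ.*_) f

  0ᶠ : ∀ {n} → Form n
  0ᶠ = replicate _ 0

  unit : ∀ {n} → Fin n → Form n
  unit zero = 1 ∷ 0ᶠ
  unit (suc i) = 0 ∷ unit i

  dot : ∀ {n} → Form n → Vec ℚ n → ℚ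
  dot [] [] = 0ℚ
  dot (c ∷ f) (x ∷ xs) = ι c ℚ.* x ℚ.+ dot f xs

  dot-0 : ∀ {n} (xs : Vec ℚ n) → dot 0ᶠ xs ≡ 0ℚ
  dot-0 [] = refl
  dot-0 (x ∷ xs) = cong₂ ℚ._+_ (ℚ.*-zeroˡ x) (dot-0 xs)

  dot-unit : ∀ {n} (i : Fin n) (xs : Vec ℚ n) → dot (unit i) xs ≡ lookup xs i
  dot-unit zero (x ∷ xs) = trans (cong₂ ℚ._+_ (ℚ.*-identityˡ x) (dot-0 xs)) (ℚ.+-identityʳ x)
  dot-unit (suc i) (x ∷ xs) = trans (cong₂ ℚ._+_ (ℚ.*-zeroˡ x) (dot-unit i xs)) (ℚ.+-identityˡ _)

  dot-+ : ∀ {n} (f g : Form n) xs → dot (f +ᶠ g) xs ≡ dot f xs ℚ.+ dot g xs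
  dot-+ [] [] [] = refl
  dot-+ (c ∷ f) (d ∷ g) (x ∷ xs) = trans
    (cong₂ ℚ._+_ (trans (cong (ℚ._* x) (ι-+ c d)) (ℚ.*-distribʳ-+ x (ι c) (ι d))) (dot-+ f g xs))
    (interchange (ι c ℚ.* x) (ι d ℚ.* x) (dot f xs) (dot g xs))

  dot-* : ∀ {n} c (f : Form n) xs → dot (c *ᶠ f) xs ≡ ι c ℚ.* dot f xs
  dot-* c [] [] = sym (ℚ.*-zeroʳ (ι c))
  dot-* c (d ∷ f) (x ∷ xs) = trans
    (cong₂ ℚ._+_ (trans (cong (ℚ._* x) (ι-* c d)) (ℚ.*-assoc (ι c) (ι d) x)) (dot-* c f xs))
    (sym (ℚ.*-distribˡ-+ (ι c) (ι d ℚ.* x) (dot f xs)))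

  record Ineq (n : ℕ) : Set where
    constructor ineq
    field
      strict : Bool
      lhs rhs : Form n
  open Ineq

  Rel : Bool → ℚ → ℚ → Set
  Rel true = ℚ._<_
  Rel false = ℚ._≤_

  Holds : ∀ {n} → Vec ℚ n → Ineq n → Set
  Holds xs (ineq s f g) = Rel s (dot f xs) (dot g xs)

  Holdsˡ : ∀ {n} → Vec ℚ n → List (Ineq n) → Set
  Holdsˡ xs [] = ⊤
  Holdsˡ xs (h ∷ hs) = Holds xs h × Holdsˡ xs hs

  Rel⇒≤ : ∀ s {x y} → Rel s x y → x ℚ.≤ y
  Rel⇒≤ true = ℚ.<⇒≤
  Rel⇒≤ false h = h

  Rel-+ : ∀ s t {x y z w} → Rel s x y → Rel t z w → Rel (s ∨ t) (x ℚ.+ z) (y ℚ.+ w)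
  Rel-+ true t h k = ℚ.+-mono-<-≤ h (Rel⇒≤ t k)
  Rel-+ false true h k = ℚ.+-mono-≤-< h k
  Rel-+ false false h k = ℚ.+-mono-≤ h k

  -- A zero multiplier yields `0 ≤ 0`, as strictness does not survive it.
  scale : ∀ {n} → ℕ → Ineq n → Ineq n
  scale zero (ineq s f g) = ineq false 0ᶠ 0ᶠ
  scale (suc c) (ineq s f g) = ineq s (suc c *ᶠ f) (suc c *ᶠ g)

  addI : ∀ {n} → Ineq n → Ineq n → Ineq n
  addI (ineq s f g) (ineq t f' g') = ineq (s ∨ t) (f +ᶠ f') (g +ᶠ g')

  Holds-scale : ∀ {n} (xs : Vec ℚ n) c h → Holds xs h → Holds xs (scale c h)
  Holds-scale xs zero h _ = ℚ.≤-refl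
  Holds-scale xs (suc c) (ineq true f g) h = subst₂ ℚ._<_ (sym (dot-* (suc c) f xs)) (sym (dot-* (suc c) g xs))
    (ℚ.*-monoʳ-<-pos (ι (suc c)) {{ℚ.normalize-pos (suc c) 1}} h)
  Holds-scale xs (suc c) (ineq false f g) h = subst₂ ℚ._≤_ (sym (dot-* (suc c) f xs)) (sym (dot-* (suc c) g xs))
    (ℚ.*-monoˡ-≤-nonNeg (ι (suc c)) {{ℚ.normalize-nonNeg (suc c) 1}} h)

  Holds-add : ∀ {n} (xs : Vec ℚ n) h k → Holds xs h → Holds xs k → Holds xs (addI h k)
  Holds-add xs (ineq s f g) (ineq t f' g') p q =
    subst₂ (Rel (s ∨ t)) (sym (dot-+ f f' xs)) (sym (dot-+ g g' xs)) (Rel-+ s t p q)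

  combine : ∀ {n} → List ℕ → List (Ineq n) → Ineq n
  combine (c ∷ cs) (h ∷ hs) = addI (scale c h) (combine cs hs)
  combine _ _ = ineq false 0ᶠ 0ᶠ

  Holds-combine : ∀ {n} (xs : Vec ℚ n) cs hs → Holdsˡ xs hs → Holds xs (combine cs hs)
  Holds-combine xs (c ∷ cs) (h ∷ hs) (p , ps) =
    Holds-add xs (scale c h) (combine cs hs) (Holds-scale xs c h p) (Holds-combine xs cs hs ps)
  Holds-combine xs [] _ _ = ℚ.≤-refl
  Holds-combine xs (_ ∷ _) [] _ = ℚ.≤-refl

  _≡ᶠ_ : ∀ {n} → Form n → Form n → Bool
  [] ≡ᶠ [] = true
  (c ∷ f) ≡ᶠ (d ∷ g) = (c ℕ.≡ᵇ d) ∧ (f ≡ᶠ g)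

  T-∧ : ∀ {a b} → T (a ∧ b) → T a × T b
  T-∧ {true} h = _ , h

  ≡ᶠ-sound : ∀ {n} (f g : Form n) → T (f ≡ᶠ g) → f ≡ g
  ≡ᶠ-sound [] [] _ = refl
  ≡ᶠ-sound (c ∷ f) (d ∷ g) h with T-∧ {c ℕ.≡ᵇ d} h
  ... | p , q = cong₂ _∷_ (ℕ.≡ᵇ⇒≡ c d p) (≡ᶠ-sound f g q)

  -- The variable parts of both sides must coincide literally; then only the constants, the
  -- coordinate with value 1, are left to be compared.
  absurd? : ∀ {n} → Ineq (suc n) → Bool
  absurd? (ineq true (c ∷ f) (d ∷ g)) = (d ℕ.≤ᵇ c) ∧ (f ≡ᶠ g)
  absurd? (ineq false (c ∷ f) (d ∷ g)) = (d ℕ.<ᵇ c) ∧ (f ≡ᶠ g)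

  absurd-sound : ∀ {n} (xs : Vec ℚ n) h → T (absurd? h) → ¬ Holds (1ℚ ∷ xs) h
  absurd-sound xs (ineq true (c ∷ f) (d ∷ g)) t h with T-∧ {d ℕ.≤ᵇ c} t
  ... | p , q rewrite ≡ᶠ-sound f g q = ℚ.<-irrefl refl (ℚ.<-≤-trans h
    (ℚ.+-monoˡ-≤ (dot g xs) (ℚ.*-monoʳ-≤-nonNeg 1ℚ (ι-mono (ℕ.≤ᵇ⇒≤ d c p)))))
  absurd-sound xs (ineq false (c ∷ f) (d ∷ g)) t h with T-∧ {d ℕ.<ᵇ c} t
  ... | p , q rewrite ≡ᶠ-sound f g q = ℚ.<-irrefl refl (ℚ.≤-<-trans h
    (ℚ.+-monoˡ-< (dot g xs) (ℚ.*-monoˡ-<-pos 1ℚ (ι-mono-< (ℕ.<ᵇ⇒< d c p)))))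
    where
    ι-mono-< : ∀ {a b} → a ℕ.< b → ι a ℚ.< ι b
    ι-mono-< {a} {b} h = ℚ.<-≤-trans (subst (ι a ℚ.<_) (sym (ι-+ 1 a))
      (subst (ℚ._< ι 1 ℚ.+ ι a) (ℚ.+-identityˡ (ι a)) (ℚ.+-monoˡ-< (ι a) (ℚ.positive⁻¹ 1ℚ)))) (ι-mono h)

  -- Fourier–Motzkin elimination, searching for the multipliers; only its output is checked.
  module Search where
    record Row : Set where
      constructor row
      field
        str : Bool
        coef : List ℤ
        cert : List ℕ
    open Row

    sizeℤ : ℤ → ℕ
    sizeℤ z = ℤ.∣ z ∣

    _+ˡ_ : List ℤ → List ℤ → List ℤ
    (x ∷ xs) +ˡ (y ∷ ys) = (x ℤ.+ y) ∷ (xs +ˡ ys)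
    xs +ˡ [] = xs
    [] +ˡ ys = ys

    _+ⁿ_ : List ℕ → List ℕ → List ℕ
    (x ∷ xs) +ⁿ (y ∷ ys) = (x ℕ.+ y) ∷ (xs +ⁿ ys)
    xs +ⁿ [] = xs
    [] +ⁿ ys = ys

    addScaled : ℕ → Row → ℕ → Row → Row
    addScaled a (row s f p) b (row t g q) = row (s ∨ t)
      (List.map (ℤ._* + a) f +ˡ List.map (ℤ._* + b) g) (List.map (ℕ._* a) p +ⁿ List.map (ℕ._* b) q)

    headℤ : List ℤ → ℤ
    headℤ [] = + 0
    headℤ (x ∷ _) = x

    entry : ℕ → List ℤ → ℤ
    entry _ [] = + 0
    entry zero (x ∷ _) = x
    entry (suc i) (_ ∷ xs) = entry i xs

    split : ℕ → List Row → List Row × List Row × List Row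
    split i [] = [] , [] , []
    split i (r ∷ rs) with split i rs | entry i (coef r)
    ... | ps , zs , ns | + 0 = ps , r ∷ zs , ns
    ... | ps , zs , ns | + suc _ = r ∷ ps , zs , ns
    ... | ps , zs , ns | -[1+ _ ] = ps , zs , r ∷ ns

    cross : ℕ → List Row → List Row → List Row
    cross i ps ns = List.concatMap (λ p → List.map (λ n → addScaled (sizeℤ (entry i (coef n))) p (sizeℤ (entry i (coef p))) n) ns) ps

    cost : ℕ → List Row → ℕ
    cost i rs with split i rs
    ... | ps , _ , ns = List.length ps ℕ.* List.length ns

    cheapest : List ℕ → List Row → ℕ × ℕ
    cheapest [] rs = 0 , 0
    cheapest (i ∷ []) rs = i , cost i rs
    cheapest (i ∷ is) rs with cheapest is rs | cost i rs
    ... | j , d | c = if c ℕ.≤ᵇ d then (i , c) else (j , d)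

    remove : ℕ → List ℕ → List ℕ
    remove i [] = []
    remove i (j ∷ js) = if i ℕ.≡ᵇ j then js else j ∷ remove i js

    contradictory : Row → Bool
    contradictory (row s f _) with headℤ f
    ... | + 0 = s
    ... | + suc _ = false
    ... | -[1+ _ ] = true

    pick : List Row → List ℕ
    pick [] = []
    pick (r ∷ rs) = if contradictory r then cert r else pick rs

    -- fuel, variables still to be eliminated
    eliminate : ℕ → List ℕ → List Row → List ℕ
    eliminate zero _ rs = pick rs
    eliminate (suc fuel) is rs with cheapest is rs
    ... | i , _ with split i rs
    ... | ps , zs , ns = eliminate fuel (remove i is) (cross i ps ns List.++ zs)

    toCoef : ∀ {n} → Form n → Form n → List ℤ
    toCoef [] [] = []
    toCoef (a ∷ f) (b ∷ g) = (+ b ℤ.- + a) ∷ toCoef f g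

    rows : ∀ {n} → List ℕ → List (Ineq n) → List Row
    rows pre [] = []
    rows pre (ineq s f g ∷ hs) = row s (toCoef f g) (pre List.++ (1 ∷ [])) ∷ rows (0 ∷ pre) hs

    search : ∀ {n} → List (Ineq (suc n)) → List ℕ
    -- Coordinate 0 carries the constants and is not eliminated, hence the `suc` and the n rounds.
    search {n} hs = eliminate n (List.map suc (List.upTo n)) (rows [] hs)

  refute? : ∀ {n} → List (Ineq (suc n)) → Bool
  refute? hs = absurd? (combine (Search.search hs) hs)

  refute-sound : ∀ {n} (xs : Vec ℚ n) hs → T (refute? hs) → ¬ Holdsˡ (1ℚ ∷ xs) hs
  refute-sound xs hs t ps = absurd-sound xs (combine (Search.search hs) hs) t (Holds-combine (1ℚ ∷ xs) (Search.search hs) hs ps)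

  module _ {m k : ℕ} where
    -- Natural coefficients cannot express subtraction. An expression is therefore represented by
    -- two forms, with value `pos` minus `neg`; `normal` states this without a subtraction.
    pos neg : ∀ {s} → Expr m k s → Form (suc (m ℕ.+ k))
    pos (nv i) = unit (suc (i ↑ˡ k))
    pos (rv i) = unit (suc (m ↑ʳ i))
    pos (# c) = c ∷ 0ᶠ
    pos (a ⊕ b) = pos a +ᶠ pos b
    pos (a ⊖ b) = pos a +ᶠ neg b
    pos (c · a) = c *ᶠ pos a
    pos (↑ a) = pos a
    neg (nv i) = 0ᶠ
    neg (rv i) = 0ᶠ
    neg (# c) = 0ᶠ
    neg (a ⊕ b) = neg a +ᶠ neg b
    neg (a ⊖ b) = neg a +ᶠ pos b
    neg (c · a) = c *ᶠ neg a
    neg (↑ a) = neg a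

    atLeast : ∀ {s} → Bool → Expr m k s → Expr m k s → Ineq (suc (m ℕ.+ k))
    atLeast st a b = ineq st (pos a +ᶠ neg b) (pos b +ᶠ neg a)

    one+ : Expr m k nat → Expr m k nat
    one+ a = # 1 ⊕ a

    -- Integrality is used only here and in the negated goals of `check≤`: a strict inequality
    -- between naturals becomes `1 + a ≤ b`.
    facts : Atom m k → List (Ineq (suc (m ℕ.+ k)))
    facts (_≤'_ a b) = atLeast false a b ∷ []
    facts (_<'_ {nat} a b) = atLeast false (one+ a) b ∷ []
    facts (_<'_ {rat} a b) = atLeast true a b ∷ []
    facts (_≡'_ a b) = atLeast false a b ∷ atLeast false b a ∷ []
    facts ⊥' = []

    check≤ : ∀ {s} → List (Ineq (suc (m ℕ.+ k))) → Expr m k s → Expr m k s → Bool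
    check≤ {nat} hs a b = refute? (atLeast false (one+ b) a ∷ hs)
    check≤ {rat} hs a b = refute? (atLeast true b a ∷ hs)

    check : List (Ineq (suc (m ℕ.+ k))) → Atom m k → Bool
    check hs (a ≤' b) = check≤ hs a b
    check hs (a <' b) = refute? (atLeast false b a ∷ hs)
    check hs (a ≡' b) = check≤ hs a b ∧ check≤ hs b a
    check hs ⊥' = refute? hs

    checkₛ : List (Ineq (suc (m ℕ.+ k))) → Sequent m k → Bool
    checkₛ hs (⊢ a) = check hs a
    checkₛ hs (a ⇒ s) = checkₛ (facts a List.++ hs) s

    module Sound (ns : Vec ℕ m) (xs : Vec ℚ k) where
      open Semantics ns xs

      atoms : Vec ℚ (m ℕ.+ k)
      atoms = Vec.map ι ns ++ xs

      env : Vec ℚ (suc (m ℕ.+ k))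
      env = 1ℚ ∷ atoms

      valℚ : ∀ {s} → Expr m k s → ℚ
      valℚ {nat} a = ι ⟦ a ⟧
      valℚ {rat} a = ⟦ a ⟧

      dot-const : ∀ c → dot (c ∷ 0ᶠ) env ≡ ι c
      dot-const c = trans (cong₂ ℚ._+_ (ℚ.*-identityʳ (ι c)) (dot-0 atoms)) (ℚ.+-identityʳ (ι c))

      normal : ∀ {s} (a : Expr m k s) → valℚ a ℚ.+ dot (neg a) env ≡ dot (pos a) env
      normal (nv i) = trans (cong (ι (lookup ns i) ℚ.+_) (dot-0 env)) (trans (ℚ.+-identityʳ _)
        (sym (trans (dot-unit (suc (i ↑ˡ k)) env) (trans (Vec.lookup-++ˡ (Vec.map ι ns) xs i) (Vec.lookup-map i ι ns)))))
      normal (rv i) = trans (cong (lookup xs i ℚ.+_) (dot-0 env)) (trans (ℚ.+-identityʳ _)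
        (sym (trans (dot-unit (suc (m ↑ʳ i)) env) (Vec.lookup-++ʳ (Vec.map ι ns) xs i))))
      normal (# c) = trans (cong (ι c ℚ.+_) (dot-0 env)) (trans (ℚ.+-identityʳ _) (sym (dot-const c)))
      normal (_⊕_ {nat} a b) = trans (cong₂ ℚ._+_ (ι-+ ⟦ a ⟧ ⟦ b ⟧) (dot-+ (neg a) (neg b) env))
        (trans (interchange (ι ⟦ a ⟧) (ι ⟦ b ⟧) _ _) (trans (cong₂ ℚ._+_ (normal a) (normal b)) (sym (dot-+ (pos a) (pos b) env))))
      normal (_⊕_ {rat} a b) = trans (cong (⟦ a ⟧ ℚ.+ ⟦ b ⟧ ℚ.+_) (dot-+ (neg a) (neg b) env))
        (trans (interchange ⟦ a ⟧ ⟦ b ⟧ _ _) (trans (cong₂ ℚ._+_ (normal a) (normal b)) (sym (dot-+ (pos a) (pos b) env))))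
      normal (a ⊖ b) = begin
        ⟦ a ⟧ ℚ.- ⟦ b ⟧ ℚ.+ dot (neg a +ᶠ pos b) env
          ≡⟨ cong (⟦ a ⟧ ℚ.- ⟦ b ⟧ ℚ.+_) (trans (dot-+ (neg a) (pos b) env) (cong (dot (neg a) env ℚ.+_) (sym (normal b)))) ⟩
        ⟦ a ⟧ ℚ.- ⟦ b ⟧ ℚ.+ (dot (neg a) env ℚ.+ (⟦ b ⟧ ℚ.+ dot (neg b) env))
          ≡⟨ interchange ⟦ a ⟧ (ℚ.- ⟦ b ⟧) _ _ ⟩
        ⟦ a ⟧ ℚ.+ dot (neg a) env ℚ.+ (ℚ.- ⟦ b ⟧ ℚ.+ (⟦ b ⟧ ℚ.+ dot (neg b) env))
          ≡⟨ cong₂ ℚ._+_ (normal a) (trans (sym (ℚ.+-assoc (ℚ.- ⟦ b ⟧) ⟦ b ⟧ _))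
               (trans (cong (ℚ._+ dot (neg b) env) (ℚ.+-inverseˡ ⟦ b ⟧)) (ℚ.+-identityˡ _))) ⟩
        dot (pos a) env ℚ.+ dot (neg b) env
          ≡⟨ sym (dot-+ (pos a) (neg b) env) ⟩
        dot (pos a +ᶠ neg b) env ∎
        where open ≡-Reasoning
      normal (c · a) = trans (cong₂ ℚ._+_ (ι-* c ⟦ a ⟧) (dot-* c (neg a) env))
        (trans (sym (ℚ.*-distribˡ-+ (ι c) (ι ⟦ a ⟧) (dot (neg a) env))) (trans (cong (ι c ℚ.*_) (normal a)) (sym (dot-* c (pos a) env))))
      normal (↑ a) = normal a

      atLeast-sound : ∀ {s} st (a b : Expr m k s) → Rel st (valℚ a) (valℚ b) → Holds env (atLeast st a b)
      atLeast-sound st a b h = subst₂ (Rel st)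
        (trans (sym (ℚ.+-assoc (valℚ a) _ _)) (trans (cong (ℚ._+ dot (neg b) env) (normal a)) (sym (dot-+ (pos a) (neg b) env))))
        (trans (trans (cong (valℚ b ℚ.+_) (ℚ.+-comm (dot (neg a) env) _)) (sym (ℚ.+-assoc (valℚ b) _ _)))
          (trans (cong (ℚ._+ dot (neg a) env) (normal b)) (sym (dot-+ (pos b) (neg a) env))))
        (addʳ st (dot (neg a) env ℚ.+ dot (neg b) env) h)
        where
        addʳ : ∀ st {x y} z → Rel st x y → Rel st (x ℚ.+ z) (y ℚ.+ z)
        addʳ true z = ℚ.+-monoˡ-< z
        addʳ false z = ℚ.+-monoˡ-≤ z

      facts-sound : ∀ a {hs} → ⟦ a ⟧ₐ → Holdsˡ env hs → Holdsˡ env (facts a List.++ hs)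
      facts-sound (_≤'_ {nat} a b) h ps = atLeast-sound false a b (ι-mono h) , ps
      facts-sound (_≤'_ {rat} a b) h ps = atLeast-sound false a b h , ps
      facts-sound (_<'_ {nat} a b) h ps = atLeast-sound false (one+ a) b (ι-mono h) , ps
      facts-sound (_<'_ {rat} a b) h ps = atLeast-sound true a b h , ps
      facts-sound (_≡'_ {nat} a b) h ps = atLeast-sound false a b (ℚ.≤-reflexive (cong ι h)) , atLeast-sound false b a (ℚ.≤-reflexive (cong ι (sym h))) , ps
      facts-sound (_≡'_ {rat} a b) h ps = atLeast-sound false a b (ℚ.≤-reflexive h) , atLeast-sound false b a (ℚ.≤-reflexive (sym h)) , ps

      check≤-sound : ∀ {s} hs (a b : Expr m k s) → T (check≤ hs a b) → Holdsˡ env hs → ⟦ a ≤' b ⟧ₐ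
      check≤-sound {nat} hs a b t ps = ℕ.≮⇒≥ λ h →
        refute-sound atoms (atLeast false (one+ b) a ∷ hs) t (atLeast-sound false (one+ b) a (ι-mono h) , ps)
      check≤-sound {rat} hs a b t ps = ℚ.≮⇒≥ λ h →
        refute-sound atoms (atLeast true b a ∷ hs) t (atLeast-sound true b a h , ps)

      ≤-antisym' : ∀ {s} (a b : Expr m k s) → ⟦ a ≤' b ⟧ₐ → ⟦ b ≤' a ⟧ₐ → ⟦ a ≡' b ⟧ₐ
      ≤-antisym' {nat} a b = ℕ.≤-antisym
      ≤-antisym' {rat} a b = ℚ.≤-antisym

      check-sound : ∀ hs a → T (check hs a) → Holdsˡ env hs → ⟦ a ⟧ₐ
      check-sound hs (a ≤' b) t ps = check≤-sound hs a b t ps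
      check-sound hs (_<'_ {nat} a b) t ps = ℕ.≰⇒> λ h →
        refute-sound atoms (atLeast false b a ∷ hs) t (atLeast-sound false b a (ι-mono h) , ps)
      check-sound hs (_<'_ {rat} a b) t ps = ℚ.≰⇒> λ h →
        refute-sound atoms (atLeast false b a ∷ hs) t (atLeast-sound false b a h , ps)
      check-sound hs (a ≡' b) t ps with T-∧ {check≤ hs a b} t
      ... | u , v = ≤-antisym' a b (check≤-sound hs a b u ps) (check≤-sound hs b a v ps)
      check-sound hs ⊥' t ps = refute-sound atoms hs t ps

      checkₛ-sound : ∀ hs s → T (checkₛ hs s) → Holdsˡ env hs → ⟦ s ⟧ₛ
      checkₛ-sound hs (⊢ a) t ps = check-sound hs a t ps
      checkₛ-sound hs (a ⇒ s) t ps h = checkₛ-sound (facts a List.++ hs) s t (facts-sound a h ps)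

    nonneg : List (Ineq (suc (m ℕ.+ k)))
    nonneg = List.map (λ i → atLeast {nat} false (# 0) (nv i)) (List.allFin m)

    nonneg-sound : ∀ ns xs → Holdsˡ (Sound.env ns xs) nonneg
    nonneg-sound ns xs = go (List.allFin m)
      where
      go : ∀ is → Holdsˡ (Sound.env ns xs) (List.map (λ i → atLeast {nat} false (# 0) (nv i)) is)
      go [] = tt
      go (i ∷ is) = Sound.atLeast-sound ns xs false (# 0) (nv i) (ι-nonneg (lookup ns i)) , go is

  Fun : Set → ℕ → Set → Set
  Fun A zero B = B
  Fun A (suc n) B = A → Fun A n B

  apply : ∀ {A B n} → Fun A n B → Vec A n → B
  apply f [] = f
  apply f (x ∷ xs) = apply (f x) xs

  ∀ⁿ : (A : Set) (n : ℕ) → (Vec A n → Set) → Set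
  ∀ⁿ A zero P = P []
  ∀ⁿ A (suc n) P = (a : A) → ∀ⁿ A n (λ as → P (a ∷ as))

  curryⁿ : ∀ {A} n {P : Vec A n → Set} → (∀ v → P v) → ∀ⁿ A n P
  curryⁿ zero f = f []
  curryⁿ (suc n) f a = curryⁿ n (λ v → f (a ∷ v))

  -- lin m k S proves the linear sequent S in m natural and k rational variables; valid is found by evaluation.
  sequent : ∀ m k → Fun (Expr m k nat) m (Fun (Expr m k rat) k (Sequent m k)) → Sequent m k
  sequent m k S = apply (apply S (Vec.map nv (Vec.allFin m))) (Vec.map rv (Vec.allFin k))

  opaque
    lin : ∀ m k (S : Fun (Expr m k nat) m (Fun (Expr m k rat) k (Sequent m k))) {valid : T (checkₛ (nonneg {m} {k}) (sequent m k S))} →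
          ∀ⁿ ℕ m λ ns → ∀ⁿ ℚ k λ xs → Semantics.⟦_⟧ₛ ns xs (sequent m k S)
    lin m k S {valid} = curryⁿ m λ ns → curryⁿ k λ xs →
      Sound.checkₛ-sound ns xs (nonneg {m} {k}) (sequent m k S) valid (nonneg-sound ns xs)

  ♯ : ∀ {m k} → ℕ → Expr m k rat
  ♯ c = ↑ (# c)

open LinearArithmetic using (ι; ι-+; ι-*; ι-mono; ι-nonneg; T-∧; lin; #; _⊕_; _⊖_; _·_; ↑; ♯; _≤'_; _<'_; _≡'_; ⊥'; _⇒_; ⊢_)

-- The metric of a graph: routes, the triangle inequality, decidability of distance bounds.

module Distances where
  open import Data.Rational using (_+_; _-_; _≤_; _<_; ∣_∣)

  ∣-∣-ub : ∀ x y → x - y ≤ ∣ x - y ∣ × y - x ≤ ∣ x - y ∣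
  ∣-∣-ub x y with ℚ.≤-total x y
  ... | inj₁ x≤y = ℚ.≤-trans (lin 0 2 (λ x y → x ≤' y ⇒ ⊢ x ⊖ y ≤' ♯ 0) x y x≤y) (ℚ.0≤∣p∣ (x - y))
                 , ℚ.≤-reflexive (sym (trans (cong ∣_∣ (lin 0 2 (λ x y → ⊢ x ⊖ y ≡' ♯ 0 ⊖ (y ⊖ x)) x y))
                     (trans (cong ∣_∣ (ℚ.+-identityˡ _)) (trans (ℚ.∣-p∣≡∣p∣ (y - x)) (ℚ.0≤p⇒∣p∣≡p (lin 0 2 (λ x y → x ≤' y ⇒ ⊢ ♯ 0 ≤' y ⊖ x) x y x≤y))))))
  ... | inj₂ y≤x = ℚ.≤-reflexive (sym (ℚ.0≤p⇒∣p∣≡p (lin 0 2 (λ x y → y ≤' x ⇒ ⊢ ♯ 0 ≤' x ⊖ y) x y y≤x)))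
                 , ℚ.≤-trans (lin 0 2 (λ x y → y ≤' x ⇒ ⊢ y ⊖ x ≤' ♯ 0) x y y≤x) (ℚ.0≤∣p∣ (x - y))

  ∣-∣-cases : ∀ x y → ∣ x - y ∣ ≡ x - y ⊎ ∣ x - y ∣ ≡ y - x
  ∣-∣-cases x y with ℚ.∣p∣≡p∨∣p∣≡-p (x - y)
  ... | inj₁ e = inj₁ e
  ... | inj₂ e = inj₂ (trans e (trans (sym (ℚ.+-identityˡ (ℚ.- (x - y)))) (lin 0 2 (λ x y → ⊢ ♯ 0 ⊖ (x ⊖ y) ≡' y ⊖ x) x y)))

  ∣-∣-≤ : ∀ x y {z} → x - y ≤ z → y - x ≤ z → ∣ x - y ∣ ≤ z
  ∣-∣-≤ x y h k with ∣-∣-cases x y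
  ... | inj₁ e = ℚ.≤-trans (ℚ.≤-reflexive e) h
  ... | inj₂ e = ℚ.≤-trans (ℚ.≤-reflexive e) k

  ∣-∣-sym : ∀ x y → ∣ x - y ∣ ≡ ∣ y - x ∣
  ∣-∣-sym x y = ℚ.≤-antisym (∣-∣-≤ x y (proj₂ (∣-∣-ub y x)) (proj₁ (∣-∣-ub y x)))
    (∣-∣-≤ y x (proj₂ (∣-∣-ub x y)) (proj₁ (∣-∣-ub x y)))

  ∣-∣-of-≤ : ∀ {x y} → x ≤ y → ∣ y - x ∣ ≡ y - x
  ∣-∣-of-≤ {x} {y} h = ℚ.0≤p⇒∣p∣≡p (lin 0 2 (λ x y → x ≤' y ⇒ ⊢ ♯ 0 ≤' y ⊖ x) x y h)

  ∣-∣-triangle : ∀ x y z → ∣ x - z ∣ ≤ ∣ x - y ∣ + ∣ y - z ∣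
  ∣-∣-triangle x y z = subst (λ e → ∣ e ∣ ≤ ∣ x - y ∣ + ∣ y - z ∣) (lin 0 3 (λ x y z → ⊢ x ⊖ y ⊕ (y ⊖ z) ≡' x ⊖ z) x y z)
    (ℚ.∣p+q∣≤∣p∣+∣q∣ (x - y) (y - z))

  module Metric {n : ℕ} (G : Graph n) where
    open Graph G
    open Point

    infixr 5 _++ʷ_
    _++ʷ_ : ∀ {k l u v w} → Walk G k u v → Walk G l v w → Walk G (k ℕ.+ l) u w
    [] ++ʷ q = q
    (e ∷ p) ++ʷ q = e ∷ (p ++ʷ q)

    adj-sym : ∀ {u v} → adj u v ≡ true → adj v u ≡ true
    adj-sym {u} {v} e = trans (symm v u) e

    reverseʷ : ∀ {k u v} → Walk G k u v → Walk G k v u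
    reverseʷ {k} {u} {v} p = subst (λ k → Walk G k v u) (ℕ.+-identityʳ k) (onto p [])
      where
      onto : ∀ {k l u v w} → Walk G k u v → Walk G l u w → Walk G (k ℕ.+ l) v w
      onto [] q = q
      onto {suc k} {l} {v = v} {w} (e ∷ p) q = subst (λ k → Walk G k v w) (ℕ.+-suc k l) (onto p (adj-sym e ∷ q))

    edgeʷ : ∀ {u v} → adj u v ≡ true → Walk G 1 u v
    edgeʷ e = e ∷ []

    -- Half a route, from a point to a vertex. Composition of routes is reduced to extending such
    -- halves by walks.
    Reach : Point G → Fin n → ℚ → Set
    Reach p v ℓ = ∃ λ u → ∃ λ k → ∃ λ c → Exit G p u c × Walk G k u v × ℓ ≡ c + ι k

    ReachLe : Point G → Fin n → ℚ → Set
    ReachLe p v r = ∃ λ ℓ → Reach p v ℓ × ℓ ≤ r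

    exit≥0 : ∀ p {v c} → Exit G p v c → 0ℚ ≤ c
    exit≥0 p (inj₁ (refl , refl)) = t≥0 p
    exit≥0 p (inj₂ (refl , refl)) = lin 0 1 (λ t → t ≤' ♯ 1 ⇒ ⊢ ♯ 0 ≤' ♯ 1 ⊖ t) (t p) (t≤1 p)

    exit≤1 : ∀ p {v c} → Exit G p v c → c ≤ 1ℚ
    exit≤1 p (inj₁ (refl , refl)) = t≤1 p
    exit≤1 p (inj₂ (refl , refl)) = lin 0 1 (λ t → ♯ 0 ≤' t ⇒ ⊢ ♯ 1 ⊖ t ≤' ♯ 1) (t p) (t≥0 p)

    -- Two routes that meet at p may use different ends of its edge. The costs of the two ends add
    -- up to at least the length of the walk between them, so p can be bypassed.
    across : ∀ p {u v c d} → Exit G p u c → Exit G p v d → ∃ λ k → Walk G k u v × ι k ≤ c + d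
    across p (inj₁ (refl , refl)) (inj₁ (refl , refl)) =
      0 , [] , lin 0 1 (λ t → ♯ 0 ≤' t ⇒ ⊢ ♯ 0 ≤' t ⊕ t) (t p) (t≥0 p)
    across p (inj₁ (refl , refl)) (inj₂ (refl , refl)) =
      1 , edgeʷ (edge p) , lin 0 1 (λ t → ⊢ ♯ 1 ≤' t ⊕ (♯ 1 ⊖ t)) (t p)
    across p (inj₂ (refl , refl)) (inj₁ (refl , refl)) =
      1 , edgeʷ (adj-sym (edge p)) , lin 0 1 (λ t → ⊢ ♯ 1 ≤' (♯ 1 ⊖ t) ⊕ t) (t p)
    across p (inj₂ (refl , refl)) (inj₂ (refl , refl)) =
      0 , [] , lin 0 1 (λ t → t ≤' ♯ 1 ⇒ ⊢ ♯ 0 ≤' (♯ 1 ⊖ t) ⊕ (♯ 1 ⊖ t)) (t p) (t≤1 p)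

    reach-walk : ∀ p {v w ℓ k} → Reach p v ℓ → Walk G k v w → Reach p w (ℓ + ι k)
    reach-walk p {k = k} (u , j , c , e , s , refl) r = u , j ℕ.+ k , c , e , s ++ʷ r ,
      trans (ℚ.+-assoc c (ι j) (ι k)) (cong (c +_) (sym (ι-+ j k)))

    exit-reach : ∀ p {v c} → Exit G p v c → Reach p v c
    exit-reach p {c = c} e = _ , 0 , c , e , [] , sym (ℚ.+-identityʳ c)

    reach-exit : ∀ p q {v ℓ c} → Reach p v ℓ → Exit G q v c → Route G p q (ℓ + c)
    reach-exit p q {c = c} (u , k , d , e , s , refl) e' = inj₁ (u , _ , k , d , c , e , e' , s , refl)

    route-sym : ∀ p q {ℓ} → Route G p q ℓ → Route G q p ℓ
    route-sym p q (inj₁ (v , w , k , c , d , e , e' , s , refl)) =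
      inj₁ (w , v , k , d , c , e' , e , reverseʷ s , lin 1 2 (λ k c d → ⊢ c ⊕ ↑ k ⊕ d ≡' d ⊕ ↑ k ⊕ c) k c d)
    route-sym p q (inj₂ (inj₁ (h , h' , refl))) = inj₂ (inj₁ (sym h , sym h' , ∣-∣-sym (t p) (t q)))
    route-sym p q (inj₂ (inj₂ (h , h' , refl))) = inj₂ (inj₂ (sym h' , sym h ,
      cong ∣_∣ (lin 0 2 (λ x y → ⊢ x ⊖ (♯ 1 ⊖ y) ≡' y ⊖ (♯ 1 ⊖ x)) (t p) (t q))))

    meet : ∀ p q {v w k ℓ m} → Reach p v ℓ → Walk G k v w → Reach q w m → Route G p q (ℓ + ι k + m)
    meet p q {k = k} {ℓ} r s (u , j , c , e , s' , refl) =
      subst (Route G p q) (lin 2 2 (λ k j x c → ⊢ x ⊕ ↑ k ⊕ ↑ j ⊕ c ≡' x ⊕ ↑ k ⊕ (c ⊕ ↑ j)) k j ℓ c)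
        (reach-exit p q (reach-walk p (reach-walk p r s) (reverseʷ s')) e)

    route-reach : ∀ p q {v ℓ m} → Route G p q ℓ → Reach q v m → ReachLe p v (ℓ + m)
    route-reach p q (inj₁ (v , w , k , c , d , e , e' , s , refl)) (u , j , c' , e″ , s' , refl) = bridge (across q e' e″)
      where
      bridge : (∃ λ i → Walk G i w u × ι i ≤ d + c') → ReachLe p _ (c + ι k + d + (c' + ι j))
      bridge (i , r , h) = c + ι (k ℕ.+ (i ℕ.+ j)) , (v , k ℕ.+ (i ℕ.+ j) , c , e , s ++ʷ r ++ʷ s' , refl) ,
        lin 3 3 (λ k i j c d c' → ↑ i ≤' d ⊕ c' ⇒ ⊢ c ⊕ ↑ (k ⊕ (i ⊕ j)) ≤' c ⊕ ↑ k ⊕ d ⊕ (c' ⊕ ↑ j)) k i j c d c' h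
    route-reach p q (inj₂ (inj₁ (refl , refl , refl))) (u , j , c , inj₁ (refl , refl) , s , refl) =
      _ , (u , j , t p , inj₁ (refl , refl) , s , refl) ,
      lin 1 3 (λ j x y z → x ⊖ y ≤' z ⇒ ⊢ x ⊕ ↑ j ≤' z ⊕ (y ⊕ ↑ j)) j (t p) (t q) _ (proj₁ (∣-∣-ub (t p) (t q)))
    route-reach p q (inj₂ (inj₁ (refl , refl , refl))) (u , j , c , inj₂ (refl , refl) , s , refl) =
      _ , (u , j , 1ℚ - t p , inj₂ (refl , refl) , s , refl) ,
      lin 1 3 (λ j x y z → y ⊖ x ≤' z ⇒ ⊢ ♯ 1 ⊖ x ⊕ ↑ j ≤' z ⊕ ((♯ 1 ⊖ y) ⊕ ↑ j)) j (t p) (t q) _ (proj₂ (∣-∣-ub (t p) (t q)))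
    route-reach p q (inj₂ (inj₂ (refl , refl , refl))) (u , j , c , inj₁ (refl , refl) , s , refl) =
      _ , (u , j , 1ℚ - t p , inj₂ (refl , refl) , s , refl) ,
      lin 1 3 (λ j x y z → ♯ 1 ⊖ y ⊖ x ≤' z ⇒ ⊢ ♯ 1 ⊖ x ⊕ ↑ j ≤' z ⊕ (y ⊕ ↑ j)) j (t p) (t q) _ (proj₂ (∣-∣-ub (t p) (1ℚ - t q)))
    route-reach p q (inj₂ (inj₂ (refl , refl , refl))) (u , j , c , inj₂ (refl , refl) , s , refl) =
      _ , (u , j , t p , inj₁ (refl , refl) , s , refl) ,
      lin 1 3 (λ j x y z → x ⊖ (♯ 1 ⊖ y) ≤' z ⇒ ⊢ x ⊕ ↑ j ≤' z ⊕ ((♯ 1 ⊖ y) ⊕ ↑ j)) j (t p) (t q) _ (proj₁ (∣-∣-ub (t p) (1ℚ - t q)))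

    route-walk : ∀ p q s {ℓ v w k c d} → Route G p q ℓ → Exit G q v c → Exit G s w d → Walk G k v w →
                 DistLe G p s (ℓ + (c + ι k + d))
    route-walk p q s {ℓ} {k = k} {c} {d} r e e' x = bridge (route-reach p q r (_ , k , c , e , x , refl))
      where
      bridge : ReachLe p _ (ℓ + (c + ι k)) → DistLe G p s (ℓ + (c + ι k + d))
      bridge (m , r' , h) = m + d , reach-exit p s r' e' ,
        lin 1 4 (λ k ℓ c d m → m ≤' ℓ ⊕ (c ⊕ ↑ k) ⇒ ⊢ m ⊕ d ≤' ℓ ⊕ (c ⊕ ↑ k ⊕ d)) k ℓ c d m h

    distLe-sym : ∀ p q {r} → DistLe G p q r → DistLe G q p r
    distLe-sym p q (ℓ , r , h) = ℓ , route-sym p q r , h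

    distLe-weaken : ∀ p q {r s} → r ≤ s → DistLe G p q r → DistLe G p q s
    distLe-weaken p q h (ℓ , r , h') = ℓ , r , ℚ.≤-trans h' h

    -- A route that contains a walk absorbs the other one by `route-walk`, after reversal if it
    -- comes first. Two direct routes stay on one edge, where the parameters are compared, with
    -- `1 - t` for a flipped edge.
    route-trans : ∀ p q s {ℓ m} → Route G p q ℓ → Route G q s m → DistLe G p s (ℓ + m)
    route-trans p q s r (inj₁ (v , w , k , c , d , e , e' , x , refl)) = route-walk p q s r e e' x
    route-trans p q s {m = m} r@(inj₁ (v , w , k , c , d , e , e' , x , refl)) r'@(inj₂ _) =
      distLe-sym s p (distLe-weaken s p (ℚ.≤-reflexive (lin 1 3 (λ k m c d → ⊢ m ⊕ (d ⊕ ↑ k ⊕ c) ≡' c ⊕ ↑ k ⊕ d ⊕ m) k m c d))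
        (route-walk s q p (route-sym q s r') e' e (reverseʷ x)))
    route-trans p q s (inj₂ (inj₁ (h , h' , refl))) (inj₂ (inj₁ (k , k' , refl))) =
      _ , inj₂ (inj₁ (trans h k , trans h' k' , refl)) , ∣-∣-triangle (t p) (t q) (t s)
    route-trans p q s (inj₂ (inj₁ (h , h' , refl))) (inj₂ (inj₂ (k , k' , refl))) =
      _ , inj₂ (inj₂ (trans h k , trans h' k' , refl)) , ∣-∣-triangle (t p) (t q) (1ℚ - t s)
    route-trans p q s (inj₂ (inj₂ (h , h' , refl))) (inj₂ (inj₁ (k , k' , refl))) =
      _ , inj₂ (inj₂ (trans h k' , trans h' k , refl)) ,
      ∣-∣-≤ (t p) (1ℚ - t s)
        (lin 0 5 (λ x y z e f → x ⊖ (♯ 1 ⊖ y) ≤' e ⇒ z ⊖ y ≤' f ⇒ ⊢ x ⊖ (♯ 1 ⊖ z) ≤' e ⊕ f) (t p) (t q) (t s) _ _ (proj₁ (∣-∣-ub (t p) (1ℚ - t q))) (proj₂ (∣-∣-ub (t q) (t s))))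
        (lin 0 5 (λ x y z e f → ♯ 1 ⊖ y ⊖ x ≤' e ⇒ y ⊖ z ≤' f ⇒ ⊢ ♯ 1 ⊖ z ⊖ x ≤' e ⊕ f) (t p) (t q) (t s) _ _ (proj₂ (∣-∣-ub (t p) (1ℚ - t q))) (proj₁ (∣-∣-ub (t q) (t s))))
    route-trans p q s (inj₂ (inj₂ (h , h' , refl))) (inj₂ (inj₂ (k , k' , refl))) =
      _ , inj₂ (inj₁ (trans h k' , trans h' k , refl)) ,
      ∣-∣-≤ (t p) (t s)
        (lin 0 5 (λ x y z e f → x ⊖ (♯ 1 ⊖ y) ≤' e ⇒ ♯ 1 ⊖ z ⊖ y ≤' f ⇒ ⊢ x ⊖ z ≤' e ⊕ f) (t p) (t q) (t s) _ _ (proj₁ (∣-∣-ub (t p) (1ℚ - t q))) (proj₂ (∣-∣-ub (t q) (1ℚ - t s))))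
        (lin 0 5 (λ x y z e f → ♯ 1 ⊖ y ⊖ x ≤' e ⇒ y ⊖ (♯ 1 ⊖ z) ≤' f ⇒ ⊢ z ⊖ x ≤' e ⊕ f) (t p) (t q) (t s) _ _ (proj₂ (∣-∣-ub (t p) (1ℚ - t q))) (proj₁ (∣-∣-ub (t q) (1ℚ - t s))))

    route≥0 : ∀ p q {ℓ} → Route G p q ℓ → 0ℚ ≤ ℓ
    route≥0 p q (inj₁ (v , w , k , c , d , e , e' , s , refl)) =
      lin 1 2 (λ k c d → ♯ 0 ≤' c ⇒ ♯ 0 ≤' d ⇒ ⊢ ♯ 0 ≤' c ⊕ ↑ k ⊕ d) k c d (exit≥0 p e) (exit≥0 q e')
    route≥0 p q (inj₂ (inj₁ (_ , _ , refl))) = ℚ.0≤∣p∣ (t p - t q)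
    route≥0 p q (inj₂ (inj₂ (_ , _ , refl))) = ℚ.0≤∣p∣ (t p - (1ℚ - t q))

    walk? : ∀ k u v → Dec (Walk G k u v)
    walk? zero u v = map′ (λ { refl → [] }) (λ { [] → refl }) (u Fin.≟ v)
    walk? (suc k) u v = map′ (λ { (w , e , p) → e ∷ p }) (λ { (e ∷ p) → _ , e , p })
      (Fin.any? λ w → (adj u w Bool.≟ true) ×-dec walk? k w v)

    shortest : ∀ {k u v} → Walk G k u v → ∃ λ m → Walk G m u v × (∀ j → Walk G j u v → m ℕ.≤ j)
    shortest {k} {u} {v} p = go k 0 (ℕ.+-identityʳ k) (λ _ ())
      where
      go : ∀ fuel i → fuel ℕ.+ i ≡ k → (∀ j → j ℕ.< i → ¬ Walk G j u v) → ∃ λ m → Walk G m u v × (∀ j → Walk G j u v → m ℕ.≤ j)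
      go fuel i h none with walk? i u v
      ... | yes q = i , q , λ j r → ℕ.≮⇒≥ λ j<i → none j j<i r
      go zero i refl none | no ¬q = ⊥-elim (¬q p)
      go (suc fuel) i h none | no ¬q = go fuel (suc i) (trans (ℕ.+-suc fuel i) h) λ j j<1+i r →
        [ (λ j<i → none j j<i r) , (λ { refl → ¬q r }) ]′ (ℕ.m≤n⇒m<n∨m≡n (ℕ.≤-pred j<1+i))

    module Decide (connected : Connected G) where
      private
        end : Point G → Bool → Fin n
        end p true = a p
        end p false = b p

        cost : Point G → Bool → ℚ
        cost p true = t p
        cost p false = 1ℚ - t p

        end-exit : ∀ p i → Exit G p (end p i) (cost p i)
        end-exit p true = inj₁ (refl , refl)
        end-exit p false = inj₂ (refl , refl)

        both : {P : Bool → Set} {A : Set} → (∀ i → A ⊎ P i) → A ⊎ (∀ i → P i)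
        both f = [ inj₁ , (λ x → [ inj₁ , (λ y → inj₂ λ { true → x ; false → y }) ]′ (f false)) ]′ (f true)

        Shortest : Fin n → Fin n → Set
        Shortest u v = ∃ λ m → Walk G m u v × (∀ j → Walk G j u v → m ℕ.≤ j)

        geodesic : ∀ u v → Shortest u v
        geodesic u v = shortest (proj₂ (connected u v))

      module _ (p : Point G) (v : Fin n) (σ : ℚ) where
        Near Far : Set
        Near = ∃ λ ℓ → Reach p v ℓ × ℓ < σ
        Far = ∀ ℓ → Reach p v ℓ → σ ≤ ℓ

        reach-near-or-far : Near ⊎ Far
        reach-near-or-far = [ inj₁ , (λ h → inj₂ (far h)) ]′ (both near-end)
          where
          FarVia : Bool → Set
          FarVia i = ∀ k → Walk G k (end p i) v → σ ≤ cost p i + ι k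

          near-end : ∀ i → Near ⊎ FarVia i
          near-end i = compare (geodesic (end p i) v)
            where
            compare : Shortest (end p i) v → Near ⊎ FarVia i
            compare (m , x , least) = decide (cost p i + ι m ℚ.<? σ)
              where
              decide : Dec (cost p i + ι m < σ) → Near ⊎ FarVia i
              decide (yes h) = inj₁ (cost p i + ι m , (end p i , m , cost p i , end-exit p i , x , refl) , h)
              decide (no h) = inj₂ λ k y → ℚ.≤-trans (ℚ.≮⇒≥ h) (ℚ.+-monoʳ-≤ (cost p i) (ι-mono (least k y)))

          far : (∀ i → FarVia i) → Far
          far h _ (_ , k , _ , inj₁ (refl , refl) , x , refl) = h true k x
          far h _ (_ , k , _ , inj₂ (refl , refl) , x , refl) = h false k x

      module _ (p q : Point G) (ρ : ℚ) where
        private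
          Goal : Set
          Goal = DistLe G p q ρ

          FarVia : Bool → Bool → Set
          FarVia i j = ∀ k → Walk G k (end p i) (end q j) → ρ < cost p i + ι k + cost q j

          near-ends : ∀ i j → Goal ⊎ FarVia i j
          near-ends i j = compare (geodesic (end p i) (end q j))
            where
            compare : Shortest (end p i) (end q j) → Goal ⊎ FarVia i j
            compare (m , x , least) = decide (cost p i + ι m + cost q j ℚ.≤? ρ)
              where
              decide : Dec (cost p i + ι m + cost q j ≤ ρ) → Goal ⊎ FarVia i j
              decide (yes h) = inj₁ (cost p i + ι m + cost q j ,
                inj₁ (end p i , end q j , m , cost p i , cost q j , end-exit p i , end-exit q j , x , refl) , h)
              decide (no h) = inj₂ λ k y → ℚ.<-≤-trans (ℚ.≰⇒> h)
                (ℚ.+-monoˡ-≤ (cost q j) (ℚ.+-monoʳ-≤ (cost p i) (ι-mono (least k y))))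

          Same Flipped : ℚ → Set
          Same ℓ = a p ≡ a q × b p ≡ b q × ℓ ≡ ∣ t p - t q ∣
          Flipped ℓ = a p ≡ b q × b p ≡ a q × ℓ ≡ ∣ t p - (1ℚ - t q) ∣

          near-same : Goal ⊎ (∀ ℓ → Same ℓ → ρ < ℓ)
          near-same = decide ((a p Fin.≟ a q) ×-dec (b p Fin.≟ b q) ×-dec (∣ t p - t q ∣ ℚ.≤? ρ))
            where
            decide : Dec (a p ≡ a q × b p ≡ b q × ∣ t p - t q ∣ ≤ ρ) → Goal ⊎ (∀ ℓ → Same ℓ → ρ < ℓ)
            decide (yes (e , e' , h)) = inj₁ (∣ t p - t q ∣ , inj₂ (inj₁ (e , e' , refl)) , h)
            decide (no ¬x) = inj₂ λ { _ (e , e' , refl) → ℚ.≰⇒> λ h → ¬x (e , e' , h) }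

          near-flipped : Goal ⊎ (∀ ℓ → Flipped ℓ → ρ < ℓ)
          near-flipped = decide ((a p Fin.≟ b q) ×-dec (b p Fin.≟ a q) ×-dec (∣ t p - (1ℚ - t q) ∣ ℚ.≤? ρ))
            where
            decide : Dec (a p ≡ b q × b p ≡ a q × ∣ t p - (1ℚ - t q) ∣ ≤ ρ) → Goal ⊎ (∀ ℓ → Flipped ℓ → ρ < ℓ)
            decide (yes (e , e' , h)) = inj₁ (∣ t p - (1ℚ - t q) ∣ , inj₂ (inj₂ (e , e' , refl)) , h)
            decide (no ¬x) = inj₂ λ { _ (e , e' , refl) → ℚ.≰⇒> λ h → ¬x (e , e' , h) }

          far : (∀ i j → FarVia i j) → (∀ ℓ → Same ℓ → ρ < ℓ) → (∀ ℓ → Flipped ℓ → ρ < ℓ) → DistGt G p q ρ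
          far h _ _ _ (inj₁ (_ , _ , k , _ , _ , inj₁ (refl , refl) , inj₁ (refl , refl) , s , refl)) = h true true k s
          far h _ _ _ (inj₁ (_ , _ , k , _ , _ , inj₁ (refl , refl) , inj₂ (refl , refl) , s , refl)) = h true false k s
          far h _ _ _ (inj₁ (_ , _ , k , _ , _ , inj₂ (refl , refl) , inj₁ (refl , refl) , s , refl)) = h false true k s
          far h _ _ _ (inj₁ (_ , _ , k , _ , _ , inj₂ (refl , refl) , inj₂ (refl , refl) , s , refl)) = h false false k s
          far _ h _ ℓ (inj₂ (inj₁ r)) = h ℓ r
          far _ _ h ℓ (inj₂ (inj₂ r)) = h ℓ r

        -- There are infinitely many routes, but only the shortest walks between the ends of the two
        -- edges and the two direct routes matter, so a comparison with ρ takes finitely many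
        -- decisions.
        near-or-far : DistLe G p q ρ ⊎ DistGt G p q ρ
        near-or-far = [ inj₁ , (λ f → [ inj₁ , (λ g → [ inj₁ , (λ h → inj₂ (far f g h)) ]′ near-flipped) ]′ near-same) ]′
          (both λ i → both λ j → near-ends i j)

open Distances

-- Walks, simple paths and cycles as sequences of vertices.

module Paths where
  open import Data.Nat using (_+_; _∸_; _≤_; _<_)

  search≤ : {P : ℕ → Set} → (∀ i → Dec (P i)) → ∀ k → Dec (∃ λ i → i ≤ k × P i)
  search≤ {P} P? k = map′ (λ { (i , h) → toℕ i , h })
    (λ { (i , i≤k , h) → fromℕ< (s≤s i≤k) , subst (λ x → x ≤ k × P x) (sym (Fin.toℕ-fromℕ< (s≤s i≤k))) (i≤k , h) })
    (Fin.any? {suc k} λ i → (toℕ i ℕ.≤? k) ×-dec P? (toℕ i))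

  -- Sequences are total functions whose length is kept apart. Here s contributes the entries 0 to
  -- k, so that t starts at index `suc k`.
  append : {A : Set} → (ℕ → A) → ℕ → (ℕ → A) → ℕ → A
  append s zero t zero = s zero
  append s zero t (suc i) = t i
  append s (suc k) t zero = s zero
  append s (suc k) t (suc i) = append (λ i → s (suc i)) k t i

  append-left : ∀ {A : Set} (s : ℕ → A) k t {i} → i ≤ k → append s k t i ≡ s i
  append-left s zero t z≤n = refl
  append-left s (suc k) t {zero} _ = refl
  append-left s (suc k) t {suc i} (s≤s h) = append-left (λ i → s (suc i)) k t h

  append-right : ∀ {A : Set} (s : ℕ → A) k t j → append s k t (suc k + j) ≡ t j
  append-right s zero t j = refl
  append-right s (suc k) t j = append-right (λ i → s (suc i)) k t j

  side : ∀ k i → i ≤ k ⊎ ∃ λ j → i ≡ suc k + j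
  side k i with i ℕ.≤? k
  ... | yes h = inj₁ h
  ... | no h = inj₂ (i ∸ suc k , sym (ℕ.m+[n∸m]≡n (ℕ.≰⇒> h)))

  module Sequences {n : ℕ} (G : Graph n) where
    open Graph G
    open Metric G

    V : Set
    V = Fin n

    Path : (ℕ → V) → ℕ → Set
    Path s k = ∀ i → i < k → adj (s i) (s (suc i)) ≡ true

    Inj : (ℕ → V) → ℕ → Set
    Inj s k = ∀ i j → i < j → j ≤ k → s i ≢ s j

    at : ∀ {k u v} → Walk G k u v → ℕ → V
    at ([] {u}) _ = u
    at (_∷_ {u = u} e p) zero = u
    at (e ∷ p) (suc i) = at p i

    at-start : ∀ {k u v} (p : Walk G k u v) → at p 0 ≡ u
    at-start [] = refl
    at-start (e ∷ p) = refl

    at-end : ∀ {k u v} (p : Walk G k u v) → at p k ≡ v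
    at-end [] = refl
    at-end (e ∷ p) = at-end p

    at-path : ∀ {k u v} (p : Walk G k u v) → Path (at p) k
    at-path (e ∷ p) zero _ = subst (λ w → adj _ w ≡ true) (sym (at-start p)) e
    at-path (e ∷ p) (suc i) (s≤s h) = at-path p i h

    segment : ∀ (s : ℕ → V) d i → (∀ x → i ≤ x → x < i + d → adj (s x) (s (suc x)) ≡ true) → Walk G d (s i) (s (i + d))
    segment s zero i h = subst (λ j → Walk G 0 (s i) (s j)) (sym (ℕ.+-identityʳ i)) []
    segment s (suc d) i h = h i ℕ.≤-refl (ℕ.m<m+n i (s≤s z≤n)) ∷
      subst (λ j → Walk G d (s (suc i)) (s j)) (sym (ℕ.+-suc i d))
        (segment s d (suc i) λ x a b → h x (ℕ.≤-trans (ℕ.n≤1+n i) a) (subst (x <_) (sym (ℕ.+-suc i d)) b))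

    path-walk : ∀ {s k} → Path s k → ∀ {i j} → i ≤ j → j ≤ k → Walk G (j ∸ i) (s i) (s j)
    path-walk {s} {k} p {i} {j} i≤j j≤k = subst (λ x → Walk G (j ∸ i) (s i) (s x)) (ℕ.m+[n∸m]≡n i≤j)
      (segment s (j ∸ i) i λ x _ h → p x (ℕ.<-≤-trans (subst (x <_) (ℕ.m+[n∸m]≡n i≤j) h) j≤k))

    path-append : ∀ {s k t l} → Path s k → Path t l → adj (s k) (t 0) ≡ true → Path (append s k t) (suc k + l)
    path-append {s} {k} {t} {l} p q e i h with side k (suc i)
    ... | inj₁ i<k rewrite append-left s k t (ℕ.<⇒≤ i<k) | append-left s k t i<k = p i i<k
    ... | inj₂ (zero , refl) rewrite ℕ.+-identityʳ k | append-left s k t (ℕ.≤-refl {k})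
        = subst (λ x → adj (s k) x ≡ true) (sym (subst (λ x → append s k t x ≡ t 0) (ℕ.+-identityʳ (suc k)) (append-right s k t 0))) e
    ... | inj₂ (suc j , refl) rewrite ℕ.+-suc k j | append-right s k t j
        = subst (λ x → adj (t j) x ≡ true) (sym (subst (λ x → append s k t x ≡ t (suc j)) (ℕ.+-suc (suc k) j) (append-right s k t (suc j))))
            (q j (ℕ.+-cancelˡ-≤ k _ _ (subst (_≤ k + l) (sym (ℕ.+-suc k j)) (ℕ.≤-pred h))))

    inj-append : ∀ {s k t l} → Inj s k → Inj t l → (∀ i j → i ≤ k → j ≤ l → s i ≢ t j) → Inj (append s k t) (suc k + l)
    inj-append {s} {k} {t} {l} p q d i j i<j j≤ with side k i | side k j
    ... | inj₁ a | inj₁ b = λ e → p i j i<j b (trans (sym (append-left s k t a)) (trans e (append-left s k t b)))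
    ... | inj₁ a | inj₂ (y , refl) = λ e → d i y a (ℕ.+-cancelˡ-≤ (suc k) _ _ j≤) (trans (sym (append-left s k t a)) (trans e (append-right s k t y)))
    ... | inj₂ (x , refl) | inj₁ b = ⊥-elim (lin 3 0 (λ k x j → # 1 ⊕ k ⊕ x <' j ⇒ j ≤' k ⇒ ⊢ ⊥') k x j i<j b)
    ... | inj₂ (x , refl) | inj₂ (y , refl) = λ e → q x y (ℕ.+-cancelˡ-< (suc k) _ _ i<j) (ℕ.+-cancelˡ-≤ (suc k) _ _ j≤)
      (trans (sym (append-right s k t x)) (trans e (append-right s k t y)))

    path-reverse : ∀ {s k} → Path s k → Path (λ i → s (k ∸ i)) k
    path-reverse {s} {k} p i i<k = adj-sym (subst (λ x → adj (s (k ∸ suc i)) (s x) ≡ true) (sym (ℕ.+-∸-assoc 1 i<k))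
      (p (k ∸ suc i) (ℕ.∸-monoʳ-< (s≤s z≤n) i<k)))

    inj-reverse : ∀ {s k} → Inj s k → Inj (λ i → s (k ∸ i)) k
    inj-reverse {s} {k} p i j i<j j≤k e = p (k ∸ j) (k ∸ i) (ℕ.∸-monoʳ-< i<j j≤k) (ℕ.m∸n≤m k i) (sym e)

    path-restrict : ∀ {s k l} → l ≤ k → Path s k → Path s l
    path-restrict l≤k p i h = p i (ℕ.<-≤-trans h l≤k)

    inj-restrict : ∀ {s k l} → l ≤ k → Inj s k → Inj s l
    inj-restrict l≤k p i j a b = p i j a (ℕ.≤-trans b l≤k)

    inj-both : ∀ {s k} → Inj s k → ∀ {i j} → i ≤ k → j ≤ k → s i ≡ s j → i ≡ j
    inj-both p {i} {j} a b e with ℕ.<-cmp i j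
    ... | tri< h _ _ = ⊥-elim (p i j h b e)
    ... | tri≈ _ h _ = h
    ... | tri> _ _ h = ⊥-elim (p j i h a (sym e))

    toCycle : ∀ {s k} → 2 ≤ k → Path s k → Inj s k → adj (s k) (s 0) ≡ true → Cycle G k
    toCycle {s} {k} 2≤k p q e = record
      { long = s≤s 2≤k
      ; vs = λ i → s (toℕ i)
      ; inj = λ {i} {j} h → Fin.toℕ-injective (inj-both q (ℕ.≤-pred (Fin.toℕ<n i)) (ℕ.≤-pred (Fin.toℕ<n j)) h)
      ; step = λ i → subst (λ x → adj (s x) (s (suc (toℕ i))) ≡ true) (sym (Fin.toℕ-inject₁ i)) (p (toℕ i) (Fin.toℕ<n i))
      ; close = subst (λ x → adj (s x) (s 0) ≡ true) (sym (Fin.toℕ-fromℕ k)) e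
      }

    record Simplified (P : V → Set) (s : ℕ → V) (k : ℕ) : Set where
      constructor simplified
      field
        seq : ℕ → V
        len : ℕ
        len≤ : len ≤ k
        path : Path seq len
        simple : Inj seq len
        start : seq 0 ≡ s 0
        end : seq len ≡ s k
        inside : ∀ i → i ≤ len → P (seq i)

    opaque
      -- A repeated vertex allows the stretch between its two occurrences to be cut out. The
      -- property P survives the cutting; it serves to keep a walk outside a ball.
      simplify : ∀ {P : V → Set} {s} k → Path s k → (∀ i → i ≤ k → P (s i)) → Simplified P s k
      simplify {P} k = go k (<-wellFounded k)
        where
        go : ∀ {s} k → Acc _<_ k → Path s k → (∀ i → i ≤ k → P (s i)) → Simplified P s k
        go {s} k (acc rec) p h with search≤ (λ i → search≤ (λ j → (i ℕ.<? j) ×-dec (s i Fin.≟ s j)) k) k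
        ... | no none = simplified s k ℕ.≤-refl p (λ i j i<j j≤k e → none (i , ℕ.≤-trans (ℕ.<⇒≤ i<j) j≤k , j , j≤k , i<j , e)) refl refl h
        ... | yes (i , i≤k , j , j≤k , i<j , e) with ℕ.m≤n⇒m<n∨m≡n j≤k
        -- The later occurrence is the last vertex. Nothing follows it, and truncation at i
        -- suffices.
        ... | inj₂ refl = shorten (go i (rec i<j) (path-restrict i≤k p) (λ x x≤i → h x (ℕ.≤-trans x≤i i≤k)))
          where
          shorten : Simplified P s i → Simplified P s k
          shorten r = record { Simplified r ; len≤ = ℕ.≤-trans (Simplified.len≤ r) i≤k ; end = trans (Simplified.end r) e }
        ... | inj₁ j<k = shorten (go (suc i + (k ∸ suc j)) (rec smaller) cut-path cut-inside)
          where
          cut : ℕ → V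
          cut = append s i (λ x → s (suc j + x))

          total : suc j + (k ∸ suc j) ≡ k
          total = ℕ.m+[n∸m]≡n j<k

          smaller : suc i + (k ∸ suc j) < k
          smaller = subst (suc i + (k ∸ suc j) <_) total (ℕ.+-monoˡ-< (k ∸ suc j) (s≤s i<j))

          cut-path : Path cut (suc i + (k ∸ suc j))
          cut-path = path-append (path-restrict i≤k p)
            (λ x x< → subst (λ y → adj (s (suc j + x)) (s y) ≡ true) (sym (ℕ.+-suc (suc j) x))
              (p (suc j + x) (subst (suc j + x <_) total (ℕ.+-monoʳ-< (suc j) x<))))
            (subst₂ (λ x y → adj x (s y) ≡ true) (sym e) (sym (ℕ.+-identityʳ (suc j))) (p j j<k))

          cut-inside : ∀ x → x ≤ suc i + (k ∸ suc j) → P (cut x)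
          cut-inside x x≤ with side i x
          ... | inj₁ a = subst P (sym (append-left s i _ a)) (h x (ℕ.≤-trans a i≤k))
          ... | inj₂ (y , refl) = subst P (sym (append-right s i _ y))
            (h (suc j + y) (subst (suc j + y ≤_) total (ℕ.+-monoʳ-≤ (suc j) (ℕ.+-cancelˡ-≤ (suc i) _ _ x≤))))

          shorten : Simplified P cut (suc i + (k ∸ suc j)) → Simplified P s k
          shorten r = record { Simplified r
            ; len≤ = ℕ.≤-trans (Simplified.len≤ r) (ℕ.<⇒≤ smaller)
            ; start = trans (Simplified.start r) (append-left s i _ z≤n)
            ; end = trans (Simplified.end r) (trans (append-right s i _ (k ∸ suc j)) (cong s total)) }

    -- A cycle of length L, unrolled to an L-periodic sequence.
    record Loop (L : ℕ) : Set where
      field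
        L≥3 : 3 ≤ L
        w : ℕ → V
        step : ∀ i → adj (w i) (w (suc i)) ≡ true
        periodic : ∀ i → w (i + L) ≡ w i
        inj : ∀ i j → i < j → j < i + L → w i ≢ w j

    unroll : ∀ {m} → Cycle G m → Loop (suc m)
    unroll {m} C = record { L≥3 = long ; w = w ; step = w-step ; periodic = w-periodic ; inj = w-inj }
      where
      open Cycle C
      L = suc m

      w : ℕ → V
      w i = vs (fromℕ< (m%n<n i L))

      at-residue : ∀ {x y} (h : x < L) (h' : y < L) → x ≡ y → vs (fromℕ< h) ≡ vs (fromℕ< h')
      at-residue h h' refl = refl

      vs-step : ∀ x y (h : x < L) (h' : y < L) → y ≡ suc x → adj (vs (fromℕ< h)) (vs (fromℕ< h')) ≡ true
      vs-step x _ h h' refl = subst₂ (λ a b → adj (vs a) (vs b) ≡ true)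
        (Fin.toℕ-injective (trans (Fin.toℕ-inject₁ (fromℕ< (ℕ.≤-pred h'))) (trans (Fin.toℕ-fromℕ< (ℕ.≤-pred h')) (sym (Fin.toℕ-fromℕ< h)))))
        (Fin.toℕ-injective (trans (cong suc (Fin.toℕ-fromℕ< (ℕ.≤-pred h'))) (sym (Fin.toℕ-fromℕ< h'))))
        (step (fromℕ< (ℕ.≤-pred h')))

      vs-close : ∀ x y (h : x < L) (h' : y < L) → x ≡ m → y ≡ 0 → adj (vs (fromℕ< h)) (vs (fromℕ< h')) ≡ true
      vs-close x y h h' refl refl = subst (λ a → adj (vs a) (vs zero) ≡ true)
        (Fin.toℕ-injective (trans (Fin.toℕ-fromℕ m) (sym (Fin.toℕ-fromℕ< h)))) close

      suc-% : ∀ i → suc i % L ≡ suc (i % L) % L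
      suc-% i = trans (%-distribˡ-+ 1 i L) (cong (λ x → (x + i % L) % L) (m<n⇒m%n≡m (ℕ.≤-trans (s≤s (s≤s z≤n)) long)))

      w-step : ∀ i → adj (w i) (w (suc i)) ≡ true
      w-step i with ℕ.m≤n⇒m<n∨m≡n (ℕ.≤-pred (m%n<n i L))
      ... | inj₁ h = vs-step _ _ (m%n<n i L) (m%n<n (suc i) L) (trans (suc-% i) (m<n⇒m%n≡m (s≤s h)))
      ... | inj₂ h = vs-close _ _ (m%n<n i L) (m%n<n (suc i) L) h (trans (suc-% i) (trans (cong (λ x → suc x % L) h) (n%n≡0 L)))

      w-periodic : ∀ i → w (i + L) ≡ w i
      w-periodic i = at-residue (m%n<n (i + L) L) (m%n<n i L) ([m+n]%n≡m%n i L)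

      w-inj : ∀ i j → i < j → j < i + L → w i ≢ w j
      -- Equal residues together with j < i + L leave no room for a larger quotient, so j ≤ i.
      w-inj i j i<j j<i+L e = ℕ.<⇒≱ i<j (subst₂ _≤_ (sym (m≡m%n+[m/n]*n j L)) (trans (cong (_+ (i ℕ./ L) ℕ.* L) (sym r)) (sym (m≡m%n+[m/n]*n i L)))
        (ℕ.+-monoʳ-≤ (j % L) (ℕ.*-monoˡ-≤ L (ℕ.≤-pred (ℕ.*-cancelʳ-< L (j ℕ./ L) (suc (i ℕ./ L)) quotient)))))
        where
        r : i % L ≡ j % L
        r = trans (sym (Fin.toℕ-fromℕ< (m%n<n i L))) (trans (cong toℕ (inj e)) (Fin.toℕ-fromℕ< (m%n<n j L)))
        quotient : (j ℕ./ L) ℕ.* L < L + (i ℕ./ L) ℕ.* L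
        quotient = lin 6 0 (λ i j q q' r L → i ≡' r ⊕ q ⇒ j ≡' r ⊕ q' ⇒ j <' i ⊕ L ⇒ ⊢ q' <' L ⊕ q) i j ((i ℕ./ L) ℕ.* L) ((j ℕ./ L) ℕ.* L) (j % L) L
          (trans (m≡m%n+[m/n]*n i L) (cong (_+ (i ℕ./ L) ℕ.* L) r)) (m≡m%n+[m/n]*n j L) j<i+L

open Paths

-- A shortest cycle is isometrically embedded: distances between its vertices.

module ShortestCycles where
  open import Data.Nat using (_+_; _∸_; _≤_; _<_)

  module Isometry {n : ℕ} (G : Graph n) {g : ℕ} (C : Sequences.Loop G g) (minimal : ∀ k → HasCycleOfLength G k → g ≤ k) where
    open Graph G
    open Metric G
    open Sequences G
    open Loop C

    arc-path : ∀ i d → Path (λ x → w (i + x)) d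
    arc-path i d x _ = subst (λ y → adj (w (i + x)) (w y) ≡ true) (sym (ℕ.+-suc i x)) (step (i + x))

    arc-inj : ∀ i {d} → d < g → Inj (λ x → w (i + x)) d
    arc-inj i {d} d<g x y x<y y≤d = inj (i + x) (i + y) (ℕ.+-monoʳ-< i x<y)
      (lin 5 0 (λ i x y d g → y ≤' d ⇒ d <' g ⇒ ⊢ i ⊕ y <' i ⊕ x ⊕ g) i x y d g y≤d d<g)

    -- The arc of length d and a path that meets the cycle only in its ends close up to a cycle of
    -- length `d + suc q`. For q = 0 the path is a single edge, and `2 ≤ d + q` keeps this cycle
    -- from degenerating.
    long-chord : ∀ i d q {s} → d < g → 2 ≤ d + q → Path s (suc q) → Inj s (suc q) → s 0 ≡ w i → s (suc q) ≡ w (i + d) →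
                 (∀ m b → m < q → b < g → s (suc m) ≢ w (i + b)) → g ≤ d + suc q
    long-chord i d zero {s} d<g 2≤ p r s₀ s₁ _ = minimal (d + 1) (d , sym (ℕ.+-comm d 1) ,
      toCycle {λ x → w (i + x)} (subst (2 ≤_) (ℕ.+-identityʳ d) 2≤) (arc-path i d) (arc-inj i d<g)
        (subst₂ (λ a b → adj a b ≡ true) s₁ (trans s₀ (cong w (sym (ℕ.+-identityʳ i)))) (adj-sym (p 0 (s≤s z≤n)))))
    long-chord i d (suc q) {s} d<g _ p r s₀ s₁ avoids = minimal (d + suc (suc q)) (suc d + q , sym (trans (ℕ.+-suc d (suc q)) (cong suc (ℕ.+-suc d q))) ,
      toCycle {append (λ x → w (i + x)) d back} (s≤s (ℕ.≤-trans 1≤d (ℕ.m≤m+n d q)))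
        (path-append (arc-path i d) (path-restrict (ℕ.n≤1+n q) (path-reverse (path-restrict (ℕ.n≤1+n (suc q)) p)))
          (subst (λ a → adj a (back 0) ≡ true) s₁ (adj-sym (p (suc q) ℕ.≤-refl))))
        (inj-append (arc-inj i d<g) (inj-restrict (ℕ.n≤1+n q) (inj-reverse (inj-restrict (ℕ.n≤1+n (suc q)) r))) disjoint)
        (subst₂ (λ a b → adj a b ≡ true) (sym (trans (append-right _ d back q) (cong s (ℕ.m+n∸n≡m 1 q))))
          (trans s₀ (trans (cong w (sym (ℕ.+-identityʳ i))) (sym (append-left (λ x → w (i + x)) d back z≤n)))) (adj-sym (p 0 (s≤s z≤n)))))
      where
      back : ℕ → V
      back x = s (suc q ∸ x)
      disjoint : ∀ x y → x ≤ d → y ≤ q → w (i + x) ≢ back y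
      disjoint x y x≤d y≤q e = avoids (q ∸ y) x (s≤s (ℕ.m∸n≤m q y)) (ℕ.≤-<-trans x≤d d<g) (trans (cong s (sym (ℕ.+-∸-assoc 1 y≤q))) (sym e))
      1≤d : 1 ≤ d
      1≤d = ℕ.n≢0⇒n>0 λ { refl → r 0 (suc (suc q)) (s≤s z≤n) ℕ.≤-refl (trans s₀ (trans (cong w (sym (ℕ.+-identityʳ i))) (sym s₁))) }

    -- By induction on the length, a simple path that touches the cycle in between is split there.
    -- Otherwise it closes up with both arcs, of lengths d and e with d + e = g; the inequalities g
    -- ≤ d + q and g ≤ e + q are incompatible with q < d and q < e.
    isometric : ∀ q {i j} → i ≤ j → j ≤ i + g → Walk G q (w i) (w j) → j ≤ i + q ⊎ i + g ≤ j + q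
    isometric q = go q (<-wellFounded q)
      where
      go : ∀ q → Acc _<_ q → ∀ {i j} → i ≤ j → j ≤ i + g → Walk G q (w i) (w j) → j ≤ i + q ⊎ i + g ≤ j + q
      go q (acc rec) {i} {j} i≤j j≤i+g x with simplify {λ _ → ⊤} q (at-path x) (λ _ _ → tt)
      ... | simplified s q' q'≤q p r s₀ s₁ _ with trans s₀ (at-start x) | trans s₁ (at-end x) | ℕ.m≤n⇒m<n∨m≡n q'≤q
      ... | s₀ | s₁ | inj₁ q'<q = [ (λ h → inj₁ (ℕ.≤-trans h (ℕ.+-monoʳ-≤ i q'≤q))) , (λ h → inj₂ (ℕ.≤-trans h (ℕ.+-monoʳ-≤ j q'≤q))) ]′
            (go q' (rec q'<q) i≤j j≤i+g (subst₂ (Walk G q') s₀ s₁ (path-walk p z≤n ℕ.≤-refl)))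
      ... | s₀ | s₁ | inj₂ refl with search≤ (λ m → search≤ (λ b → (suc m ℕ.<? q') ×-dec (b ℕ.<? g) ×-dec (s (suc m) Fin.≟ w (i + b))) g) q'
      ... | yes (m , _ , b , _ , m<q , b<g , e) = split
        where
        first : i + b ≤ i + suc m ⊎ i + g ≤ i + b + suc m
        first = go (suc m) (rec m<q) (ℕ.m≤m+n i b) (ℕ.+-monoʳ-≤ i (ℕ.<⇒≤ b<g))
          (subst₂ (Walk G (suc m)) s₀ e (path-walk p z≤n (ℕ.<⇒≤ m<q)))
        rest : Walk G (q' ∸ suc m) (w (i + b)) (w j)
        rest = subst₂ (Walk G (q' ∸ suc m)) e s₁ (path-walk p (ℕ.<⇒≤ m<q) ℕ.≤-refl)
        rest< : q' ∸ suc m < q'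
        rest< = ℕ.∸-monoʳ-< (s≤s z≤n) (ℕ.<⇒≤ m<q)
        total : suc m + (q' ∸ suc m) ≡ q'
        total = ℕ.m+[n∸m]≡n (ℕ.<⇒≤ m<q)

        Goal : Set
        Goal = j ≤ i + q' ⊎ i + g ≤ j + q'

        ahead : i + b ≤ j → Goal
        ahead h = combined first (go (q' ∸ suc m) (rec rest<) h (ℕ.≤-trans j≤i+g (ℕ.+-monoˡ-≤ g (ℕ.m≤m+n i b))) rest)
          where
          combined : i + b ≤ i + suc m ⊎ i + g ≤ i + b + suc m → j ≤ i + b + (q' ∸ suc m) ⊎ i + b + g ≤ j + (q' ∸ suc m) → Goal
          combined (inj₁ a) (inj₁ c) = inj₁ (lin 6 0 (λ i j b m q r → i ⊕ b ≤' i ⊕ m ⇒ j ≤' i ⊕ b ⊕ r ⇒ m ⊕ r ≡' q ⇒ ⊢ j ≤' i ⊕ q)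
            i j b (suc m) q' (q' ∸ suc m) a c total)
          combined (inj₂ a) _ = inj₂ (lin 7 0 (λ i j b m q r g → i ⊕ b ≤' j ⇒ i ⊕ g ≤' i ⊕ b ⊕ m ⇒ m ⊕ r ≡' q ⇒ ⊢ i ⊕ g ≤' j ⊕ q)
            i j b (suc m) q' (q' ∸ suc m) g h a total)
          combined (inj₁ _) (inj₂ c) = inj₂ (lin 7 0 (λ i j b m q r g → i ⊕ b ⊕ g ≤' j ⊕ r ⇒ m ⊕ r ≡' q ⇒ ⊢ i ⊕ g ≤' j ⊕ q)
            i j b (suc m) q' (q' ∸ suc m) g c total)

        behind : j < i + b → Goal
        behind h = combined first (go (q' ∸ suc m) (rec rest<) (ℕ.<⇒≤ h)
            (lin 4 0 (λ i j b g → i ≤' j ⇒ b <' g ⇒ ⊢ i ⊕ b ≤' j ⊕ g) i j b g i≤j b<g) (reverseʷ rest))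
          where
          combined : i + b ≤ i + suc m ⊎ i + g ≤ i + b + suc m → i + b ≤ j + (q' ∸ suc m) ⊎ j + g ≤ i + b + (q' ∸ suc m) → Goal
          combined (inj₁ a) _ = inj₁ (lin 6 0 (λ i j b m q r → j <' i ⊕ b ⇒ i ⊕ b ≤' i ⊕ m ⇒ m ⊕ r ≡' q ⇒ ⊢ j ≤' i ⊕ q)
            i j b (suc m) q' (q' ∸ suc m) h a total)
          combined (inj₂ a) (inj₁ c) = inj₂ (lin 7 0 (λ i j b m q r g → i ⊕ g ≤' i ⊕ b ⊕ m ⇒ i ⊕ b ≤' j ⊕ r ⇒ m ⊕ r ≡' q ⇒ ⊢ i ⊕ g ≤' j ⊕ q)
            i j b (suc m) q' (q' ∸ suc m) g a c total)
          combined (inj₂ _) (inj₂ c) = inj₁ (lin 7 0 (λ i j b m q r g → b <' g ⇒ j ⊕ g ≤' i ⊕ b ⊕ r ⇒ m ⊕ r ≡' q ⇒ ⊢ j ≤' i ⊕ q)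
            i j b (suc m) q' (q' ∸ suc m) g b<g c total)

        split : Goal
        split with i + b ℕ.≤? j
        ... | yes h = ahead h
        ... | no h = behind (ℕ.≰⇒> h)
      ... | no avoids with j ℕ.≤? i + q' | i + g ℕ.≤? j + q'
      ... | yes h | _ = inj₁ h
      ... | no _ | yes h = inj₂ h
      ... | no h₁ | no h₂ = ⊥-elim (impossible (ℕ.≰⇒> h₁) (ℕ.≰⇒> h₂) (q' , refl))
        where
        d = j ∸ i
        i+d : i + d ≡ j
        i+d = ℕ.m+[n∸m]≡n i≤j
        e = g ∸ d
        d+e : d + e ≡ g
        d+e = ℕ.m+[n∸m]≡n (ℕ.+-cancelˡ-≤ i _ _ (subst (_≤ i + g) (sym i+d) j≤i+g))

        impossible : i + q' < j → j + q' < i + g → (∃ λ q → q ≡ q') → ⊥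
        impossible a b (zero , refl) = inj i j (subst (_< j) (ℕ.+-identityʳ i) a) (subst (_< i + g) (ℕ.+-identityʳ j) b) (trans (sym s₀) s₁)
        impossible a b (suc q , refl) = lin 6 0 (λ i j d e g q → d ⊕ e ≡' g ⇒ i ⊕ d ≡' j ⇒ i ⊕ (# 1 ⊕ q) <' j ⇒ j ⊕ (# 1 ⊕ q) <' i ⊕ g ⇒
          g ≤' d ⊕ (# 1 ⊕ q) ⇒ g ≤' e ⊕ (# 1 ⊕ q) ⇒ ⊢ ⊥') i j d e g q d+e i+d a b
          (long-chord i d q d<g (lin 4 0 (λ i j d q → i ⊕ d ≡' j ⇒ i ⊕ (# 1 ⊕ q) <' j ⇒ ⊢ # 2 ≤' d ⊕ q) i j d q i+d a)
            p r s₀ (trans s₁ (cong w (sym i+d))) λ m b m<q b<g h → avoids (m , ℕ.≤-trans (ℕ.<⇒≤ m<q) (ℕ.n≤1+n q) , b , ℕ.<⇒≤ b<g , s≤s m<q , b<g , h))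
          (long-chord j e q e<g (lin 6 0 (λ i j d e g q → d ⊕ e ≡' g ⇒ i ⊕ d ≡' j ⇒ j ⊕ (# 1 ⊕ q) <' i ⊕ g ⇒ ⊢ # 2 ≤' e ⊕ q) i j d e g q d+e i+d b)
            (path-reverse p) (inj-reverse r) s₁ (trans (cong s (ℕ.n∸n≡0 (suc q))) (trans s₀ (trans (sym (periodic i)) (cong w i+g≡j+e)))) avoids-reverse)
          where
          d<g : d < g
          d<g = lin 5 0 (λ i j d g q → i ⊕ d ≡' j ⇒ j ⊕ q <' i ⊕ g ⇒ ⊢ d <' g) i j d g (suc q) i+d b
          e<g : e < g
          e<g = lin 6 0 (λ i j d e g q → d ⊕ e ≡' g ⇒ i ⊕ d ≡' j ⇒ i ⊕ (# 1 ⊕ q) <' j ⇒ ⊢ e <' g) i j d e g q d+e i+d a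
          i+g≡j+e : i + g ≡ j + e
          i+g≡j+e = lin 5 0 (λ i j d e g → d ⊕ e ≡' g ⇒ i ⊕ d ≡' j ⇒ ⊢ i ⊕ g ≡' j ⊕ e) i j d e g d+e i+d
          avoids-reverse : ∀ m b → m < q → b < g → s (suc q ∸ suc m) ≢ w (j + b)
          avoids-reverse m b m<q b<g h with d + b ℕ.<? g
          ... | yes d+b<g = avoids (q ∸ suc m , ℕ.≤-trans (ℕ.m∸n≤m q (suc m)) (ℕ.n≤1+n q) , d + b , ℕ.<⇒≤ d+b<g ,
                  s≤s (ℕ.∸-monoʳ-< (s≤s z≤n) m<q) , d+b<g ,
                  trans (cong s (sym (ℕ.+-∸-assoc 1 m<q))) (trans h (cong w (trans (cong (_+ b) (sym i+d)) (ℕ.+-assoc i d b)))))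
          -- The position b behind j has reached `i + g`; one period less turns it into an index
          -- counted from i.
          ... | no d+b≮g = avoids (q ∸ suc m , ℕ.≤-trans (ℕ.m∸n≤m q (suc m)) (ℕ.n≤1+n q) , b ∸ e , ℕ.≤-trans (ℕ.m∸n≤m b e) (ℕ.<⇒≤ b<g) ,
                  s≤s (ℕ.∸-monoʳ-< (s≤s z≤n) m<q) , ℕ.≤-<-trans (ℕ.m∸n≤m b e) b<g ,
                  trans (cong s (sym (ℕ.+-∸-assoc 1 m<q))) (trans h (trans (cong w wrap) (periodic (i + (b ∸ e))))))
            where
            e≤b : e ≤ b
            e≤b = lin 4 0 (λ d e g b → d ⊕ e ≡' g ⇒ g ≤' d ⊕ b ⇒ ⊢ e ≤' b) d e g b d+e (ℕ.≮⇒≥ d+b≮g)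
            wrap : j + b ≡ i + (b ∸ e) + g
            wrap = lin 7 0 (λ i j b d e g x → d ⊕ e ≡' g ⇒ i ⊕ d ≡' j ⇒ e ⊕ x ≡' b ⇒ ⊢ j ⊕ b ≡' i ⊕ x ⊕ g) i j b d e g (b ∸ e) d+e i+d (ℕ.m+[n∸m]≡n e≤b)

open ShortestCycles

-- The bigon on a shortest cycle and the lower bound g/4.

module GirthTriangles where
  open import Data.Rational using (_+_; _-_; _≤_; _<_; ∣_∣)

  *-cancel-/ : ∀ a d → ι (suc d) ℚ.* (ℤ.+ a ℚ./ suc d) ≡ ι a
  *-cancel-/ a d = ℚ.toℚᵘ-injective (ℚᵘ.≃-trans (ℚ.toℚᵘ-homo-* (ι (suc d)) (ℤ.+ a ℚ./ suc d))
    (ℚᵘ.≃-trans (ℚᵘ.*-cong (ℚ.toℚᵘ-fromℚᵘ (ℚᵘ.mkℚᵘ (ℤ.+ suc d) 0)) (ℚ.toℚᵘ-fromℚᵘ (ℚᵘ.mkℚᵘ (ℤ.+ a) d)))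
    (ℚᵘ.≃-trans (ℚᵘ.*≡* (trans (ℤ.*-identityʳ _) (trans (ℤ.*-comm (ℤ.+ suc d) (ℤ.+ a)) (cong (λ e → ℤ.+ a ℤ.* ℤ.+ suc e) (sym (ℕ.+-identityʳ d))))))
      (ℚᵘ.≃-sym (ℚ.toℚᵘ-fromℚᵘ (ℚᵘ.mkℚᵘ (ℤ.+ a) 0))))))

  ι-suc-* : ∀ k x → ι (suc k) ℚ.* x ≡ x + ι k ℚ.* x
  ι-suc-* k x = trans (cong (ℚ._* x) (ι-+ 1 k)) (trans (ℚ.*-distribʳ-+ x 1ℚ (ι k)) (cong (_+ ι k ℚ.* x) (ℚ.*-identityˡ x)))

  halves : ∀ a → let x = ℤ.+ a ℚ./ 2 in x + x ≡ ι a
  halves a = trans (sym (trans (ι-suc-* 1 x) (cong (λ y → x + y) (ℚ.*-identityˡ x)))) (*-cancel-/ a 1)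
    where x = ℤ.+ a ℚ./ 2

  quarters : ∀ a → let x = ℤ.+ a ℚ./ 4 in x + x + (x + x) ≡ ι a
  quarters a = trans (sym (trans (ι-suc-* 3 x) (trans (cong (x +_) (trans (ι-suc-* 2 x) (cong (x +_) (trans (ι-suc-* 1 x) (cong (x +_) (ℚ.*-identityˡ x))))))
    (lin 0 1 (λ x → ⊢ x ⊕ (x ⊕ (x ⊕ x)) ≡' x ⊕ x ⊕ (x ⊕ x)) x)))) (*-cancel-/ a 3)
    where x = ℤ.+ a ℚ./ 4

  locate : ∀ N s → 0ℚ ≤ s → s ≤ ι (suc N) → ∃ λ i → i ℕ.≤ N × ι i ≤ s × s ≤ ι (suc i)
  locate zero s h h' = 0 , z≤n , h , h'
  locate (suc N) s h h' with s ℚ.≤? ι (suc N)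
  ... | yes s≤ = let (i , i≤N , lo , hi) = locate N s h s≤ in i , ℕ.m≤n⇒m≤1+n i≤N , lo , hi
  ... | no s≰ = suc N , ℕ.≤-refl , ℚ.<⇒≤ (ℚ.≰⇒> s≰) , h'

  module GirthCycle {n : ℕ} (G : Graph n) {g : ℕ} (C : Sequences.Loop G g) (minimal : ∀ k → HasCycleOfLength G k → g ℕ.≤ k) where
    open Graph G
    open Metric G
    open Sequences G
    open Loop C
    open Isometry G C minimal
    open Point

    -- The edge is part of the data: an integer parameter strictly between 0 and g lies on two
    -- edges, and the parameter g, another name for the point 0, lies only on the last edge.
    record Located (s : ℚ) : Set where
      constructor located
      field
        index : ℕ
        index<g : index ℕ.< g
        lower : ι index ≤ s
        upper : s ≤ ι (suc index)
    open Located

    pt : ∀ {s} → Located s → Point G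
    pt {s} (located i _ lo hi) = record
      { a = w i ; b = w (suc i) ; edge = step i ; t = s - ι i
      ; t≥0 = lin 1 1 (λ i s → ↑ i ≤' s ⇒ ⊢ ♯ 0 ≤' s ⊖ ↑ i) i s lo
      ; t≤1 = lin 1 1 (λ i s → s ≤' ↑ (# 1 ⊕ i) ⇒ ⊢ s ⊖ ↑ i ≤' ♯ 1) i s hi }

    exit-index : ∀ {s} (l : Located s) {v c} → Exit G (pt l) v c → ∃ λ κ → v ≡ w κ × κ ℕ.≤ g × s - ι κ ≤ c × ι κ - s ≤ c
    exit-index {s} (located i i<g lo hi) (inj₁ (e , refl)) = i , e , ℕ.<⇒≤ i<g , ℚ.≤-refl , lin 1 1 (λ i s → ↑ i ≤' s ⇒ ⊢ ↑ i ⊖ s ≤' s ⊖ ↑ i) i s lo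
    exit-index {s} (located i i<g lo hi) (inj₂ (e , refl)) = suc i , e , i<g ,
      lin 1 1 (λ i s → s ≤' ↑ (# 1 ⊕ i) ⇒ ⊢ s ⊖ ↑ (# 1 ⊕ i) ≤' ♯ 1 ⊖ (s ⊖ ↑ i)) i s hi ,
      lin 1 1 (λ i s → ⊢ ↑ (# 1 ⊕ i) ⊖ s ≤' ♯ 1 ⊖ (s ⊖ ↑ i)) i s

    Bounded : ℚ → ℚ → Set
    Bounded d ℓ = d ≤ ℓ ⊎ ι g - d ≤ ℓ

    walk-bounded : ∀ {s s' c c' κ κ' q} → s - ι κ ≤ c → ι κ - s ≤ c → s' - ι κ' ≤ c' → ι κ' - s' ≤ c' →
                   κ ℕ.≤ κ' → κ' ℕ.≤ g → Walk G q (w κ) (w κ') → Bounded ∣ s - s' ∣ (c + ι q + c')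
    walk-bounded {s} {s'} {c} {c'} {κ} {κ'} {q} h₁ h₂ h₃ h₄ κ≤κ' κ'≤g x =
      [ (λ h → inj₁ (∣-∣-≤ s s'
          (lin 3 4 (λ κ κ' q s s' c c' → s ⊖ ↑ κ ≤' c ⇒ ↑ κ' ⊖ s' ≤' c' ⇒ κ ≤' κ' ⇒ ⊢ s ⊖ s' ≤' c ⊕ ↑ q ⊕ c') κ κ' q s s' c c' h₁ h₄ κ≤κ')
          (lin 3 4 (λ κ κ' q s s' c c' → ↑ κ ⊖ s ≤' c ⇒ s' ⊖ ↑ κ' ≤' c' ⇒ κ' ≤' κ ⊕ q ⇒ ⊢ s' ⊖ s ≤' c ⊕ ↑ q ⊕ c') κ κ' q s s' c c' h₂ h₃ h)))
      , (λ h → inj₂ (lin 4 5 (λ κ κ' q g s s' c c' d → ↑ κ' ⊖ s' ≤' c' ⇒ s ⊖ ↑ κ ≤' c ⇒ κ ⊕ g ≤' κ' ⊕ q ⇒ s' ⊖ s ≤' d ⇒ ⊢ ↑ g ⊖ d ≤' c ⊕ ↑ q ⊕ c')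
          κ κ' q g s s' c c' ∣ s - s' ∣ h₄ h₁ h (proj₂ (∣-∣-ub s s'))))
      ]′ (isometric q κ≤κ' (ℕ.≤-trans κ'≤g (ℕ.m≤n+m g κ)) x)

    index-inj : ∀ {i j} → i ℕ.< g → j ℕ.< g → w i ≡ w j → i ≡ j
    index-inj {i} {j} i<g j<g e with ℕ.<-cmp i j
    ... | tri< h _ _ = ⊥-elim (inj i j h (ℕ.≤-trans j<g (ℕ.m≤n+m g i)) e)
    ... | tri≈ _ h _ = h
    ... | tri> _ _ h = ⊥-elim (inj j i h (ℕ.≤-trans i<g (ℕ.m≤n+m g j)) (sym e))

    -- Otherwise i ≡ j + 1 and j ≡ i + 1 modulo g, and g would divide 2.
    no-flip : ∀ {i j} → i ℕ.< g → j ℕ.< g → w i ≡ w (suc j) → w (suc i) ≢ w j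
    no-flip {i} {j} i<g j<g e e' with ℕ.<-cmp i (suc j)
    ... | tri≈ _ refl _ = inj j (suc i) (ℕ.m≤n⇒m≤1+n ℕ.≤-refl) (lin 2 0 (λ j g → # 3 ≤' g ⇒ ⊢ # 2 ⊕ j <' j ⊕ g) j g L≥3) (sym e')
    ... | tri> _ _ h = inj (suc j) i h (lin 3 0 (λ i j g → i <' g ⇒ ⊢ i <' # 1 ⊕ j ⊕ g) i j g i<g) (sym e)
    ... | tri< h _ _ with suc j ℕ.<? i ℕ.+ g
    ... | yes k = inj i (suc j) h k e
    ... | no k = inj (suc i) j (lin 3 0 (λ i j g → # 3 ≤' g ⇒ i ⊕ g ≤' # 1 ⊕ j ⇒ ⊢ # 1 ⊕ i <' j) i j g L≥3 (ℕ.≮⇒≥ k))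
        (lin 3 0 (λ i j g → j <' g ⇒ ⊢ j <' # 1 ⊕ i ⊕ g) i j g j<g) e'

    route-bounded : ∀ {s s'} (l : Located s) (l' : Located s') ℓ → Route G (pt l) (pt l') ℓ → Bounded ∣ s - s' ∣ ℓ
    route-bounded {s} {s'} l l' ℓ (inj₁ (v , v' , q , c , c' , e , e' , x , refl)) = bound (exit-index l e) (exit-index l' e')
      where
      bound : (∃ λ κ → v ≡ w κ × κ ℕ.≤ g × s - ι κ ≤ c × ι κ - s ≤ c) → (∃ λ κ → v' ≡ w κ × κ ℕ.≤ g × s' - ι κ ≤ c' × ι κ - s' ≤ c') →
              Bounded ∣ s - s' ∣ (c + ι q + c')
      bound (κ , refl , κ≤g , h₁ , h₂) (κ' , refl , κ'≤g , h₃ , h₄) =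
        [ (λ h → walk-bounded h₁ h₂ h₃ h₄ h κ'≤g x)
        , (λ h → subst₂ Bounded (∣-∣-sym s' s) (lin 1 2 (λ q c c' → ⊢ c' ⊕ ↑ q ⊕ c ≡' c ⊕ ↑ q ⊕ c') q c c')
                   (walk-bounded h₃ h₄ h₁ h₂ h κ≤g (reverseʷ x)))
        ]′ (ℕ.≤-total κ κ')
    route-bounded {s} {s'} l l' ℓ (inj₂ (inj₁ (e , e' , refl))) = inj₁ (ℚ.≤-reflexive (cong ∣_∣
      (trans (lin 1 2 (λ i s s' → ⊢ s ⊖ s' ≡' s ⊖ ↑ i ⊖ (s' ⊖ ↑ i)) (index l) s s')
        (cong (λ j → s - ι (index l) - (s' - ι j)) (index-inj (index<g l) (index<g l') e)))))
    route-bounded l l' ℓ (inj₂ (inj₂ (e , e' , refl))) = ⊥-elim (no-flip (index<g l) (index<g l') e e')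

    route-ahead : ∀ {s s'} (l : Located s) (l' : Located s') → index l ℕ.< index l' → Route G (pt l) (pt l') ∣ s - s' ∣
    route-ahead {s} {s'} l@(located i _ lo hi) l'@(located j _ lo' hi') i<j =
      inj₁ (w (suc i) , w j , j ℕ.∸ suc i , 1ℚ - (s - ι i) , s' - ι j , inj₂ (refl , refl) , inj₁ (refl , refl) ,
        path-walk {w} {j} (λ x _ → step x) i<j ℕ.≤-refl ,
        trans (∣-∣-sym s s') (trans (∣-∣-of-≤ (lin 2 2 (λ i j s s' → s ≤' ↑ (# 1 ⊕ i) ⇒ i <' j ⇒ ↑ j ≤' s' ⇒ ⊢ s ≤' s') i j s s' hi i<j lo'))
          (lin 3 2 (λ i j d s s' → # 1 ⊕ i ⊕ d ≡' j ⇒ ⊢ s' ⊖ s ≡' ♯ 1 ⊖ (s ⊖ ↑ i) ⊕ ↑ d ⊕ (s' ⊖ ↑ j)) i j (j ℕ.∸ suc i) s s' (ℕ.m+[n∸m]≡n i<j))))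

    route-cycle : ∀ {s s'} (l : Located s) (l' : Located s') → Route G (pt l) (pt l') ∣ s - s' ∣
    route-cycle {s} {s'} l l' = compare (ℕ.<-cmp (index l) (index l'))
      where
      compare : Relation.Binary.Tri (index l ℕ.< index l') (index l ≡ index l') (index l' ℕ.< index l) → Route G (pt l) (pt l') ∣ s - s' ∣
      compare (tri< h _ _) = route-ahead l l' h
      compare (tri≈ _ h _) = inj₂ (inj₁ (cong w h , cong (λ i → w (suc i)) h , cong ∣_∣
        (trans (lin 1 2 (λ i s s' → ⊢ s ⊖ s' ≡' s ⊖ ↑ i ⊖ (s' ⊖ ↑ i)) (index l) s s') (cong (λ j → s - ι (index l) - (s' - ι j)) h))))
      compare (tri> _ _ h) = subst (Route G (pt l) (pt l')) (∣-∣-sym s' s) (route-sym (pt l') (pt l) (route-ahead l' l h))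

    H Q : ℚ
    H = ℤ.+ g ℚ./ 2
    Q = ℤ.+ g ℚ./ 4

    H+H : H + H ≡ ι g
    H+H = halves g

    Q+Q : Q + Q ≡ H
    Q+Q = lin 1 2 (λ g h q → h ⊕ h ≡' ↑ g ⇒ q ⊕ q ⊕ (q ⊕ q) ≡' ↑ g ⇒ ⊢ q ⊕ q ≡' h) g H Q H+H (quarters g)

    -- For parameters at most g/2 apart the complementary arc is no shorter, so both alternatives of
    -- `Bounded` give the same lower bound.
    isDist : ∀ {s s'} (l : Located s) (l' : Located s') → ∣ s - s' ∣ ≤ H → IsDist G (pt l) (pt l') ∣ s - s' ∣
    isDist {s} {s'} l l' h = route-cycle l l' , λ ℓ r → [ (λ x → x) ,
      (λ x → lin 1 3 (λ g h d ℓ → h ⊕ h ≡' ↑ g ⇒ d ≤' h ⇒ ↑ g ⊖ d ≤' ℓ ⇒ ⊢ d ≤' ℓ) g H ∣ s - s' ∣ ℓ H+H h x) ]′ (route-bounded l l' ℓ r)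

    H≥0 : 0ℚ ≤ H
    H≥0 = lin 1 1 (λ g h → h ⊕ h ≡' ↑ g ⇒ ⊢ ♯ 0 ≤' h) g H H+H

    samePoint : ∀ {s s'} (l : Located s) (l' : Located s') → s ≡ s' → SamePoint G (pt l) (pt l')
    samePoint {s} l l' refl = subst (IsDist G (pt l) (pt l')) zero-dist (isDist l l' (ℚ.≤-trans (ℚ.≤-reflexive zero-dist) H≥0))
      where
      zero-dist : ∣ s - s ∣ ≡ 0ℚ
      zero-dist = cong ∣_∣ (ℚ.+-inverseʳ s)

    place : ∀ s → 0ℚ ≤ s → s ≤ ι g → Located s
    place s h h' = found g refl h'
      where
      found : ∀ N → N ≡ g → s ≤ ι N → Located s
      found zero refl _ = ⊥-elim (ℕ.<⇒≱ L≥3 z≤n)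
      found (suc N) refl h' = let (i , i≤N , lo , hi) = locate N s h h' in located i (s≤s i≤N) lo hi

    module Arc (s₀ L : ℚ) (s₀≥0 : 0ℚ ≤ s₀) (L≥0 : 0ℚ ≤ L) (fits : s₀ + L ≤ ι g) (L≤H : L ≤ H) where
      at-arc : ∀ s → 0ℚ ≤ s → s ≤ L → Located (s₀ + s)
      at-arc s h h' = place (s₀ + s)
        (lin 0 2 (λ s₀ s → ♯ 0 ≤' s₀ ⇒ ♯ 0 ≤' s ⇒ ⊢ ♯ 0 ≤' s₀ ⊕ s) s₀ s s₀≥0 h)
        (lin 1 3 (λ g s₀ s L → s ≤' L ⇒ s₀ ⊕ L ≤' ↑ g ⇒ ⊢ s₀ ⊕ s ≤' ↑ g) g s₀ s L h' fits)

      arc : ∀ {x y} → SamePoint G (pt (at-arc 0ℚ ℚ.≤-refl L≥0)) x → SamePoint G (pt (at-arc L L≥0 ℚ.≤-refl)) y → Geodesic G x y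
      arc start end = record
        { L = L ; L≥0 = L≥0 ; γ = λ s h h' → pt (at-arc s h h') ; start = start ; end = end
        ; iso = λ s s' h₁ h₂ h₁' h₂' → subst (IsDist G (pt (at-arc s h₁ h₂)) (pt (at-arc s' h₁' h₂'))) (cong ∣_∣ (shift s s'))
            (isDist (at-arc s h₁ h₂) (at-arc s' h₁' h₂') (subst (_≤ H) (cong ∣_∣ (sym (shift s s'))) (∣-∣-≤ s s'
              (lin 0 4 (λ s s' L H → ♯ 0 ≤' s' ⇒ s ≤' L ⇒ L ≤' H ⇒ ⊢ s ⊖ s' ≤' H) s s' L H h₁' h₂ L≤H)
              (lin 0 4 (λ s s' L H → ♯ 0 ≤' s ⇒ s' ≤' L ⇒ L ≤' H ⇒ ⊢ s' ⊖ s ≤' H) s s' L H h₁ h₂' L≤H)))) }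
        where
        shift : ∀ s s' → s₀ + s - (s₀ + s') ≡ s - s'
        shift s s' = lin 0 3 (λ s₀ s s' → ⊢ s₀ ⊕ s ⊖ (s₀ ⊕ s') ≡' s ⊖ s') s₀ s s'

    private
      module XY = Arc 0ℚ H ℚ.≤-refl H≥0 (lin 1 1 (λ g h → h ⊕ h ≡' ↑ g ⇒ ⊢ ♯ 0 ⊕ h ≤' ↑ g) g H H+H) ℚ.≤-refl
      module YZ = Arc H 0ℚ H≥0 ℚ.≤-refl (lin 1 1 (λ g h → h ⊕ h ≡' ↑ g ⇒ ⊢ h ⊕ ♯ 0 ≤' ↑ g) g H H+H) H≥0
      module ZX = Arc H H H≥0 H≥0 (ℚ.≤-reflexive H+H) ℚ.≤-refl

      0≤g : 0ℚ ≤ ι g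
      0≤g = ι-nonneg g

      H≤g : H ≤ ι g
      H≤g = lin 1 1 (λ g h → h ⊕ h ≡' ↑ g ⇒ ⊢ h ≤' ↑ g) g H H+H

      at-0 : Located 0ℚ
      at-0 = place 0ℚ ℚ.≤-refl 0≤g

      at-H : Located H
      at-H = place H H≥0 H≤g

      X Y : Point G
      X = pt at-0
      Y = pt at-H

      around : ∀ {s} (l : Located s) → s ≡ ι g → SamePoint G (pt l) X
      around {s} l refl = wrap (exit-at l (ℕ.m≤n⇒m<n∨m≡n (index<g l))) , λ ℓ r → route≥0 (pt l) X r
        where
        exit-at : ∀ (l : Located (ι g)) → suc (index l) ℕ.< g ⊎ suc (index l) ≡ g → Exit G (pt l) (w g) 0ℚ
        exit-at (located i i<g lo hi) (inj₁ h) = ⊥-elim (lin 2 0 (λ i g → ↑ g ≤' ↑ (# 1 ⊕ i) ⇒ # 1 ⊕ i <' g ⇒ ⊢ ⊥') i g hi h)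
        exit-at (located i i<g lo hi) (inj₂ refl) = inj₂ (refl , lin 1 0 (λ i → ⊢ ♯ 0 ≡' ♯ 1 ⊖ (↑ (# 1 ⊕ i) ⊖ ↑ i)) i)
        exit-X : ∀ (l : Located 0ℚ) → Exit G (pt l) (w 0) 0ℚ
        exit-X (located i _ lo _) with ℕ.m≤n⇒m<n∨m≡n (z≤n {i})
        ... | inj₁ h = ⊥-elim (lin 1 0 (λ i → ↑ i ≤' ♯ 0 ⇒ # 1 ≤' i ⇒ ⊢ ⊥') i lo h)
        ... | inj₂ refl = inj₁ (refl , refl)
        wrap : Exit G (pt l) (w g) 0ℚ → Route G (pt l) X 0ℚ
        wrap e = inj₁ (w g , w 0 , 0 , 0ℚ , 0ℚ , e , exit-X at-0 , subst (Walk G 0 (w g)) (periodic 0) [] , refl)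

      -- The corners y and z coincide and the side between them is a point. The third side runs on
      -- to the parameter g, where it returns to X by periodicity.
      bigon : Triangle G
      bigon = record
        { x = X ; y = Y ; z = Y
        ; xy = XY.arc (samePoint (XY.at-arc 0ℚ ℚ.≤-refl H≥0) at-0 refl) (samePoint (XY.at-arc H H≥0 ℚ.≤-refl) at-H (ℚ.+-identityˡ H))
        ; yz = YZ.arc (samePoint (YZ.at-arc 0ℚ ℚ.≤-refl ℚ.≤-refl) at-H (ℚ.+-identityʳ H)) (samePoint (YZ.at-arc 0ℚ ℚ.≤-refl ℚ.≤-refl) at-H (ℚ.+-identityʳ H))
        ; zx = ZX.arc (samePoint (ZX.at-arc 0ℚ ℚ.≤-refl H≥0) at-H (ℚ.+-identityʳ H)) (around (ZX.at-arc H H≥0 ℚ.≤-refl) H+H) }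

      0≤Q : 0ℚ ≤ Q
      0≤Q = lin 0 2 (λ h q → q ⊕ q ≡' h ⇒ ♯ 0 ≤' h ⇒ ⊢ ♯ 0 ≤' q) H Q Q+Q H≥0

      Q≤H : Q ≤ H
      Q≤H = lin 0 2 (λ h q → q ⊕ q ≡' h ⇒ ♯ 0 ≤' h ⇒ ⊢ q ≤' h) H Q Q+Q H≥0

      at-Q : Located (0ℚ + Q)
      at-Q = XY.at-arc Q 0≤Q Q≤H

      P : Point G
      P = pt at-Q

      -- Both arcs from the parameter Q = g/4 to a parameter s in [g/2, g], of lengths s - Q and g -
      -- (s - Q), are at least Q.
      P-far : ∀ {s} (l : Located s) → H ≤ s → s ≤ ι g → ∀ {ε} → 0ℚ < ε → ∀ q → SamePoint G q (pt l) → DistGt G P q (Q - ε)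
      P-far {s} l H≤s s≤g {ε} ε>0 q (same , _) ℓ r = close (route-trans P q (pt l) r same)
        where
        close : DistLe G P (pt l) (ℓ + 0ℚ) → Q - ε < ℓ
        close (m , r' , m≤) = [ (λ h → lin 0 7 (λ h q s d m ℓ ε → q ⊕ q ≡' h ⇒ h ≤' s ⇒ s ⊖ (♯ 0 ⊕ q) ≤' d ⇒ d ≤' m ⇒ m ≤' ℓ ⊕ ♯ 0 ⇒ ♯ 0 <' ε ⇒ ⊢ q ⊖ ε <' ℓ)
              H Q s ∣ 0ℚ + Q - s ∣ m ℓ ε Q+Q H≤s (proj₂ (∣-∣-ub (0ℚ + Q) s)) h m≤ ε>0)
          , (λ h → lin 1 7 (λ g h q s d m ℓ ε → d ≤' s ⊖ q ⇒ s ≤' ↑ g ⇒ ↑ g ⊖ d ≤' m ⇒ m ≤' ℓ ⊕ ♯ 0 ⇒ ♯ 0 <' ε ⇒ ⊢ q ⊖ ε <' ℓ)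
              g H Q s ∣ 0ℚ + Q - s ∣ m ℓ ε
              (∣-∣-≤ (0ℚ + Q) s (lin 0 3 (λ h q s → q ⊕ q ≡' h ⇒ ♯ 0 ≤' h ⇒ h ≤' s ⇒ ⊢ ♯ 0 ⊕ q ⊖ s ≤' s ⊖ q) H Q s Q+Q H≥0 H≤s)
                (lin 0 2 (λ q s → ⊢ s ⊖ (♯ 0 ⊕ q) ≤' s ⊖ q) Q s)) s≤g h m≤ ε>0)
          ]′ (route-bounded at-Q l m r')

    girth/4≤δ : δ≥ G (ℤ.+ g ℚ./ 4)
    girth/4≤δ ε ε>0 = bigon , zero , P , (Q , 0≤Q , Q≤H , samePoint at-Q at-Q refl) , far
      where
      far : ∀ j q → j ≢ zero → OnSide G bigon j q → DistGt G P q (Q - ε)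
      far zero q 0≢0 _ = ⊥-elim (0≢0 refl)
      far (suc zero) q _ (s , h , h' , same) = P-far (YZ.at-arc s h h')
        (lin 0 2 (λ h s → ♯ 0 ≤' s ⇒ ⊢ h ≤' h ⊕ s) H s h) (lin 1 2 (λ g h s → h ⊕ h ≡' ↑ g ⇒ ♯ 0 ≤' h ⇒ s ≤' ♯ 0 ⇒ ⊢ h ⊕ s ≤' ↑ g) g H s H+H H≥0 h') ε>0 q same
      far (suc (suc zero)) q _ (s , h , h' , same) = P-far (ZX.at-arc s h h')
        (lin 0 2 (λ h s → ♯ 0 ≤' s ⇒ ⊢ h ≤' h ⊕ s) H s h) (lin 1 2 (λ g h s → h ⊕ h ≡' ↑ g ⇒ s ≤' h ⇒ ⊢ h ⊕ s ≤' ↑ g) g H s H+H h') ε>0 q same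

open GirthTriangles

-- From a sampled curve outside a ball to a simple closed path through its centre.

module DetourExtraction where
  open import Data.Rational using (_+_; _-_; _≤_; _<_; ∣_∣)
  open import Data.Nat using (_∸_)

  module Detours {n : ℕ} (G : Graph n) where
    open Graph G
    open Metric G
    open Sequences G
    open Point

    -- A simple closed path Γ 0, …, Γ K through the edge {Γ K , Γ 0} which contains a point p.  Up to index kx from the
    -- front and ky from the back it follows shortest paths from p to x' and y', two points at distance ρ from p and 2ρ
    -- from each other, whose positions along Γ are X and Y; all the other vertices are at distance ≥ ρ - η from p,
    -- where η is the step with which the sides of the triangle are sampled.
    record Detour (ρ η : ℚ) : Set where
      field
        kx ky q₀ : ℕ
        Γ : ℕ → V
        X Y : ℚ
      K : ℕ
      K = suc kx ℕ.+ (suc q₀ ℕ.+ ky)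
      field
        X+Y : X + Y + 1ℚ ≡ ρ + ρ
        path : Path Γ K
        simple : Inj Γ K
        close : adj (Γ K) (Γ 0) ≡ true
        inner-inner : ∀ i j q → i ℕ.≤ kx → j ℕ.≤ ky → Walk G q (Γ i) (Γ (K ∸ j)) → suc (i ℕ.+ j) ℕ.≤ q
        outer-inner : ∀ j q → j ℕ.≤ ky → Walk G q (Γ (suc kx)) (Γ (K ∸ j)) → X + ι j + 1ℚ ≤ ι q + (ι (suc kx) - X) + (η + η)
        inner-outer : ∀ i q → i ℕ.≤ kx → Walk G q (Γ i) (Γ (K ∸ suc ky)) → Y + ι i + 1ℚ ≤ ι q + (ι (suc ky) - Y) + (η + η)
        outer-outer : ∀ q → Walk G q (Γ (suc kx)) (Γ (K ∸ suc ky)) →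
                      X + Y + 1ℚ ≤ ι q + (ι (suc kx) - X) + (ι (suc ky) - Y) + (η + η + (η + η))
        front-far : ∀ i o q → i ℕ.≤ kx → kx ℕ.< o → o ℕ.+ ky ℕ.< K → Walk G q (Γ i) (Γ o) → X ≤ ι q + ι i + η
        back-far : ∀ j o q → j ℕ.≤ ky → kx ℕ.< o → o ℕ.+ ky ℕ.< K → Walk G q (Γ (K ∸ j)) (Γ o) → Y ≤ ι q + ι j + η

    End : Point G → V → Set
    End q v = v ≡ a q ⊎ v ≡ b q

    exit-end : ∀ q {v c} → Exit G q v c → End q v
    exit-end q (inj₁ (e , _)) = inj₁ e
    exit-end q (inj₂ (e , _)) = inj₂ e

    end-adj : ∀ q {u v} → End q u → End q v → u ≡ v ⊎ adj u v ≡ true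
    end-adj q (inj₁ refl) (inj₁ refl) = inj₁ refl
    end-adj q (inj₁ refl) (inj₂ refl) = inj₂ (edge q)
    end-adj q (inj₂ refl) (inj₁ refl) = inj₂ (adj-sym (edge q))
    end-adj q (inj₂ refl) (inj₂ refl) = inj₁ refl

    other-exit : ∀ q {u v c} → Exit G q u c → End q v → u ≢ v → ∃ λ d → Exit G q v d × d ≡ 1ℚ - c
    other-exit q (inj₁ (refl , refl)) (inj₁ refl) u≢v = ⊥-elim (u≢v refl)
    other-exit q (inj₁ (refl , refl)) (inj₂ refl) _ = 1ℚ - t q , inj₂ (refl , refl) , refl
    other-exit q (inj₂ (refl , refl)) (inj₁ refl) _ = t q , inj₁ (refl , refl) , lin 0 1 (λ t → ⊢ t ≡' ♯ 1 ⊖ (♯ 1 ⊖ t)) (t q)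
    other-exit q (inj₂ (refl , refl)) (inj₂ refl) u≢v = ⊥-elim (u≢v refl)

    SameEdge : Point G → Point G → Set
    SameEdge q s = (a q ≡ a s × b q ≡ b s) ⊎ (a q ≡ b s × b q ≡ a s)

    sameEdge-end : ∀ q s {v} → SameEdge q s → End q v → End s v
    sameEdge-end q s (inj₁ (h , h')) (inj₁ e) = inj₁ (trans e h)
    sameEdge-end q s (inj₁ (h , h')) (inj₂ e) = inj₂ (trans e h')
    sameEdge-end q s (inj₂ (h , h')) (inj₁ e) = inj₂ (trans e h)
    sameEdge-end q s (inj₂ (h , h')) (inj₂ e) = inj₁ (trans e h')

    sameEdge-sym : ∀ q s → SameEdge q s → SameEdge s q
    sameEdge-sym q s (inj₁ (h , h')) = inj₁ (sym h , sym h')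
    sameEdge-sym q s (inj₂ (h , h')) = inj₂ (sym h' , sym h)

    sameEdge-trans : ∀ q s r → SameEdge q s → SameEdge s r → SameEdge q r
    sameEdge-trans q s r (inj₁ (h , h')) (inj₁ (k , k')) = inj₁ (trans h k , trans h' k')
    sameEdge-trans q s r (inj₁ (h , h')) (inj₂ (k , k')) = inj₂ (trans h k , trans h' k')
    sameEdge-trans q s r (inj₂ (h , h')) (inj₁ (k , k')) = inj₂ (trans h k' , trans h' k)
    sameEdge-trans q s r (inj₂ (h , h')) (inj₂ (k , k')) = inj₁ (trans h k' , trans h' k)

    sameEdge-dist : ∀ q s → SameEdge q s → DistLe G q s 1ℚ
    sameEdge-dist q s (inj₁ (h , h')) = ∣ t q - t s ∣ , inj₂ (inj₁ (h , h' , refl)) , ∣-∣-≤ (t q) (t s)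
      (lin 0 2 (λ x y → x ≤' ♯ 1 ⇒ ♯ 0 ≤' y ⇒ ⊢ x ⊖ y ≤' ♯ 1) (t q) (t s) (t≤1 q) (t≥0 s))
      (lin 0 2 (λ x y → ♯ 0 ≤' x ⇒ y ≤' ♯ 1 ⇒ ⊢ y ⊖ x ≤' ♯ 1) (t q) (t s) (t≥0 q) (t≤1 s))
    sameEdge-dist q s (inj₂ (h , h')) = ∣ t q - (1ℚ - t s) ∣ , inj₂ (inj₂ (h , h' , refl)) , ∣-∣-≤ (t q) (1ℚ - t s)
      (lin 0 2 (λ x y → x ≤' ♯ 1 ⇒ y ≤' ♯ 1 ⇒ ⊢ x ⊖ (♯ 1 ⊖ y) ≤' ♯ 1) (t q) (t s) (t≤1 q) (t≤1 s))
      (lin 0 2 (λ x y → ♯ 0 ≤' x ⇒ ♯ 0 ≤' y ⇒ ⊢ ♯ 1 ⊖ y ⊖ x ≤' ♯ 1) (t q) (t s) (t≥0 q) (t≥0 s))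

    direct-≤1 : ∀ q s {ℓ} → (a q ≡ a s × b q ≡ b s × ℓ ≡ ∣ t q - t s ∣) ⊎ (a q ≡ b s × b q ≡ a s × ℓ ≡ ∣ t q - (1ℚ - t s) ∣) → ℓ ≤ 1ℚ
    direct-≤1 q s (inj₁ (h , h' , refl)) = proj₂ (proj₂ (sameEdge-dist q s (inj₁ (h , h'))))
    direct-≤1 q s (inj₂ (h , h' , refl)) = proj₂ (proj₂ (sameEdge-dist q s (inj₂ (h , h'))))

    module Around (connected : Connected G) (p : Point G) (ρ η : ℚ) (0<t : 0ℚ < t p) (t<1 : t p < 1ℚ)
                  (η>0 : 0ℚ < η) (η<1 : η < 1ℚ) (ρ>1+η : 1ℚ + η < ρ) where
      open Decide connected

      FarPoint : Point G → Set
      FarPoint q = ∀ ℓ → Route G p q ℓ → ρ ≤ ℓ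

      -- The discrete form of a curve outside the open ball around p. Nothing is asked of the last
      -- point, so that a chain can end where the next one begins.
      data Chain : Point G → Point G → Set where
        stop : ∀ q → Chain q q
        link : ∀ q q₁ {q₂ ℓ} → FarPoint q → Route G q q₁ ℓ → ℓ ≤ η → Chain q₁ q₂ → Chain q q₂

      -- The ball is shrunk by η because a vertex passed between two samples is only known to be
      -- within η of a far one.
      W : V → Set
      W v = ∀ ℓ → Reach p v ℓ → ρ - η ≤ ℓ

      data OuterWalk : V → V → Set where
        here : ∀ {u} → W u → OuterWalk u u
        step : ∀ {u v w} → W u → adj u v ≡ true → OuterWalk v w → OuterWalk u w

      start-W : ∀ {u v} → OuterWalk u v → W u
      start-W (here h) = h
      start-W (step h _ _) = h

      move : ∀ {u v w} → W u → u ≡ v ⊎ adj u v ≡ true → OuterWalk v w → OuterWalk u w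
      move h (inj₁ refl) o = o
      move h (inj₂ e) o = step h e o

      extend : ∀ {u v w} → OuterWalk u v → v ≡ w ⊎ adj v w ≡ true → W w → OuterWalk u w
      extend (here h) e k = move h e (here k)
      extend (step h e o) e' k = step h e (extend o e' k)

      -- A route of length at most η < 1 contains no whole edge.
      link-cases : ∀ q q₁ {ℓ} → FarPoint q → Route G q q₁ ℓ → ℓ ≤ η → SameEdge q q₁ ⊎ ∃ λ v → End q v × End q₁ v × W v
      link-cases q q₁ far (inj₂ (inj₁ (h , h' , _))) _ = inj₁ (inj₁ (h , h'))
      link-cases q q₁ far (inj₂ (inj₂ (h , h' , _))) _ = inj₁ (inj₂ (h , h'))
      link-cases q q₁ far (inj₁ (v , _ , 0 , c , d , e , e' , [] , refl)) h = inj₂ (v , exit-end q e , exit-end q₁ e' , λ ℓ r →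
        lin 0 5 (λ ρ η ℓ c d → c ⊕ ♯ 0 ⊕ d ≤' η ⇒ ♯ 0 ≤' d ⇒ ρ ≤' ℓ ⊕ c ⇒ ⊢ ρ ⊖ η ≤' ℓ) ρ η ℓ c d h (exit≥0 q₁ e') (far (ℓ + c) (reach-exit p q r e)))
      link-cases q q₁ far (inj₁ (v , w , suc k , c , d , e , e' , x , refl)) h = ⊥-elim
        (lin 1 3 (λ k c d η → c ⊕ ↑ (# 1 ⊕ k) ⊕ d ≤' η ⇒ ♯ 0 ≤' c ⇒ ♯ 0 ≤' d ⇒ η <' ♯ 1 ⇒ ⊢ ⊥') k c d η h (exit≥0 q e) (exit≥0 q₁ e') η<1)

      Crossing : Point G → Point G → Set
      Crossing q s = ∃ λ u → ∃ λ v → End q u × End s v × OuterWalk u v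

      chain-walk : ∀ {q s} → Chain q s → SameEdge q s ⊎ Crossing q s
      chain-walk (stop q) = inj₁ (inj₁ (refl , refl))
      chain-walk {_} {s} (link q q₁ far r h c) = glue (link-cases q q₁ far r h) (chain-walk c)
        where
        glue : SameEdge q q₁ ⊎ (∃ λ v → End q v × End q₁ v × W v) → SameEdge q₁ s ⊎ Crossing q₁ s → SameEdge q s ⊎ Crossing q s
        glue (inj₁ e) (inj₁ e') = inj₁ (sameEdge-trans q q₁ s e e')
        glue (inj₁ e) (inj₂ (u , v , eu , ev , o)) = inj₂ (u , v , sameEdge-end q₁ q (sameEdge-sym q q₁ e) eu , ev , o)
        glue (inj₂ (v , ev , ev₁ , wv)) (inj₁ e) = inj₂ (v , v , ev , sameEdge-end q₁ s e ev₁ , here wv)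
        glue (inj₂ (v , ev , ev₁ , wv)) (inj₂ (u , v' , eu , ev' , o)) = inj₂ (v , v' , ev , ev' , move wv (end-adj q₁ ev₁ eu) o)

      -- A shortest path from p towards x up to its first vertex outside the shrunken ball: the
      -- indices up to k are inside, `suc k` is outside. By `d≤` the point x is, up to 2η, no
      -- farther from that outer vertex than its position ρ - c along the path suggests.
      record Ray (x : Point G) (u : V) : Set where
        field
          start : V
          c d : ℚ
          k : ℕ
          w : ℕ → V
          exit : Exit G p start c
          w₀ : w 0 ≡ start
          path : Path w (suc k)
          exact : ∀ i ℓ → i ℕ.≤ k → Reach p (w i) ℓ → c + ι i ≤ ℓ
          inner : c + ι k < ρ - η
          outer : W (w (suc k))
          back : ∀ i → i ℕ.≤ k → Reach x (w i) (ρ - c - ι i)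
          beyond : Reach x (w (suc k)) d
          d≤ : d ≤ ι (suc k) - (ρ - c) + (η + η)
          near : w (suc k) ≡ u ⊎ adj (w (suc k)) u ≡ true

      ray : ∀ x u → Route G p x ρ → FarPoint x → End x u → W u → Ray x u
      ray x u (inj₂ r) far _ _ = ⊥-elim (lin 0 2 (λ ρ η → ρ ≤' ♯ 1 ⇒ ♯ 1 ⊕ η <' ρ ⇒ ♯ 0 <' η ⇒ ⊢ ⊥') ρ η (direct-≤1 p x r) ρ>1+η η>0)
      ray x u (inj₁ (e , f , m , c , c' , ex , ex' , walk , ρ≡)) far eu wu =
        [ (λ { (ℓ , r , ℓ<) → short ℓ r ℓ< }) , long m walk ρ≡ ]′ (reach-near-or-far p f (ρ - η))
        where
        exact : ∀ {m} (walk : Walk G m e f) → ρ ≡ c + ι m + c' → ∀ i ℓ → i ℕ.≤ m → Reach p (at walk i) ℓ → c + ι i ≤ ℓ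
        exact {m} walk ρ≡ i ℓ i≤m r =
          lin 3 4 (λ m i j c c' ρ ℓ → ρ ≡' c ⊕ ↑ m ⊕ c' ⇒ i ⊕ j ≡' m ⇒ ρ ≤' ℓ ⊕ ↑ j ⊕ c' ⇒ ⊢ c ⊕ ↑ i ≤' ℓ) m i (m ∸ i) c c' ρ ℓ ρ≡
            (ℕ.m+[n∸m]≡n i≤m) (far _ (reach-exit p x (reach-walk p r (subst (Walk G (m ∸ i) (at walk i)) (at-end walk)
              (path-walk (at-path walk) i≤m ℕ.≤-refl))) ex'))

        back : ∀ {m} (walk : Walk G m e f) → ρ ≡ c + ι m + c' → ∀ i → i ℕ.≤ m → Reach x (at walk i) (ρ - c - ι i)
        back {m} walk ρ≡ i i≤m = f , m ∸ i , c' , ex' ,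
          reverseʷ (subst (Walk G (m ∸ i) (at walk i)) (at-end walk) (path-walk (at-path walk) i≤m ℕ.≤-refl)) ,
          lin 3 3 (λ m i j c c' ρ → ρ ≡' c ⊕ ↑ m ⊕ c' ⇒ i ⊕ j ≡' m ⇒ ⊢ ρ ⊖ c ⊖ ↑ i ≡' c' ⊕ ↑ j) m i (m ∸ i) c c' ρ ρ≡ (ℕ.m+[n∸m]≡n i≤m)

        p-reach : ∀ {m} → Walk G m e f → Reach p f (c + ι m)
        p-reach {m} walk = e , m , c , ex , walk , refl

        -- The last vertex f of the path is already outside the shrunken ball. Then x lies at most η
        -- beyond f, which is the origin of the 2η in `d≤`.
        long : ∀ m (walk : Walk G m e f) → ρ ≡ c + ι m + c' → W f → Ray x u
        long zero walk ρ≡ wf = ⊥-elim (lin 0 3 (λ ρ η c → ρ ⊖ η ≤' c ⊕ ♯ 0 ⇒ c ≤' ♯ 1 ⇒ ♯ 1 ⊕ η <' ρ ⇒ ⊢ ⊥') ρ η c (wf (c + ι 0) (p-reach walk)) (exit≤1 p ex) ρ>1+η)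
        long (suc k) walk ρ≡ wf = record
          { start = e ; c = c ; d = c' ; k = k ; w = at walk ; exit = ex ; w₀ = at-start walk ; path = at-path walk
          ; exact = λ i ℓ i≤k → exact walk ρ≡ i ℓ (ℕ.m≤n⇒m≤1+n i≤k)
          ; inner = lin 1 4 (λ k ρ η c c' → ρ ≡' c ⊕ ↑ (# 1 ⊕ k) ⊕ c' ⇒ η <' ♯ 1 ⇒ ♯ 0 ≤' c' ⇒ ⊢ c ⊕ ↑ k <' ρ ⊖ η) k ρ η c c' ρ≡ η<1 (exit≥0 x ex')
          ; outer = subst W (sym (at-end walk)) wf
          ; back = λ i i≤k → back walk ρ≡ i (ℕ.m≤n⇒m≤1+n i≤k)
          ; beyond = subst (λ v → Reach x v c') (sym (at-end walk)) (exit-reach x ex')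
          ; d≤ = lin 1 4 (λ k ρ η c c' → ρ ≡' c ⊕ ↑ (# 1 ⊕ k) ⊕ c' ⇒ ρ ⊖ η ≤' c ⊕ ↑ (# 1 ⊕ k) ⇒ ⊢ c' ≤' ↑ (# 1 ⊕ k) ⊖ (ρ ⊖ c) ⊕ (η ⊕ η))
              k ρ η c c' ρ≡ (wf (c + ι (suc k)) (p-reach walk))
          ; near = subst (λ v → v ≡ u ⊎ adj v u ≡ true) (sym (at-end walk)) (end-adj x (exit-end x ex') eu) }

        -- Here f is still inside and so differs from u; the edge of x prolongs the path from f to
        -- u.
        short : ∀ ℓ → Reach p f ℓ → ℓ < ρ - η → Ray x u
        short ℓ r ℓ< = build (other-exit x ex' eu f≢u)
          where
          f≢u : f ≢ u
          f≢u refl = lin 0 3 (λ ρ η ℓ → ℓ <' ρ ⊖ η ⇒ ρ ⊖ η ≤' ℓ ⇒ ⊢ ⊥') ρ η ℓ ℓ< (wu ℓ r)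
          w : ℕ → V
          w = append (at walk) m (λ _ → u)
          w-left : ∀ {i} → i ℕ.≤ m → w i ≡ at walk i
          w-left = append-left (at walk) m (λ _ → u)
          w-end : w (suc m) ≡ u
          w-end = trans (cong (λ i → w (suc i)) (sym (ℕ.+-identityʳ m))) (append-right (at walk) m (λ _ → u) 0)
          build : (∃ λ d → Exit G x u d × d ≡ 1ℚ - c') → Ray x u
          build (d , exd , d≡) = record
            { start = e ; c = c ; d = d ; k = m ; w = w ; exit = ex ; w₀ = trans (w-left z≤n) (at-start walk)
            ; path = subst (Path w) (ℕ.+-identityʳ (suc m)) (path-append (at-path walk) (λ _ ())
                (subst (λ v → adj v u ≡ true) (sym (at-end walk)) ([ (λ e → ⊥-elim (f≢u e)) , (λ e → e) ]′ (end-adj x (exit-end x ex') eu))))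
            ; exact = λ i ℓ i≤m r → exact walk ρ≡ i ℓ i≤m (subst (λ v → Reach p v ℓ) (w-left i≤m) r)
            ; inner = ℚ.≤-<-trans (exact walk ρ≡ m ℓ ℕ.≤-refl (subst (λ v → Reach p v ℓ) (sym (at-end walk)) r)) ℓ<
            ; outer = subst W (sym w-end) wu
            ; back = λ i i≤m → subst (λ v → Reach x v (ρ - c - ι i)) (sym (w-left i≤m)) (back walk ρ≡ i i≤m)
            ; beyond = subst (λ v → Reach x v d) (sym w-end) (exit-reach x exd)
            ; d≤ = lin 1 5 (λ m ρ η c c' d → d ≡' ♯ 1 ⊖ c' ⇒ ρ ≡' c ⊕ ↑ m ⊕ c' ⇒ ♯ 0 <' η ⇒ ⊢ d ≤' ↑ (# 1 ⊕ m) ⊖ (ρ ⊖ c) ⊕ (η ⊕ η))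
                m ρ η c c' d d≡ ρ≡ η>0
            ; near = inj₁ w-end }

      outer-length : ∀ {u v} → OuterWalk u v → ℕ
      outer-length (here _) = 0
      outer-length (step _ _ o) = suc (outer-length o)

      outer-at : ∀ {u v} → OuterWalk u v → ℕ → V
      outer-at (here {u} _) _ = u
      outer-at (step {u} _ _ o) zero = u
      outer-at (step _ _ o) (suc i) = outer-at o i

      outer-start : ∀ {u v} (o : OuterWalk u v) → outer-at o 0 ≡ u
      outer-start (here _) = refl
      outer-start (step _ _ _) = refl

      outer-end : ∀ {u v} (o : OuterWalk u v) → outer-at o (outer-length o) ≡ v
      outer-end (here _) = refl
      outer-end (step _ _ o) = outer-end o

      outer-path : ∀ {u v} (o : OuterWalk u v) → Path (outer-at o) (outer-length o)
      outer-path (step {u} _ e o) zero _ = subst (λ v → adj u v ≡ true) (sym (outer-start o)) e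
      outer-path (step _ _ o) (suc i) (s≤s h) = outer-path o i h

      outer-W : ∀ {u v} (o : OuterWalk u v) i → W (outer-at o i)
      outer-W (here h) _ = h
      outer-W (step h _ o) zero = h
      outer-W (step _ _ o) (suc i) = outer-W o i

      module Close (x y : Point G) (xy-far : ∀ ℓ → Route G x y ℓ → ρ + ρ ≤ ℓ)
                   {u v : V} (R : Ray x u) (S : Ray y v) (o : OuterWalk u v) where
        private
          module R = Ray R
          module S = Ray S

        -- If both rays left the edge of p at the same end, x and y would be joined through that end
        -- in less than 2ρ, since p has positive distance from either end.
        exits : R.c + S.c ≡ 1ℚ × adj S.start R.start ≡ true
        exits = cases R.exit S.exit refl refl
          where
          across-zero : ∀ {c c'} → R.c ≡ c → S.c ≡ c' → 0ℚ < c → c ≡ c' → R.start ≡ S.start → ⊥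
          across-zero refl refl 0<c refl e = lin 0 2 (λ ρ c → ρ ⊕ ρ ≤' ρ ⊖ c ⊖ ♯ 0 ⊕ ♯ 0 ⊕ (ρ ⊖ c ⊖ ♯ 0) ⇒ ♯ 0 <' c ⇒ ⊢ ⊥') ρ R.c
            (xy-far _ (meet x y (R.back 0 z≤n) (subst (Walk G 0 (R.w 0)) (trans R.w₀ (trans e (sym S.w₀))) []) (S.back 0 z≤n))) 0<c

          cases : ∀ {e e' c c'} → Exit G p e c → Exit G p e' c' → (R.start , R.c) ≡ (e , c) → (S.start , S.c) ≡ (e' , c') → R.c + S.c ≡ 1ℚ × adj S.start R.start ≡ true
          cases (inj₁ (refl , refl)) (inj₁ (refl , refl)) h h' = ⊥-elim (across-zero (cong proj₂ h) (cong proj₂ h') 0<t refl (trans (cong proj₁ h) (sym (cong proj₁ h'))))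
          cases (inj₁ (refl , refl)) (inj₂ (refl , refl)) refl refl = lin 0 1 (λ t → ⊢ t ⊕ (♯ 1 ⊖ t) ≡' ♯ 1) (t p) , adj-sym (edge p)
          cases (inj₂ (refl , refl)) (inj₁ (refl , refl)) refl refl = lin 0 1 (λ t → ⊢ ♯ 1 ⊖ t ⊕ t ≡' ♯ 1) (t p) , edge p
          cases (inj₂ (refl , refl)) (inj₂ (refl , refl)) h h' = ⊥-elim (across-zero (cong proj₂ h) (cong proj₂ h')
            (lin 0 1 (λ t → t <' ♯ 1 ⇒ ⊢ ♯ 0 <' ♯ 1 ⊖ t) (t p) t<1) refl (trans (cong proj₁ h) (sym (cong proj₁ h'))))

        c+c : R.c + S.c ≡ 1ℚ
        c+c = proj₁ exits

        ray-inj : ∀ {z a} (T : Ray z a) → Inj (Ray.w T) (Ray.k T)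
        ray-inj T i j i<j j≤k e = lin 2 1 (λ i j c → i <' j ⇒ c ⊕ ↑ j ≤' c ⊕ ↑ i ⇒ ⊢ ⊥') i j T.c i<j (T.exact j (T.c + ι i) j≤k
          (subst (λ v → Reach p v (T.c + ι i)) e
            (T.start , i , T.c , T.exit , subst (λ v → Walk G i v (T.w i)) T.w₀ (path-walk T.path z≤n (ℕ.≤-trans (ℕ.≤-trans (ℕ.<⇒≤ i<j) j≤k) (ℕ.n≤1+n T.k))) , refl)))
          where module T = Ray T

        ray-not-W : ∀ {z a} (T : Ray z a) i → i ℕ.≤ Ray.k T → ¬ W (Ray.w T i)
        ray-not-W T i i≤k h = lin 2 3 (λ i k c ρ η → i ≤' k ⇒ c ⊕ ↑ k <' ρ ⊖ η ⇒ ρ ⊖ η ≤' c ⊕ ↑ i ⇒ ⊢ ⊥') i T.k T.c ρ η i≤k T.inner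
          (h (T.c + ι i) (T.start , i , T.c , T.exit , subst (λ v → Walk G i v (T.w i)) T.w₀ (path-walk T.path z≤n (ℕ.≤-trans i≤k (ℕ.n≤1+n T.k))) , refl))
          where module T = Ray T

        -- A walk between the rays completes to a route from x to y of length (ρ - c - i) + q + (ρ -
        -- c' - j), which is at least 2ρ, while c + c' = 1. The estimates at the outer ends of the
        -- rays arise in the same way.
        inner-inner : ∀ i j q → i ℕ.≤ R.k → j ℕ.≤ S.k → Walk G q (R.w i) (S.w j) → suc (i ℕ.+ j) ℕ.≤ q
        inner-inner i j q i≤ j≤ z = lin 3 3 (λ i j q ρ c c' → c ⊕ c' ≡' ♯ 1 ⇒ ρ ⊕ ρ ≤' ρ ⊖ c ⊖ ↑ i ⊕ ↑ q ⊕ (ρ ⊖ c' ⊖ ↑ j) ⇒ ⊢ # 1 ⊕ (i ⊕ j) ≤' q)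
          i j q ρ R.c S.c c+c (xy-far _ (meet x y (R.back i i≤) z (S.back j j≤)))

        joined : OuterWalk (R.w (suc R.k)) (S.w (suc S.k))
        joined = move R.outer R.near (extend o ([ (λ e → inj₁ (sym e)) , (λ e → inj₂ (adj-sym e)) ]′ S.near) S.outer)

        private
          module O = Simplified (simplify {W} (outer-length joined) (outer-path joined) (λ i _ → outer-W joined i))

          kx ky q₀ K : ℕ
          kx = R.k
          ky = S.k
          q₀ = O.len
          K = suc kx ℕ.+ (suc q₀ ℕ.+ ky)

          tail Γ : ℕ → V
          tail = append O.seq q₀ (λ j → S.w (ky ∸ j))
          Γ = append R.w kx tail

          O-start : O.seq 0 ≡ R.w (suc kx)
          O-start = trans O.start (outer-start joined)

          O-end : O.seq q₀ ≡ S.w (suc ky)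
          O-end = trans O.end (outer-end joined)

          Γ-front : ∀ {i} → i ℕ.≤ kx → Γ i ≡ R.w i
          Γ-front = append-left R.w kx tail

          Γ-mid : ∀ j → j ℕ.≤ q₀ → Γ (suc kx ℕ.+ j) ≡ O.seq j
          Γ-mid j j≤ = trans (append-right R.w kx tail j) (append-left O.seq q₀ _ j≤)

          Γ-kx : Γ (suc kx) ≡ R.w (suc kx)
          Γ-kx = trans (trans (cong (λ i → Γ (suc i)) (sym (ℕ.+-identityʳ kx))) (Γ-mid 0 z≤n)) O-start

          Γ-back : ∀ j → j ℕ.≤ ky → Γ (K ∸ j) ≡ S.w j
          Γ-back j j≤ = trans (cong Γ shift) (trans (append-right R.w kx tail _) (trans (append-right O.seq q₀ _ (ky ∸ j)) (cong S.w (ℕ.m∸[m∸n]≡n j≤))))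
            where
            shift : K ∸ j ≡ suc kx ℕ.+ (suc q₀ ℕ.+ (ky ∸ j))
            shift = trans (ℕ.+-∸-assoc (suc kx) (ℕ.≤-trans j≤ (ℕ.m≤n+m ky (suc q₀)))) (cong (suc kx ℕ.+_) (ℕ.+-∸-assoc (suc q₀) j≤))

          Γ-ky : Γ (K ∸ suc ky) ≡ S.w (suc ky)
          Γ-ky = trans (cong Γ shift) (trans (Γ-mid q₀ ℕ.≤-refl) O-end)
            where
            shift : K ∸ suc ky ≡ suc kx ℕ.+ q₀
            shift = trans (cong (_∸ suc ky) (lin 3 0 (λ kx q ky → ⊢ # 1 ⊕ kx ⊕ (# 1 ⊕ q ⊕ ky) ≡' # 1 ⊕ kx ⊕ q ⊕ (# 1 ⊕ ky)) kx q₀ ky)) (ℕ.m+n∸n≡m (suc kx ℕ.+ q₀) (suc ky))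

          mid-W : ∀ i → kx ℕ.< i → i ℕ.+ ky ℕ.< K → W (Γ i)
          mid-W i kx<i i< = subst W (trans (sym (Γ-mid (i ∸ suc kx) j≤)) (cong Γ (ℕ.m+[n∸m]≡n kx<i))) (O.inside (i ∸ suc kx) j≤)
            where
            j≤ : i ∸ suc kx ℕ.≤ q₀
            j≤ = lin 5 0 (λ i j kx q ky → # 1 ⊕ kx ⊕ j ≡' i ⇒ i ⊕ ky <' # 1 ⊕ kx ⊕ (# 1 ⊕ q ⊕ ky) ⇒ ⊢ j ≤' q) i (i ∸ suc kx) kx q₀ ky (ℕ.m+[n∸m]≡n kx<i) i<

          along : ∀ {z a} (T : Ray z a) i → i ℕ.≤ Ray.k T → ∀ {q o} → W o → Walk G q (Ray.w T i) o → ρ - Ray.c T ≤ ι q + ι i + η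
          along T i i≤k {q} h z = lin 2 3 (λ i q c ρ η → ρ ⊖ η ≤' c ⊕ ↑ (i ⊕ q) ⇒ ⊢ ρ ⊖ c ≤' ↑ q ⊕ ↑ i ⊕ η) i q T.c ρ η
            (h (T.c + ι (i ℕ.+ q)) (T.start , i ℕ.+ q , T.c , T.exit ,
              subst (λ v → Walk G i v (T.w i)) T.w₀ (path-walk T.path z≤n (ℕ.≤-trans i≤k (ℕ.n≤1+n T.k))) ++ʷ z , refl))
            where module T = Ray T

          walk-cong : ∀ {q u u' v v'} → u ≡ u' → v ≡ v' → Walk G q u v → Walk G q u' v'
          walk-cong refl refl z = z

        private
          X Y : ℚ
          X = ρ - R.c
          Y = ρ - S.c

          outer-inner : ∀ j q → j ℕ.≤ ky → Walk G q (R.w (suc kx)) (S.w j) → X + ι j + 1ℚ ≤ ι q + (ι (suc kx) - X) + (η + η)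
          outer-inner j q j≤ z = lin 3 5 (λ j q kx ρ η c c' d → c ⊕ c' ≡' ♯ 1 ⇒ d ≤' ↑ (# 1 ⊕ kx) ⊖ (ρ ⊖ c) ⊕ (η ⊕ η) ⇒ ρ ⊕ ρ ≤' d ⊕ ↑ q ⊕ (ρ ⊖ c' ⊖ ↑ j) ⇒
              ⊢ ρ ⊖ c ⊕ ↑ j ⊕ ♯ 1 ≤' ↑ q ⊕ (↑ (# 1 ⊕ kx) ⊖ (ρ ⊖ c)) ⊕ (η ⊕ η)) j q kx ρ η R.c S.c R.d c+c R.d≤
            (xy-far (R.d + ι q + (ρ - S.c - ι j)) (meet x y R.beyond z (S.back j j≤)))

          inner-outer : ∀ i q → i ℕ.≤ kx → Walk G q (R.w i) (S.w (suc ky)) → Y + ι i + 1ℚ ≤ ι q + (ι (suc ky) - Y) + (η + η)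
          inner-outer i q i≤ z = lin 3 5 (λ i q ky ρ η c c' d → c ⊕ c' ≡' ♯ 1 ⇒ d ≤' ↑ (# 1 ⊕ ky) ⊖ (ρ ⊖ c') ⊕ (η ⊕ η) ⇒ ρ ⊕ ρ ≤' ρ ⊖ c ⊖ ↑ i ⊕ ↑ q ⊕ d ⇒
              ⊢ ρ ⊖ c' ⊕ ↑ i ⊕ ♯ 1 ≤' ↑ q ⊕ (↑ (# 1 ⊕ ky) ⊖ (ρ ⊖ c')) ⊕ (η ⊕ η)) i q ky ρ η R.c S.c S.d c+c S.d≤
            (xy-far (ρ - R.c - ι i + ι q + S.d) (meet x y (R.back i i≤) z S.beyond))

          outer-outer : ∀ q → Walk G q (R.w (suc kx)) (S.w (suc ky)) → X + Y + 1ℚ ≤ ι q + (ι (suc kx) - X) + (ι (suc ky) - Y) + (η + η + (η + η))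
          outer-outer q z = lin 3 6 (λ q kx ky ρ η c c' d d' → c ⊕ c' ≡' ♯ 1 ⇒ d ≤' ↑ (# 1 ⊕ kx) ⊖ (ρ ⊖ c) ⊕ (η ⊕ η) ⇒ d' ≤' ↑ (# 1 ⊕ ky) ⊖ (ρ ⊖ c') ⊕ (η ⊕ η) ⇒
              ρ ⊕ ρ ≤' d ⊕ ↑ q ⊕ d' ⇒ ⊢ ρ ⊖ c ⊕ (ρ ⊖ c') ⊕ ♯ 1 ≤' ↑ q ⊕ (↑ (# 1 ⊕ kx) ⊖ (ρ ⊖ c)) ⊕ (↑ (# 1 ⊕ ky) ⊖ (ρ ⊖ c')) ⊕ (η ⊕ η ⊕ (η ⊕ η)))
            q kx ky ρ η R.c S.c R.d S.d c+c R.d≤ S.d≤ (xy-far (R.d + ι q + S.d) (meet x y R.beyond z S.beyond))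

          disjoint : ∀ i j → i ℕ.≤ kx → j ℕ.≤ suc q₀ ℕ.+ ky → R.w i ≢ tail j
          -- The front ray avoids the outer path because of W; a vertex shared with the other ray
          -- would be a walk of length 0 against `inner-inner`.
          disjoint i j i≤ j≤ e = [ in-outer , (λ (j' , j≡) → in-back j' j≡) ]′ (side q₀ j)
            where
            in-outer : ¬ j ℕ.≤ q₀
            in-outer j≤q = ray-not-W R i i≤ (subst W (sym (trans e (append-left O.seq q₀ _ j≤q))) (O.inside j j≤q))
            in-back : ∀ j' → ¬ j ≡ suc q₀ ℕ.+ j'
            in-back j' j≡ = ℕ.n≮0 (inner-inner i (ky ∸ j') 0 i≤ (ℕ.m∸n≤m ky j')
              (subst (Walk G 0 (R.w i)) (trans e (trans (cong tail j≡) (append-right O.seq q₀ _ j'))) []))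

          path : Path Γ K
          path = path-append (path-restrict (ℕ.n≤1+n kx) R.path)
              (path-append O.path (path-reverse (path-restrict (ℕ.n≤1+n ky) S.path))
                (subst (λ v → adj v (S.w ky) ≡ true) (sym O-end) (adj-sym (S.path ky ℕ.≤-refl))))
              (subst (λ v → adj (R.w kx) v ≡ true) (sym (trans (append-left O.seq q₀ _ z≤n) O-start)) (R.path kx ℕ.≤-refl))

          simple : Inj Γ K
          simple = inj-append (ray-inj R) (inj-append O.simple (inj-reverse (ray-inj S))
            (λ i j i≤ j≤ e → ray-not-W S (ky ∸ j) (ℕ.m∸n≤m ky j) (subst W e (O.inside i i≤)))) disjoint

        detour : Detour ρ η
        detour = record
          { kx = kx ; ky = ky ; q₀ = q₀ ; Γ = Γ ; X = X ; Y = Y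
          ; X+Y = lin 0 3 (λ ρ c c' → c ⊕ c' ≡' ♯ 1 ⇒ ⊢ ρ ⊖ c ⊕ (ρ ⊖ c') ⊕ ♯ 1 ≡' ρ ⊕ ρ) ρ R.c S.c c+c
          ; path = path
          ; simple = simple
          ; close = subst₂ (λ v v' → adj v v' ≡ true) (sym (trans (Γ-back 0 z≤n) S.w₀)) (sym (trans (Γ-front z≤n) R.w₀)) (proj₂ exits)
          ; inner-inner = λ i j q i≤ j≤ z → inner-inner i j q i≤ j≤ (walk-cong (Γ-front i≤) (Γ-back j j≤) z)
          ; outer-inner = λ j q j≤ z → outer-inner j q j≤ (walk-cong Γ-kx (Γ-back j j≤) z)
          ; inner-outer = λ i q i≤ z → inner-outer i q i≤ (walk-cong (Γ-front i≤) Γ-ky z)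
          ; outer-outer = λ q z → outer-outer q (walk-cong Γ-kx Γ-ky z)
          ; front-far = λ i o q i≤ kx<o o< z → along R i i≤ (mid-W o kx<o o<) (walk-cong (Γ-front i≤) refl z)
          ; back-far = λ j o q j≤ kx<o o< z → along S j j≤ (mid-W o kx<o o<) (walk-cong (Γ-back j j≤) refl z) }

      detour-of-chain : ∀ x y → Route G p x ρ → Route G p y ρ → FarPoint x → FarPoint y → (∀ ℓ → Route G x y ℓ → ρ + ρ ≤ ℓ) → Chain x y → Detour ρ η
      detour-of-chain x y rx ry fx fy xy-far chain = cases (chain-walk chain)
        where
        last-W : ∀ {u v} → OuterWalk u v → W v
        last-W (here h) = h
        last-W (step _ _ o) = last-W o

        cases : SameEdge x y ⊎ Crossing x y → Detour ρ η
        cases (inj₁ e) = ⊥-elim (close (sameEdge-dist x y e))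
          where
          close : DistLe G x y 1ℚ → ⊥
          close (ℓ , r , h) = lin 0 3 (λ ρ η ℓ → ρ ⊕ ρ ≤' ℓ ⇒ ℓ ≤' ♯ 1 ⇒ ♯ 1 ⊕ η <' ρ ⇒ ♯ 0 <' η ⇒ ⊢ ⊥') ρ η ℓ (xy-far ℓ r) h ρ>1+η η>0
        cases (inj₂ (u , v , eu , ev , o)) = Close.detour x y xy-far (ray x u rx fx eu (start-W o)) (ray y v ry fy ev (last-W o)) o

open DetourExtraction

-- Triangles are thin as soon as all detours are short.

module Thinness where
  open import Data.Rational using (_+_; _-_; _≤_; _<_; ∣_∣)

  half : ∀ a → 0ℚ < a → ∃ λ v → 0ℚ < v × v + v < a
  half a 0<a = let (u , 0<u , u<a) = ℚ.<-dense 0<a in pick u 0<u u<a (ℚ.≤-total u (a - u))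
    where
    pick : ∀ u → 0ℚ < u → u < a → u ≤ a - u ⊎ a - u ≤ u → ∃ λ v → 0ℚ < v × v + v < a
    pick u 0<u u<a (inj₁ h) = let (v , 0<v , v<u) = ℚ.<-dense 0<u in
      v , 0<v , lin 0 3 (λ a u v → v <' u ⇒ u ≤' a ⊖ u ⇒ ⊢ v ⊕ v <' a) a u v v<u h
    pick u 0<u u<a (inj₂ h) = let (v , 0<v , v<) = ℚ.<-dense (lin 0 2 (λ a u → u <' a ⇒ ⊢ ♯ 0 <' a ⊖ u) a u u<a) in
      v , 0<v , lin 0 3 (λ a u v → v <' a ⊖ u ⇒ a ⊖ u ≤' u ⇒ ⊢ v ⊕ v <' a) a u v v< h

  half<1 : ∀ a → 0ℚ < a → ∃ λ v → 0ℚ < v × v + v < a × v < 1ℚ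
  half<1 a 0<a = pick (ℚ.≤-total a 1ℚ)
    where
    pick : a ≤ 1ℚ ⊎ 1ℚ ≤ a → ∃ λ v → 0ℚ < v × v + v < a × v < 1ℚ
    pick (inj₁ h) = let (v , 0<v , v<) = half a 0<a in
      v , 0<v , v< , lin 0 2 (λ a v → ♯ 0 <' v ⇒ v ⊕ v <' a ⇒ a ≤' ♯ 1 ⇒ ⊢ v <' ♯ 1) a v 0<v v< h
    pick (inj₂ h) = let (v , 0<v , v<) = half 1ℚ (ℚ.positive⁻¹ 1ℚ) in
      v , 0<v , ℚ.<-≤-trans v< h , lin 0 1 (λ v → ♯ 0 <' v ⇒ v ⊕ v <' ♯ 1 ⇒ ⊢ v <' ♯ 1) v 0<v v<

  infixr 7 _×ℚ_
  _×ℚ_ : ℕ → ℚ → ℚ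
  zero ×ℚ x = 0ℚ
  suc N ×ℚ x = x + N ×ℚ x

  ×ℚ-ι : ∀ N x → N ×ℚ x ≡ ι N ℚ.* x
  ×ℚ-ι zero x = sym (ℚ.*-zeroˡ x)
  ×ℚ-ι (suc N) x = trans (cong (x +_) (×ℚ-ι N x)) (sym (ι-suc-* N x))

  -- This bounds the number of sampling steps along a side, on which `sample` recurses.
  archimedean : ∀ d x → 0ℚ < x → ∃ λ N → d ≤ N ×ℚ x
  archimedean d x 0<x = let (m , d≤m) = above d ; (D , 1≤Dx) = cover x 0<x in
    m ℕ.* D , ℚ.≤-trans d≤m (subst₂ _≤_ (ℚ.*-identityʳ (ι m))
      (sym (trans (×ℚ-ι (m ℕ.* D) x) (trans (cong (ℚ._* x) (ι-* m D)) (ℚ.*-assoc (ι m) (ι D) x))))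
      (ℚ.*-monoˡ-≤-nonNeg (ι m) {{ℚ.normalize-nonNeg m 1}} 1≤Dx))
    where
    above : ∀ d → ∃ λ m → d ≤ ι m
    above d@(mkℚ (ℤ.+ a) e _) = a , subst (d ≤_) (trans (cong (ι (suc e) ℚ.*_) (sym (ℚ.↥p/↧p≡p d))) (*-cancel-/ a e))
      (subst₂ _≤_ (ℚ.+-identityʳ d) (sym (ι-suc-* e d)) (ℚ.+-monoʳ-≤ d (subst (_≤ ι e ℚ.* d) (ℚ.*-zeroʳ (ι e))
        (ℚ.*-monoˡ-≤-nonNeg (ι e) {{ℚ.normalize-nonNeg e 1}} (ℚ.nonNegative⁻¹ d)))))
    above d@(mkℚ ℤ.-[1+ a ] e _) = 0 , ℚ.<⇒≤ (ℚ.negative⁻¹ d)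
    cover : ∀ x → 0ℚ < x → ∃ λ D → 1ℚ ≤ ι D ℚ.* x
    cover x@(mkℚ (ℤ.+ suc a) d _) _ = suc d , subst (1ℚ ≤_) (sym (trans (cong (ι (suc d) ℚ.*_) (sym (ℚ.↥p/↧p≡p x))) (*-cancel-/ (suc a) d))) (ι-mono {1} {suc a} (s≤s z≤n))
    cover x@(mkℚ (ℤ.+ zero) d _) 0<x = ⊥-elim (ℚ.<-irrefl refl (ℚ.<-≤-trans 0<x (ℚ.nonPositive⁻¹ x)))
    cover x@(mkℚ ℤ.-[1+ a ] d _) 0<x = ⊥-elim (ℚ.<-asym 0<x (ℚ.negative⁻¹ x))

  integer-gap : ∀ {κ} a b → 0ℚ < κ → κ < 1ℚ → κ + ι a ≢ ι b
  integer-gap {κ} a b 0<κ κ<1 e = [ (λ h → lin 2 1 (λ a b κ → κ ⊕ ↑ a ≡' ↑ b ⇒ b ≤' a ⇒ ♯ 0 <' κ ⇒ ⊢ ⊥') a b κ e h 0<κ)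
    , (λ h → lin 2 1 (λ a b κ → κ ⊕ ↑ a ≡' ↑ b ⇒ a <' b ⇒ κ <' ♯ 1 ⇒ ⊢ ⊥') a b κ e h κ<1) ]′ (ℕ.≤-<-connex b a)

  module Thin {n : ℕ} (G : Graph n) (connected : Connected G) where
    open Graph G
    open Metric G
    open Sequences G
    open Detours G
    open Point

    samePoint-sym : ∀ p q → SamePoint G p q → SamePoint G q p
    samePoint-sym p q (r , _) = route-sym p q r , λ ℓ r' → route≥0 q p r'

    Interior : Point G → Set
    Interior q = 0ℚ < t q × t q < 1ℚ

    AtVertex : Point G → Set
    AtVertex q = ∃ λ m → ∃ λ m' → t q ≡ ι m × 1ℚ - t q ≡ ι m'

    interior? : ∀ q → Interior q ⊎ AtVertex q
    interior? q = lower (0ℚ ℚ.<? t q) (t q ℚ.<? 1ℚ)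
      where
      lower : Dec (0ℚ < t q) → Dec (t q < 1ℚ) → Interior q ⊎ AtVertex q
      lower (yes h) (yes h') = inj₁ (h , h')
      lower (no h) _ = inj₂ (0 , 1 , ℚ.≤-antisym (ℚ.≮⇒≥ h) (t≥0 q) ,
        lin 0 1 (λ t → t ≤' ♯ 0 ⇒ ♯ 0 ≤' t ⇒ ⊢ ♯ 1 ⊖ t ≡' ♯ 1) (t q) (ℚ.≮⇒≥ h) (t≥0 q))
      lower _ (no h) = inj₂ (1 , 0 , ℚ.≤-antisym (t≤1 q) (ℚ.≮⇒≥ h) ,
        lin 0 1 (λ t → t ≤' ♯ 1 ⇒ ♯ 1 ≤' t ⇒ ⊢ ♯ 1 ⊖ t ≡' ♯ 0) (t q) (t≤1 q) (ℚ.≮⇒≥ h))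

    atVertex-exit : ∀ q {v c} → AtVertex q → Exit G q v c → ∃ λ m → c ≡ ι m
    atVertex-exit q (m , _ , h , _) (inj₁ (_ , refl)) = m , h
    atVertex-exit q (_ , m , _ , h) (inj₂ (_ , refl)) = m , h

    -- Routes between vertices have integer length. Hence, of two points of a side at distance κ
    -- between 0 and 1, at least one is interior to an edge.
    atVertex-route : ∀ q s {κ} → AtVertex q → AtVertex s → 0ℚ < κ → κ < 1ℚ → ¬ Route G q s κ
    atVertex-route q s {κ} vq vs 0<κ κ<1 (inj₁ (_ , _ , k , c , d , e , e' , _ , refl)) = close (atVertex-exit q vq e) (atVertex-exit s vs e')
      where
      close : (∃ λ m → c ≡ ι m) → (∃ λ m → d ≡ ι m) → ⊥
      close (m , h) (m' , h') = integer-gap 0 (m ℕ.+ k ℕ.+ m') 0<κ κ<1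
        (lin 3 2 (λ m k m' c d → c ≡' ↑ m ⇒ d ≡' ↑ m' ⇒ ⊢ c ⊕ ↑ k ⊕ d ⊕ ♯ 0 ≡' ↑ (m ⊕ k ⊕ m')) m k m' c d h h')
    atVertex-route q s {κ} (m , _ , h , _) (m' , m″ , h' , h″) 0<κ κ<1 (inj₂ r) = direct r
      where
      clash : ∀ {x y} m' → x ≡ ι m → y ≡ ι m' → κ ≡ ∣ x - y ∣ → ⊥
      clash {x} {y} m' h h' e = [ (λ e' → integer-gap m' m 0<κ κ<1 (lin 2 3 (λ m m' x y κ → x ≡' ↑ m ⇒ y ≡' ↑ m' ⇒ κ ≡' x ⊖ y ⇒ ⊢ κ ⊕ ↑ m' ≡' ↑ m) m m' x y κ h h' (trans e e')))
        , (λ e' → integer-gap m m' 0<κ κ<1 (lin 2 3 (λ m m' x y κ → x ≡' ↑ m ⇒ y ≡' ↑ m' ⇒ κ ≡' y ⊖ x ⇒ ⊢ κ ⊕ ↑ m ≡' ↑ m') m m' x y κ h h' (trans e e'))) ]′ (∣-∣-cases x y)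
      direct : (a q ≡ a s × b q ≡ b s × κ ≡ ∣ t q - t s ∣) ⊎ (a q ≡ b s × b q ≡ a s × κ ≡ ∣ t q - (1ℚ - t s) ∣) → ⊥
      direct (inj₁ (_ , _ , e)) = clash m' h h' e
      direct (inj₂ (_ , _ , e)) = clash m″ h h″ e

    on-geodesic : ∀ {x y} (A : Geodesic G x y) s h h' → OnGeodesic G A (Geodesic.γ A s h h')
    on-geodesic A s h h' = s , h , h' , inj₂ (inj₁ (refl , refl , sym (cong ∣_∣ (ℚ.+-inverseʳ (t q))))) , λ ℓ r → route≥0 q q r
      where q = Geodesic.γ A s h h'

    gap : ∀ {x y} (A : Geodesic G x y) {s s'} h₁ h₂ h₁' h₂' → s ≤ s' →
          let open Geodesic A in Route G (γ s h₁ h₂) (γ s' h₁' h₂') (s' - s) × (∀ ℓ → Route G (γ s h₁ h₂) (γ s' h₁' h₂') ℓ → s' - s ≤ ℓ)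
    gap A {s} {s'} h₁ h₂ h₁' h₂' s≤s' = subst (IsDist G (Geodesic.γ A s h₁ h₂) (Geodesic.γ A s' h₁' h₂')) (trans (∣-∣-sym s s') (∣-∣-of-≤ s≤s')) (Geodesic.iso A s s' h₁ h₂ h₁' h₂')

    module Sampling (p : Point G) (ρ η : ℚ) (0<t : 0ℚ < t p) (t<1 : t p < 1ℚ)
                    (η>0 : 0ℚ < η) (η<1 : η < 1ℚ) (ρ>1+η : 1ℚ + η < ρ) where
      open Decide connected
      open Around connected p ρ η 0<t t<1 η>0 η<1 ρ>1+η public

      _++ᶜ_ : ∀ {q r s} → Chain q r → Chain r s → Chain q s
      stop _ ++ᶜ d = d
      link q q₁ f r h c ++ᶜ d = link q q₁ f r h (c ++ᶜ d)

      farPoint-same : ∀ q s → SamePoint G q s → FarPoint q → FarPoint s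
      farPoint-same q s (r , _) f ℓ r' = close (route-trans p s q r' (route-sym q s r))
        where
        close : DistLe G p q (ℓ + 0ℚ) → ρ ≤ ℓ
        close (m , r , h) = ℚ.≤-trans (f m r) (ℚ.≤-trans h (ℚ.≤-reflexive (ℚ.+-identityʳ ℓ)))

      -- Consecutive sides share a corner only up to distance 0, so passing from one to the next
      -- takes two links of length 0.
      joint : ∀ q y s → FarPoint q → SamePoint G q y → SamePoint G s y → Chain q s
      joint q y s f e e' = link q y f (proj₁ e) (ℚ.<⇒≤ η>0) (link y s (farPoint-same q y e f) (proj₁ (samePoint-sym s y e')) (ℚ.<⇒≤ η>0) (stop s))

      module _ {u v : Point G} (A : Geodesic G u v) where
        open Geodesic A

        -- `Found` is the outcome that stops the sampling early, such as a point close to p. On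
        -- stretches where all points are known to be far it is instantiated by `⊥`.
        sample : ∀ {Found : Set} {s₁ s₂} → s₁ ≤ s₂ → (h₁ : 0ℚ ≤ s₁) (h₁' : s₁ ≤ L) (h₂ : 0ℚ ≤ s₂) (h₂' : s₂ ≤ L) →
                 (∀ s h h' → s₁ ≤ s → s ≤ s₂ → Found ⊎ FarPoint (γ s h h')) → Found ⊎ Chain (γ s₁ h₁ h₁') (γ s₂ h₂ h₂')
        sample {Found} {s₁} {s₂} s₁≤s₂ h₁ h₁' h₂ h₂' decide = let (N , h) = archimedean (s₂ - s₁) η η>0 in go N s₁≤s₂ h₁ h₁' h ℚ.≤-refl
          where
          go : ∀ N {s} → s ≤ s₂ → (h₁ : 0ℚ ≤ s) (h₁' : s ≤ L) → s₂ - s ≤ N ×ℚ η → s₁ ≤ s → Found ⊎ Chain (γ s h₁ h₁') (γ s₂ h₂ h₂')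
          go N {s} s≤ k k' bound s₁≤s = [ inj₁ , (λ f → advance N bound f (s₂ - s ℚ.≤? η)) ]′ (decide s k k' s₁≤s s≤)
            where
            last : FarPoint (γ s k k') → s₂ - s ≤ η → Found ⊎ Chain (γ s k k') (γ s₂ h₂ h₂')
            last f h = inj₂ (link (γ s k k') (γ s₂ h₂ h₂') f (proj₁ (gap A k k' h₂ h₂' s≤)) h (stop _))

            advance : ∀ N → s₂ - s ≤ N ×ℚ η → FarPoint (γ s k k') → Dec (s₂ - s ≤ η) → Found ⊎ Chain (γ s k k') (γ s₂ h₂ h₂')
            advance _ _ f (yes h) = last f h
            advance zero bound f (no h) = last f (ℚ.≤-trans bound (ℚ.<⇒≤ η>0))
            advance (suc N) bound f (no h) = [ inj₁ , (λ c → inj₂ (link (γ s k k') (γ (s + η) l l') f (proj₁ (gap A k k' l l' s≤s+η))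
                (ℚ.≤-reflexive (lin 0 2 (λ s η → ⊢ s ⊕ η ⊖ s ≡' η) s η)) c)) ]′
              (go N s+η≤ l l' (lin 0 4 (λ s s₂ η m → s₂ ⊖ s ≤' η ⊕ m ⇒ ⊢ s₂ ⊖ (s ⊕ η) ≤' m) s s₂ η (N ×ℚ η) bound) (ℚ.≤-trans s₁≤s s≤s+η))
              where
              s≤s+η : s ≤ s + η
              s≤s+η = lin 0 2 (λ s η → ♯ 0 <' η ⇒ ⊢ s ≤' s ⊕ η) s η η>0
              s+η≤ : s + η ≤ s₂
              s+η≤ = lin 0 3 (λ s s₂ η → η <' s₂ ⊖ s ⇒ ⊢ s ⊕ η ≤' s₂) s s₂ η (ℚ.≰⇒> h)
              l : 0ℚ ≤ s + η
              l = ℚ.≤-trans k s≤s+η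
              l' : s + η ≤ L
              l' = ℚ.≤-trans s+η≤ h₂'

        search-side : (∃ λ q → OnGeodesic G A q × DistLe G p q ρ) ⊎ (FarPoint (γ L L≥0 ℚ.≤-refl) × Chain (γ 0ℚ ℚ.≤-refl L≥0) (γ L L≥0 ℚ.≤-refl))
        search-side = [ inj₁ , (λ f → [ inj₁ , (λ c → inj₂ (f , c)) ]′ (sample L≥0 ℚ.≤-refl L≥0 L≥0 ℚ.≤-refl (λ s h h' _ _ → decide s h h'))) ]′
          (decide L L≥0 ℚ.≤-refl)
          where
          decide : ∀ s h h' → (∃ λ q → OnGeodesic G A q × DistLe G p q ρ) ⊎ FarPoint (γ s h h')
          decide s h h' = [ (λ d → inj₁ (γ s h h' , on-geodesic A s h h' , d)) , (λ f → inj₂ (λ ℓ r → ℚ.<⇒≤ (f ℓ r))) ]′ (near-or-far p (γ s h h') ρ)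

    -- The triangle argument is the same for all graphs. What depends on the graph is `bound`, which
    -- says that ρ exceeds r by at most 2η in every detour.
    module Triangles (r : ℚ) (1<r : 1ℚ < r)
                     (bound : ∀ {ρ η} → 0ℚ < η → 1ℚ + η < ρ → Detour ρ η →
                              ρ + ρ + (ρ + ρ) ≤ r + r + (r + r) + (η + η + (η + η) + (η + η + (η + η)))) where

      module Side {x y z : Point G} (A : Geodesic G x y) (B : Geodesic G y z) (C : Geodesic G z x) (ε : ℚ) (ε>0 : 0ℚ < ε) where
        private
          module A = Geodesic A
          module B = Geodesic B
          module C = Geodesic C

        Close : Point G → ℚ → Set
        Close p R = (∃ λ q → OnGeodesic G B q × DistLe G p q R) ⊎ (∃ λ q → OnGeodesic G C q × DistLe G p q R)

        close-weaken : ∀ p {R R'} → R ≤ R' → Close p R → Close p R'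
        close-weaken p h (inj₁ (q , on , d)) = inj₁ (q , on , distLe-weaken p q h d)
        close-weaken p h (inj₂ (q , on , d)) = inj₂ (q , on , distLe-weaken p q h d)

        distLe-trans : ∀ p q s {R ℓ} → Route G p q ℓ → DistLe G q s R → DistLe G p s (ℓ + R)
        distLe-trans p q s {R} {ℓ} r (m , r' , h) = distLe-weaken p s (ℚ.+-monoʳ-≤ ℓ h) (route-trans p q s r r')

        close-trans : ∀ p q {R ℓ} → Route G p q ℓ → Close q R → Close p (ℓ + R)
        close-trans p q r (inj₁ (s , on , d)) = inj₁ (s , on , distLe-trans p q s r d)
        close-trans p q r (inj₂ (s , on , d)) = inj₂ (s , on , distLe-trans p q s r d)

        close-x : ∀ s h h' → Close (A.γ s h h') s
        close-x s h h' = inj₂ (x , (C.L , C.L≥0 , ℚ.≤-refl , samePoint-sym (C.γ C.L C.L≥0 ℚ.≤-refl) x C.end) ,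
          distLe-weaken (A.γ s h h') x (ℚ.≤-reflexive (lin 0 1 (λ s → ⊢ s ⊖ ♯ 0 ⊕ ♯ 0 ≡' s) s))
            (route-trans (A.γ s h h') (A.γ 0ℚ ℚ.≤-refl A.L≥0) x (route-sym (A.γ 0ℚ ℚ.≤-refl A.L≥0) (A.γ s h h') (proj₁ (gap A ℚ.≤-refl A.L≥0 h h' h))) (proj₁ A.start)))

        close-y : ∀ s h h' → Close (A.γ s h h') (A.L - s)
        close-y s h h' = inj₁ (y , (0ℚ , ℚ.≤-refl , B.L≥0 , samePoint-sym (B.γ 0ℚ ℚ.≤-refl B.L≥0) y B.start) ,
          distLe-weaken (A.γ s h h') y (ℚ.≤-reflexive (ℚ.+-identityʳ (A.L - s)))
            (route-trans (A.γ s h h') (A.γ A.L A.L≥0 ℚ.≤-refl) y (proj₁ (gap A h h' A.L≥0 ℚ.≤-refl h')) (proj₁ A.end)))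

        module Generic (κ : ℚ) (κ>0 : 0ℚ < κ) (κ<1 : κ < 1ℚ) where
          ρ : ℚ
          ρ = r + κ

          -- Unless a sample of the other two sides is within ρ of p, the samples lead from x₊
          -- through the corners y, z, x to x₋ outside the ball, and the resulting detour is too
          -- long for `bound`.
          generic : ∀ s h h' → Interior (A.γ s h h') → ρ ≤ s → ρ ≤ A.L - s → Close (A.γ s h h') ρ
          generic s h h' (0<t , t<1) ρ≤s ρ≤L-s = let (η , η>0 , η+η<κ) = half κ κ>0 in run η η>0 η+η<κ
            where
            p : Point G
            p = A.γ s h h'

            ρ>0 : 0ℚ < ρ
            ρ>0 = lin 0 2 (λ r κ → ♯ 1 <' r ⇒ ♯ 0 <' κ ⇒ ⊢ ♯ 0 <' r ⊕ κ) r κ 1<r κ>0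

            s₊≤L : s + ρ ≤ A.L
            s₊≤L = lin 0 3 (λ s ρ L → ρ ≤' L ⊖ s ⇒ ⊢ s ⊕ ρ ≤' L) s ρ A.L ρ≤L-s
            0≤s₊ : 0ℚ ≤ s + ρ
            0≤s₊ = lin 0 2 (λ s ρ → ♯ 0 ≤' s ⇒ ♯ 0 <' ρ ⇒ ⊢ ♯ 0 ≤' s ⊕ ρ) s ρ h ρ>0
            0≤s₋ : 0ℚ ≤ s - ρ
            0≤s₋ = lin 0 2 (λ s ρ → ρ ≤' s ⇒ ⊢ ♯ 0 ≤' s ⊖ ρ) s ρ ρ≤s
            s₋≤L : s - ρ ≤ A.L
            s₋≤L = lin 0 3 (λ s ρ L → s ≤' L ⇒ ♯ 0 <' ρ ⇒ ⊢ s ⊖ ρ ≤' L) s ρ A.L h' ρ>0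
            s≤s₊ : s ≤ s + ρ
            s≤s₊ = lin 0 2 (λ s ρ → ♯ 0 <' ρ ⇒ ⊢ s ≤' s ⊕ ρ) s ρ ρ>0
            s₋≤s : s - ρ ≤ s
            s₋≤s = lin 0 2 (λ s ρ → ♯ 0 <' ρ ⇒ ⊢ s ⊖ ρ ≤' s) s ρ ρ>0

            x₊ x₋ : Point G
            x₊ = A.γ (s + ρ) 0≤s₊ s₊≤L
            x₋ = A.γ (s - ρ) 0≤s₋ s₋≤L

            run : ∀ η → 0ℚ < η → η + η < κ → Close p ρ
            run η η>0 η+η<κ = [ inj₁ , (λ (fB , cB) → [ inj₂ , (λ (fC , cC) → ⊥-elim (absurd (detour-of-chain x₊ x₋ route₊ route₋ (far-above (s + ρ) 0≤s₊ s₊≤L ℚ.≤-refl) (far-below (s - ρ) 0≤s₋ s₋≤L ℚ.≤-refl) x₊x₋ (chain fB cB fC cC)))) ]′ (search-side C)) ]′ (search-side B)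
              where
              η<1 : η < 1ℚ
              η<1 = lin 0 2 (λ η κ → ♯ 0 <' η ⇒ η ⊕ η <' κ ⇒ κ <' ♯ 1 ⇒ ⊢ η <' ♯ 1) η κ η>0 η+η<κ κ<1
              1+η<ρ : 1ℚ + η < ρ
              1+η<ρ = lin 0 3 (λ η κ r → ♯ 0 <' η ⇒ η ⊕ η <' κ ⇒ ♯ 1 <' r ⇒ ⊢ ♯ 1 ⊕ η <' r ⊕ κ) η κ r η>0 η+η<κ 1<r
              open Sampling p ρ η 0<t t<1 η>0 η<1 1+η<ρ

              far-above : ∀ s' k k' → s + ρ ≤ s' → FarPoint (A.γ s' k k')
              far-above s' k k' le ℓ r = ℚ.≤-trans (lin 0 3 (λ s ρ s' → s ⊕ ρ ≤' s' ⇒ ⊢ ρ ≤' s' ⊖ s) s ρ s' le) (proj₂ (gap A h h' k k' (ℚ.≤-trans s≤s₊ le)) ℓ r)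

              far-below : ∀ s' k k' → s' ≤ s - ρ → FarPoint (A.γ s' k k')
              far-below s' k k' le ℓ r = ℚ.≤-trans (lin 0 3 (λ s ρ s' → s' ≤' s ⊖ ρ ⇒ ⊢ ρ ≤' s ⊖ s') s ρ s' le)
                (proj₂ (gap A k k' h h' (ℚ.≤-trans le s₋≤s)) ℓ (route-sym p (A.γ s' k k') r))

              route₊ : Route G p x₊ ρ
              route₊ = subst (Route G p x₊) (lin 0 2 (λ s ρ → ⊢ s ⊕ ρ ⊖ s ≡' ρ) s ρ) (proj₁ (gap A h h' 0≤s₊ s₊≤L s≤s₊))
              route₋ : Route G p x₋ ρ
              route₋ = subst (Route G p x₋) (lin 0 2 (λ s ρ → ⊢ s ⊖ (s ⊖ ρ) ≡' ρ) s ρ) (route-sym x₋ p (proj₁ (gap A 0≤s₋ s₋≤L h h' s₋≤s)))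
              x₊x₋ : ∀ ℓ → Route G x₊ x₋ ℓ → ρ + ρ ≤ ℓ
              x₊x₋ ℓ r = ℚ.≤-trans (ℚ.≤-reflexive (lin 0 2 (λ s ρ → ⊢ ρ ⊕ ρ ≡' s ⊕ ρ ⊖ (s ⊖ ρ)) s ρ))
                (proj₂ (gap A 0≤s₋ s₋≤L 0≤s₊ s₊≤L (ℚ.≤-trans s₋≤s s≤s₊)) ℓ (route-sym x₊ x₋ r))

              certain : {P : Set} → ⊥ ⊎ P → P
              certain (inj₂ x) = x

              chain : FarPoint (B.γ B.L B.L≥0 ℚ.≤-refl) → Chain (B.γ 0ℚ ℚ.≤-refl B.L≥0) (B.γ B.L B.L≥0 ℚ.≤-refl) → FarPoint (C.γ C.L C.L≥0 ℚ.≤-refl) →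
                      Chain (C.γ 0ℚ ℚ.≤-refl C.L≥0) (C.γ C.L C.L≥0 ℚ.≤-refl) → Chain x₊ x₋
              chain fB cB fC cC =
                certain (sample A s₊≤L 0≤s₊ s₊≤L A.L≥0 ℚ.≤-refl (λ s' k k' le _ → inj₂ (far-above s' k k' le))) ++ᶜ
                (joint (A.γ A.L A.L≥0 ℚ.≤-refl) y (B.γ 0ℚ ℚ.≤-refl B.L≥0) (far-above A.L A.L≥0 ℚ.≤-refl s₊≤L) A.end B.start ++ᶜ
                (cB ++ᶜ (joint (B.γ B.L B.L≥0 ℚ.≤-refl) z (C.γ 0ℚ ℚ.≤-refl C.L≥0) fB B.end C.start ++ᶜ (cC ++ᶜ
                (joint (C.γ C.L C.L≥0 ℚ.≤-refl) x (A.γ 0ℚ ℚ.≤-refl A.L≥0) fC C.end A.start ++ᶜ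
                certain (sample A 0≤s₋ ℚ.≤-refl A.L≥0 0≤s₋ s₋≤L (λ s' k k' _ le → inj₂ (far-below s' k k' le))))))))

              absurd : Detour ρ η → ⊥
              -- The bound 4(r + κ) ≤ 4r + 8η would give κ ≤ 2η.
              absurd D = lin 0 3 (λ r κ η → r ⊕ κ ⊕ (r ⊕ κ) ⊕ (r ⊕ κ ⊕ (r ⊕ κ)) ≤' r ⊕ r ⊕ (r ⊕ r) ⊕ (η ⊕ η ⊕ (η ⊕ η) ⊕ (η ⊕ η ⊕ (η ⊕ η))) ⇒
                η ⊕ η <' κ ⇒ ⊢ ⊥') r κ η (bound η>0 1+η<ρ D) η+η<κ

        close-side : ∀ p → OnGeodesic G A p → Close p (r + ε)
        close-side p (s , h , h' , same , _) = close-weaken p (ℚ.≤-reflexive (ℚ.+-identityˡ (r + ε))) (close-trans p (A.γ s h h') same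
          (cases (s ℚ.≤? r + ε) (A.L - s ℚ.≤? r + ε)))
          where
          q : Point G
          q = A.γ s h h'
          cases : Dec (s ≤ r + ε) → Dec (A.L - s ≤ r + ε) → Close q (r + ε)
          -- Points within r + ε of a corner are settled by that corner, which lies on another side
          -- as well.
          cases (yes le) _ = close-weaken q le (close-x s h h')
          cases (no _) (yes le) = close-weaken q le (close-y s h h')
          -- p is moved off the vertices, so that the shortest paths to its two sides leave its edge at different ends.
          cases (no s>) (no L-s>) = let (κ , κ>0 , κ+κ<ε , κ<1) = half<1 ε ε>0 in perturb κ κ>0 κ+κ<ε κ<1
            where
            perturb : ∀ κ → 0ℚ < κ → κ + κ < ε → κ < 1ℚ → Close q (r + ε)
            perturb κ κ>0 κ+κ<ε κ<1 = [ here , (λ v → [ shifted , (λ v' → ⊥-elim (atVertex-route q q₊ v v' κ>0 κ<1 route)) ]′ (interior? q₊)) ]′ (interior? q)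
              where
              open Generic κ κ>0 κ<1
              s₊≤L : s + κ ≤ A.L
              s₊≤L = lin 0 5 (λ s κ L r ε → r ⊕ ε <' L ⊖ s ⇒ κ ⊕ κ <' ε ⇒ ♯ 0 <' κ ⇒ ♯ 1 <' r ⇒ ⊢ s ⊕ κ ≤' L) s κ A.L r ε (ℚ.≰⇒> L-s>) κ+κ<ε κ>0 1<r
              s≤s₊ : s ≤ s + κ
              s≤s₊ = lin 0 2 (λ s κ → ♯ 0 <' κ ⇒ ⊢ s ≤' s ⊕ κ) s κ κ>0
              q₊ : Point G
              q₊ = A.γ (s + κ) (ℚ.≤-trans h s≤s₊) s₊≤L
              route : Route G q q₊ κ
              route = subst (Route G q q₊) (lin 0 2 (λ s κ → ⊢ s ⊕ κ ⊖ s ≡' κ) s κ) (proj₁ (gap A h h' (ℚ.≤-trans h s≤s₊) s₊≤L s≤s₊))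
              here : Interior q → Close q (r + ε)
              here i = close-weaken q (lin 0 3 (λ r κ ε → κ ⊕ κ <' ε ⇒ ♯ 0 <' κ ⇒ ⊢ r ⊕ κ ≤' r ⊕ ε) r κ ε κ+κ<ε κ>0)
                (generic s h h' i
                  (lin 0 4 (λ s κ r ε → r ⊕ ε <' s ⇒ κ ⊕ κ <' ε ⇒ ♯ 0 <' κ ⇒ ⊢ r ⊕ κ ≤' s) s κ r ε (ℚ.≰⇒> s>) κ+κ<ε κ>0)
                  (lin 0 4 (λ d κ r ε → r ⊕ ε <' d ⇒ κ ⊕ κ <' ε ⇒ ♯ 0 <' κ ⇒ ⊢ r ⊕ κ ≤' d) (A.L - s) κ r ε (ℚ.≰⇒> L-s>) κ+κ<ε κ>0))
              shifted : Interior q₊ → Close q (r + ε)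
              shifted i = close-weaken q (lin 0 3 (λ r κ ε → κ ⊕ κ <' ε ⇒ ⊢ κ ⊕ (r ⊕ κ) ≤' r ⊕ ε) r κ ε κ+κ<ε) (close-trans q q₊ route
                (generic (s + κ) (ℚ.≤-trans h s≤s₊) s₊≤L i
                  (lin 0 4 (λ s κ r ε → r ⊕ ε <' s ⇒ κ ⊕ κ <' ε ⇒ ♯ 0 <' κ ⇒ ⊢ r ⊕ κ ≤' s ⊕ κ) s κ r ε (ℚ.≰⇒> s>) κ+κ<ε κ>0)
                  (lin 0 5 (λ s κ L r ε → r ⊕ ε <' L ⊖ s ⇒ κ ⊕ κ <' ε ⇒ ⊢ r ⊕ κ ≤' L ⊖ (s ⊕ κ)) s κ A.L r ε (ℚ.≰⇒> L-s>) κ+κ<ε)))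

      thin : δ≤ G r
      thin T ε ε>0 zero p on = [ (λ (q , on , d) → suc zero , (λ ()) , q , on , d) , (λ (q , on , d) → suc (suc zero) , (λ ()) , q , on , d) ]′
        (Side.close-side (Triangle.xy T) (Triangle.yz T) (Triangle.zx T) ε ε>0 p on)
      thin T ε ε>0 (suc zero) p on = [ (λ (q , on , d) → suc (suc zero) , (λ ()) , q , on , d) , (λ (q , on , d) → zero , (λ ()) , q , on , d) ]′
        (Side.close-side (Triangle.yz T) (Triangle.zx T) (Triangle.xy T) ε ε>0 p on)
      thin T ε ε>0 (suc (suc zero)) p on = [ (λ (q , on , d) → zero , (λ ()) , q , on , d) , (λ (q , on , d) → suc zero , (λ ()) , q , on , d) ]′
        (Side.close-side (Triangle.zx T) (Triangle.xy T) (Triangle.yz T) ε ε>0 p on)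

open Thinness

-- Shortcuts of a detour through chords and a hub.

module DetourChords where
  open import Data.Rational using (_+_; _-_; _≤_; _<_; ∣_∣)
  open import Data.Nat using (_∸_)

  module Chords {n : ℕ} (G : Graph n) where
    open Graph G
    open Metric G
    open Sequences G
    open Detours G

    walk-cong : ∀ {q q' u u' v v'} → q ≡ q' → u ≡ u' → v ≡ v' → Walk G q u v → Walk G q' u' v'
    walk-cong refl refl refl z = z

    -- It exchanges the roles of x' and y', which halves the case distinction in `cell`.
    reverse-detour : ∀ {ρ η} → Detour ρ η → Detour ρ η
    reverse-detour {ρ} {η} D = record
      { kx = ky ; ky = kx ; q₀ = q₀ ; Γ = λ i → Γ (K ∸ i) ; X = Y ; Y = X
      ; X+Y = trans (lin 0 2 (λ x y → ⊢ y ⊕ x ⊕ ♯ 1 ≡' x ⊕ y ⊕ ♯ 1) X Y) X+Y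
      ; path = subst (Path (λ i → Γ (K ∸ i))) K≡ (path-reverse path)
      ; simple = subst (Inj (λ i → Γ (K ∸ i))) K≡ (inj-reverse simple)
      ; close = subst (λ v → adj v (Γ K) ≡ true) (sym (back 0 z≤n)) (adj-sym close)
      ; inner-inner = λ i j q i≤ j≤ z → subst (ℕ._≤ q) (cong suc (ℕ.+-comm j i)) (inner-inner j i q j≤ i≤ (reverseʷ (walk-cong refl refl (back j (≤kx j j≤)) z)))
      ; outer-inner = λ j q j≤ z → inner-outer j q j≤ (reverseʷ (walk-cong refl refl (back j (≤kx j j≤)) z))
      ; inner-outer = λ i q i≤ z → outer-inner i q i≤ (reverseʷ (walk-cong refl refl (back (suc kx) (ℕ.m≤m+n (suc kx) _)) z))
      ; outer-outer = λ q z → swap-≤ q (outer-outer q (reverseʷ (walk-cong refl refl (back (suc kx) (ℕ.m≤m+n (suc kx) _)) z)))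
      ; front-far = λ i o q i≤ ky<o o< z → back-far i (K ∸ o) q i≤ (flip₁ o o<) (flip₂ o ky<o (ℕ.≤-trans (ℕ.m≤m+n o kx) (ℕ.<⇒≤ o<))) z
      ; back-far = λ j o q j≤ ky<o o< z → front-far j (K ∸ o) q j≤ (flip₁ o o<) (flip₂ o ky<o (ℕ.≤-trans (ℕ.m≤m+n o kx) (ℕ.<⇒≤ o<))) (walk-cong refl (back j (≤kx j j≤)) refl z)
      }
      where
      open Detour D
      K' : ℕ
      K' = suc ky ℕ.+ (suc q₀ ℕ.+ kx)
      K≡ : K ≡ K'
      K≡ = lin 3 0 (λ kx q ky → ⊢ # 1 ⊕ kx ⊕ (# 1 ⊕ q ⊕ ky) ≡' # 1 ⊕ ky ⊕ (# 1 ⊕ q ⊕ kx)) kx q₀ ky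
      back : ∀ j → j ℕ.≤ K → Γ (K ∸ (K' ∸ j)) ≡ Γ j
      back j j≤ = cong Γ (trans (cong (λ k → K ∸ (k ∸ j)) (sym K≡)) (ℕ.m∸[m∸n]≡n j≤))
      ≤kx : ∀ j → j ℕ.≤ kx → j ℕ.≤ K
      ≤kx j h = ℕ.≤-trans h (ℕ.≤-trans (ℕ.n≤1+n kx) (ℕ.m≤m+n (suc kx) _))
      swap-≤ : ∀ q → X + Y + 1ℚ ≤ ι q + (ι (suc kx) - X) + (ι (suc ky) - Y) + (η + η + (η + η)) →
               Y + X + 1ℚ ≤ ι q + (ι (suc ky) - Y) + (ι (suc kx) - X) + (η + η + (η + η))
      swap-≤ q = lin 3 3 (λ q a b X Y η → X ⊕ Y ⊕ ♯ 1 ≤' ↑ q ⊕ (↑ a ⊖ X) ⊕ (↑ b ⊖ Y) ⊕ (η ⊕ η ⊕ (η ⊕ η)) ⇒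
        ⊢ Y ⊕ X ⊕ ♯ 1 ≤' ↑ q ⊕ (↑ b ⊖ Y) ⊕ (↑ a ⊖ X) ⊕ (η ⊕ η ⊕ (η ⊕ η))) q (suc kx) (suc ky) X Y η
      flip₁ : ∀ o → o ℕ.+ kx ℕ.< K' → kx ℕ.< K ∸ o
      flip₁ o h = ℕ.m+n≤o⇒m≤o∸n (suc kx) (subst (ℕ._≤ K) (cong suc (ℕ.+-comm o kx)) (subst (o ℕ.+ kx ℕ.<_) (sym K≡) h))
      flip₂ : ∀ o → ky ℕ.< o → o ℕ.≤ K' → K ∸ o ℕ.+ ky ℕ.< K
      flip₂ o h o≤ = subst (K ∸ o ℕ.+ ky ℕ.<_) (ℕ.m∸n+n≡m (subst (o ℕ.≤_) (sym K≡) o≤)) (ℕ.+-monoʳ-< (K ∸ o) h)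

    module Estimates {ρ η : ℚ} (η>0 : 0ℚ < η) (D : Detour ρ η) where
      open Detour D

      8η : ℚ
      8η = η + η + (η + η) + (η + η + (η + η))

      Bound : ℕ → Set
      Bound m = ρ + ρ + (ρ + ρ) ≤ ι m + 8η

      bound-weaken : ∀ {m m'} → m ℕ.≤ m' → Bound m → Bound m'
      bound-weaken h b = ℚ.≤-trans b (ℚ.+-monoˡ-≤ 8η (ι-mono h))

      along : ∀ {i j} → i ℕ.≤ j → j ℕ.≤ K → Walk G (j ∸ i) (Γ i) (Γ j)
      along = path-walk path

      back-along : ∀ {b} → ky ℕ.< b → b ℕ.≤ K → Walk G (b ∸ suc ky) (Γ (K ∸ b)) (Γ (K ∸ suc ky))
      back-along {b} h b≤ = walk-cong (trans (ℕ.∸-+-assoc K (suc ky) (K ∸ b)) (trans (cong (K ∸_) (ℕ.+-comm (suc ky) (K ∸ b))) (trans (sym (ℕ.∸-+-assoc K (K ∸ b) (suc ky))) (cong (_∸ suc ky) (ℕ.m∸[m∸n]≡n b≤))))) refl refl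
        (along (ℕ.∸-monoʳ-≤ K h) (ℕ.m∸n≤m K (suc ky)))

      back-to-end : ∀ {b} → b ℕ.≤ K → Walk G b (Γ K) (Γ (K ∸ b))
      back-to-end {b} b≤ = reverseʷ (walk-cong (ℕ.m∸[m∸n]≡n b≤) refl refl (along (ℕ.m∸n≤m K b) ℕ.≤-refl))

      -- The segment between x' and y' is a geodesic of length 2ρ, so the rest of the closed path is
      -- at least as long, up to 4η; together they have length `suc K`.
      bound-cycle : Bound (suc K)
      bound-cycle = lin 4 4 (λ kx q ky K ρ η X Y → K ≡' # 1 ⊕ kx ⊕ (# 1 ⊕ q ⊕ ky) ⇒ X ⊕ Y ⊕ ♯ 1 ≡' ρ ⊕ ρ ⇒ ♯ 0 <' η ⇒
          X ⊕ Y ⊕ ♯ 1 ≤' ↑ q ⊕ (↑ (# 1 ⊕ kx) ⊖ X) ⊕ (↑ (# 1 ⊕ ky) ⊖ Y) ⊕ (η ⊕ η ⊕ (η ⊕ η)) ⇒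
          ⊢ ρ ⊕ ρ ⊕ (ρ ⊕ ρ) ≤' ↑ (# 1 ⊕ K) ⊕ (η ⊕ η ⊕ (η ⊕ η) ⊕ (η ⊕ η ⊕ (η ⊕ η)))) kx q₀ ky K ρ η X Y refl X+Y η>0
        (outer-outer q₀ (walk-cong length refl refl (along first≤last (ℕ.m∸n≤m K (suc ky)))))
        where
        last≡ : K ∸ suc ky ≡ suc kx ℕ.+ q₀
        last≡ = trans (cong (_∸ suc ky) (lin 3 0 (λ kx q ky → ⊢ # 1 ⊕ kx ⊕ (# 1 ⊕ q ⊕ ky) ≡' # 1 ⊕ kx ⊕ q ⊕ (# 1 ⊕ ky)) kx q₀ ky)) (ℕ.m+n∸n≡m (suc kx ℕ.+ q₀) (suc ky))
        first≤last : suc kx ℕ.≤ K ∸ suc ky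
        first≤last = subst (suc kx ℕ.≤_) (sym last≡) (ℕ.m≤m+n (suc kx) q₀)
        length : K ∸ suc ky ∸ suc kx ≡ q₀
        length = trans (cong (_∸ suc kx) last≡) (ℕ.m+n∸m≡n (suc kx) q₀)

      Outer : ℕ → Set
      Outer i = kx ℕ.< i × i ℕ.+ ky ℕ.< K

      where-is : ∀ i → i ℕ.≤ kx ⊎ Outer i ⊎ K ℕ.≤ i ℕ.+ ky
      where-is i = [ inj₁ , (λ h → inj₂ ([ (λ h' → inj₁ (h , h')) , inj₂ ]′ (ℕ.<-≤-connex (i ℕ.+ ky) K))) ]′ (ℕ.≤-<-connex i kx)

      outer-to : ∀ {a} → Outer a → Walk G (a ∸ suc kx) (Γ (suc kx)) (Γ a)
      outer-to {a} (h , h') = along h (ℕ.≤-trans (ℕ.m≤m+n a ky) (ℕ.<⇒≤ h'))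

      -- The chord cuts off a closed path through p of length ℓ = a + b + 2. From x' to `Γ (K ∸ b)`
      -- the way over the chord is no shorter than the geodesic, hence X + 1 + b ≤ ℓ/2. As Γ a is
      -- outside the ball, y' is at most one edge beyond `Γ (K ∸ b)`. Up to η this gives 2ρ ≤ ℓ/2 +
      -- 1.
      one-chord : ∀ {a b} → Outer a → b ℕ.≤ ky → adj (Γ a) (Γ (K ∸ b)) ≡ true → Bound (a ℕ.+ b ℕ.+ 4)
      one-chord {a} {b} o@(kx<a , a<) b≤ e = lin 4 4 (λ a b kx d ρ η X Y → X ⊕ Y ⊕ ♯ 1 ≡' ρ ⊕ ρ ⇒ # 1 ⊕ kx ⊕ d ≡' a ⇒ ♯ 0 <' η ⇒
          X ⊕ ↑ b ⊕ ♯ 1 ≤' ↑ (d ⊕ # 1) ⊕ (↑ (# 1 ⊕ kx) ⊖ X) ⊕ (η ⊕ η) ⇒ Y ≤' ♯ 1 ⊕ ↑ b ⊕ η ⇒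
          ⊢ ρ ⊕ ρ ⊕ (ρ ⊕ ρ) ≤' ↑ (a ⊕ b ⊕ # 4) ⊕ (η ⊕ η ⊕ (η ⊕ η) ⊕ (η ⊕ η ⊕ (η ⊕ η)))) a b kx (a ∸ suc kx) ρ η X Y X+Y (ℕ.m+[n∸m]≡n kx<a) η>0
        (outer-inner b (a ∸ suc kx ℕ.+ 1) b≤ (outer-to o ++ʷ edgeʷ e))
        (back-far b a 1 b≤ kx<a a< (edgeʷ (adj-sym e)))

      module Hub {a b h : ℕ} (a<h : a ℕ.< h) (h+b<K : h ℕ.+ b ℕ.< K) (e : adj (Γ a) (Γ h) ≡ true) (e' : adj (Γ h) (Γ (K ∸ b)) ≡ true) where
        b≤K : b ℕ.≤ K
        b≤K = ℕ.≤-trans (ℕ.m≤n+m b h) (ℕ.<⇒≤ h+b<K)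

        across-hub : Walk G 2 (Γ a) (Γ (K ∸ b))
        across-hub = e ∷ (e' ∷ [])

        -- Here Γ a lies on the shortest path from p to y'. The walk from Γ 0 over Γ K and the hub
        -- to Γ a cannot be a shortcut, so K - a ≤ b + 2, and the whole detour is no longer than the
        -- cell.
        single-cell : K ℕ.≤ a ℕ.+ ky → Bound (a ℕ.+ b ℕ.+ 3)
        single-cell K≤ = bound-weaken (lin 4 0 (λ a b K j → a ⊕ j ≡' K ⇒ # 1 ⊕ (# 0 ⊕ j) ≤' # 1 ⊕ (b ⊕ # 2) ⇒ ⊢ # 1 ⊕ K ≤' a ⊕ b ⊕ # 3) a b K (K ∸ a) a+j
            (inner-inner 0 (K ∸ a) (suc (b ℕ.+ 2)) z≤n (ℕ.m≤n+o⇒m∸n≤o K a K≤)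
              (walk-cong refl refl (cong Γ (sym (ℕ.m∸[m∸n]≡n a≤K))) (adj-sym close ∷ (back-to-end b≤K ++ʷ reverseʷ across-hub))))) bound-cycle
          where
          a≤K : a ℕ.≤ K
          a≤K = ℕ.≤-trans (ℕ.<⇒≤ a<h) (ℕ.≤-trans (ℕ.m≤m+n h b) (ℕ.<⇒≤ h+b<K))
          a+j : a ℕ.+ (K ∸ a) ≡ K
          a+j = ℕ.m+[n∸m]≡n a≤K

        -- The two edges at the hub bypass part of the detour between the outer ends of the rays.
        -- The argument of `bound-cycle` then applies to the cell alone, of length a + b + 3.
        outer-outer-hub : Outer a → ky ℕ.< b → Bound (a ℕ.+ b ℕ.+ 3)
        outer-outer-hub o@(kx<a , _) ky<b = lin 6 4 (λ a b kx ky d d' ρ η X Y → X ⊕ Y ⊕ ♯ 1 ≡' ρ ⊕ ρ ⇒ # 1 ⊕ kx ⊕ d ≡' a ⇒ # 1 ⊕ ky ⊕ d' ≡' b ⇒ ♯ 0 <' η ⇒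
            X ⊕ Y ⊕ ♯ 1 ≤' ↑ (d ⊕ (# 2 ⊕ d')) ⊕ (↑ (# 1 ⊕ kx) ⊖ X) ⊕ (↑ (# 1 ⊕ ky) ⊖ Y) ⊕ (η ⊕ η ⊕ (η ⊕ η)) ⇒
            ⊢ ρ ⊕ ρ ⊕ (ρ ⊕ ρ) ≤' ↑ (a ⊕ b ⊕ # 3) ⊕ (η ⊕ η ⊕ (η ⊕ η) ⊕ (η ⊕ η ⊕ (η ⊕ η)))) a b kx ky (a ∸ suc kx) (b ∸ suc ky) ρ η X Y X+Y
              (ℕ.m+[n∸m]≡n kx<a) (ℕ.m+[n∸m]≡n ky<b) η>0
          (outer-outer (a ∸ suc kx ℕ.+ (2 ℕ.+ (b ∸ suc ky))) (outer-to o ++ʷ (across-hub ++ʷ back-along ky<b b≤K)))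

        -- With the hub outside the ball, the reasoning of `one-chord` applies to a chord of two
        -- edges. With the hub on the shortest path from p to y', its distance along the detour from
        -- Γ K is at most b + 1, and the edge from Γ a to the hub is itself a chord for `one-chord`.
        outer-inner-hub : Outer a → b ℕ.≤ ky → Bound (a ℕ.+ b ℕ.+ 5)
        outer-inner-hub o@(kx<a , a<) b≤ = [ (λ h≤kx → ⊥-elim (lin 3 0 (λ a h kx → a <' h ⇒ h ≤' kx ⇒ kx <' a ⇒ ⊢ ⊥') a h kx a<h h≤kx kx<a)) , [ hub-outer , hub-inner ]′ ]′ (where-is h)
          where
          hub-outer : Outer h → Bound (a ℕ.+ b ℕ.+ 5)
          hub-outer (kx<h , h<) = lin 4 4 (λ a b kx d ρ η X Y → X ⊕ Y ⊕ ♯ 1 ≡' ρ ⊕ ρ ⇒ # 1 ⊕ kx ⊕ d ≡' a ⇒ ♯ 0 <' η ⇒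
              X ⊕ ↑ b ⊕ ♯ 1 ≤' ↑ (d ⊕ # 2) ⊕ (↑ (# 1 ⊕ kx) ⊖ X) ⊕ (η ⊕ η) ⇒ Y ≤' ♯ 1 ⊕ ↑ b ⊕ η ⇒
              ⊢ ρ ⊕ ρ ⊕ (ρ ⊕ ρ) ≤' ↑ (a ⊕ b ⊕ # 5) ⊕ (η ⊕ η ⊕ (η ⊕ η) ⊕ (η ⊕ η ⊕ (η ⊕ η)))) a b kx (a ∸ suc kx) ρ η X Y X+Y (ℕ.m+[n∸m]≡n kx<a) η>0
            (outer-inner b (a ∸ suc kx ℕ.+ 2) b≤ (outer-to o ++ʷ across-hub))
            (back-far b h 1 b≤ kx<h h< (edgeʷ (adj-sym e')))

          hub-inner : K ℕ.≤ h ℕ.+ ky → Bound (a ℕ.+ b ℕ.+ 5)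
          hub-inner K≤ = bound-weaken (lin 3 0 (λ a b j → # 1 ⊕ (# 0 ⊕ j) ≤' # 1 ⊕ (b ⊕ # 1) ⇒ ⊢ a ⊕ j ⊕ # 4 ≤' a ⊕ b ⊕ # 5) a b (K ∸ h)
              (inner-inner 0 (K ∸ h) (suc (b ℕ.+ 1)) z≤n j≤ky (walk-cong refl refl h≡ (adj-sym close ∷ (back-to-end b≤K ++ʷ edgeʷ (adj-sym e'))))))
            (one-chord o j≤ky (subst (λ v → adj (Γ a) v ≡ true) h≡ e))
            where
            j≤ky : K ∸ h ℕ.≤ ky
            j≤ky = ℕ.m≤n+o⇒m∸n≤o K h K≤
            h≡ : Γ h ≡ Γ (K ∸ (K ∸ h))
            h≡ = cong Γ (sym (ℕ.m∸[m∸n]≡n (ℕ.≤-trans (ℕ.m≤m+n h b) (ℕ.<⇒≤ h+b<K))))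

      -- This serves the case of p on a spoke, with Γ K as the hub: the cell has length a + 2, and
      -- its other spoke is a chord with b = 0.
      spoke-cell : ∀ {a} → 2 ℕ.≤ a → a ℕ.< K → adj (Γ a) (Γ K) ≡ true → Bound (a ℕ.+ 4)
      spoke-cell {a} 2≤a a<K e = [ (λ a≤kx → ⊥-elim (lin 1 0 (λ a → # 2 ≤' a ⇒ # 1 ⊕ (a ⊕ # 0) ≤' # 1 ⇒ ⊢ ⊥') a 2≤a (inner-inner a 0 1 a≤kx z≤n (edgeʷ e))))
        , [ (λ o → bound-weaken (ℕ.≤-reflexive (cong (ℕ._+ 4) (ℕ.+-identityʳ a))) (one-chord o z≤n e)) , last ]′ ]′ (where-is a)
        where
        last : K ℕ.≤ a ℕ.+ ky → Bound (a ℕ.+ 4)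
        last K≤ = bound-weaken (lin 3 0 (λ a K j → a ⊕ j ≡' K ⇒ # 1 ⊕ (# 0 ⊕ j) ≤' # 2 ⇒ ⊢ # 1 ⊕ K ≤' a ⊕ # 4) a K (K ∸ a) (ℕ.m+[n∸m]≡n (ℕ.<⇒≤ a<K))
          (inner-inner 0 (K ∸ a) 2 z≤n (ℕ.m≤n+o⇒m∸n≤o K a K≤)
            (walk-cong refl refl (cong Γ (sym (ℕ.m∸[m∸n]≡n (ℕ.<⇒≤ a<K)))) (adj-sym close ∷ (adj-sym e ∷ []))))) bound-cycle

    -- The cell bounded by Γ a, …, Γ 0, Γ K, …, Γ (K ∸ b) and two edges at the hub Γ h has length a + b + 3.
    cell : ∀ {ρ η} (η>0 : 0ℚ < η) (D : Detour ρ η) → let open Detour D in ∀ {a b h} → a ℕ.< h → h ℕ.+ b ℕ.< K →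
           adj (Γ a) (Γ h) ≡ true → adj (Γ h) (Γ (K ∸ b)) ≡ true → 3 ℕ.≤ suc (a ℕ.+ b) → Estimates.Bound η>0 D (a ℕ.+ b ℕ.+ 5)
    cell {ρ} {η} η>0 D {a} {b} {h} a<h h+b<K e e' 3≤ = [ a-inner , [ a-outer , (λ K≤ → bound-weaken 3≤5 (single-cell K≤)) ]′ ]′ (where-is a)
      where
      open Detour D
      open Estimates η>0 D
      open Hub a<h h+b<K e e'

      3≤5 : a ℕ.+ b ℕ.+ 3 ℕ.≤ a ℕ.+ b ℕ.+ 5
      3≤5 = ℕ.+-monoʳ-≤ (a ℕ.+ b) (s≤s (s≤s (s≤s z≤n)))

      h≤K : h ℕ.≤ K
      h≤K = ℕ.≤-trans (ℕ.m≤m+n h b) (ℕ.<⇒≤ h+b<K)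

      D' : Detour ρ η
      D' = reverse-detour D
      module D' = Detour D'
      module E' = Estimates η>0 D'

      K≡ : K ≡ D'.K
      K≡ = lin 3 0 (λ kx q ky → ⊢ # 1 ⊕ kx ⊕ (# 1 ⊕ q ⊕ ky) ≡' # 1 ⊕ ky ⊕ (# 1 ⊕ q ⊕ kx)) kx q₀ ky

      -- Reversal sends index i to K - i, and the ends a and b of the cell change places.
      module H' = E'.Hub {b} {a} {K ∸ h} (ℕ.m+n≤o⇒m≤o∸n (suc b) (subst (ℕ._≤ K) (cong suc (ℕ.+-comm h b)) h+b<K))
        (subst (K ∸ h ℕ.+ a ℕ.<_) (trans (ℕ.m∸n+n≡m h≤K) K≡) (ℕ.+-monoʳ-< (K ∸ h) a<h))
        (subst (λ v → adj (Γ (K ∸ b)) v ≡ true) (cong Γ (sym (ℕ.m∸[m∸n]≡n h≤K))) (adj-sym e'))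
        (subst₂ (λ v w → adj v w ≡ true) (cong Γ (sym (ℕ.m∸[m∸n]≡n h≤K)))
          (cong Γ (sym (trans (cong (λ k → K ∸ (k ∸ a)) (sym K≡)) (ℕ.m∸[m∸n]≡n (ℕ.≤-trans (ℕ.<⇒≤ a<h) h≤K))))) (adj-sym e))

      mirror : ∀ c → E'.Bound (b ℕ.+ a ℕ.+ c) → Bound (a ℕ.+ b ℕ.+ c)
      mirror c = subst (λ m → Bound (m ℕ.+ c)) (ℕ.+-comm b a)

      a-inner : a ℕ.≤ kx → Bound (a ℕ.+ b ℕ.+ 5)
      -- With both ends of the cell on the shortest paths from p, two edges at the hub would shorten
      -- a stretch of a + b + 1 ≥ 3 edges of the geodesic.
      a-inner a≤kx = [ (λ b≤ky → ⊥-elim (ℕ.<⇒≱ 3≤ (inner-inner a b 2 a≤kx b≤ky across-hub)))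
        , [ (λ o → mirror 5 (H'.outer-inner-hub o a≤kx)) , (λ K≤ → bound-weaken 3≤5 (mirror 3 (H'.single-cell K≤))) ]′ ]′ (E'.where-is b)

      a-outer : Outer a → Bound (a ℕ.+ b ℕ.+ 5)
      a-outer o = [ outer-inner-hub o , (λ ky<b → bound-weaken 3≤5 (outer-outer-hub o ky<b)) ]′ (ℕ.≤-<-connex b ky)

open DetourChords

-- Fans: marks, girth, circumference and the bound for detours.

module Fans where
  open import Data.Nat using (_+_; _∸_; _≤_; _<_; _≡ᵇ_; _≤ᵇ_; _<ᵇ_)

  T⇒≡ : ∀ {b} → T b → b ≡ true
  T⇒≡ {true} _ = refl

  ≡⇒T : ∀ {b} → b ≡ true → T b
  ≡⇒T refl = tt

  -- The marks are the partial sums of the gap list, 0 included; the recursion consumes the gaps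
  -- from the left.
  mark : List ℕ → ℕ → Bool
  mark [] q = q ≡ᵇ 0
  mark (m ∷ ms) zero = true
  mark (m ∷ ms) (suc q) = (m ≤ᵇ suc q) ∧ mark ms (suc q ∸ m)

  mark-0 : ∀ ms → mark ms 0 ≡ true
  mark-0 [] = refl
  mark-0 (m ∷ ms) = refl

  mark-+ : ∀ m ms q → mark ms q ≡ true → mark (m ∷ ms) (m + q) ≡ true
  mark-+ zero ms zero _ = refl
  mark-+ zero ms (suc q) h = h
  mark-+ (suc m) ms q h = cong₂ _∧_ (T⇒≡ (ℕ.≤⇒≤ᵇ {suc m} (ℕ.m≤m+n (suc m) q))) (trans (cong (mark ms) (ℕ.m+n∸m≡n m q)) h)

  mark-view : ∀ m ms q → mark (m ∷ ms) q ≡ true → q ≡ 0 ⊎ ∃ λ q' → q ≡ m + q' × mark ms q' ≡ true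
  mark-view m ms zero _ = inj₁ refl
  mark-view m ms (suc q) h with T-∧ {m ≤ᵇ suc q} (≡⇒T h)
  ... | m≤ , h' = inj₂ (suc q ∸ m , sym (ℕ.m+[n∸m]≡n (ℕ.≤ᵇ⇒≤ m (suc q) m≤)) , T⇒≡ h')

  mark-sum : ∀ ms → mark ms (sum ms) ≡ true
  mark-sum [] = refl
  mark-sum (m ∷ ms) = mark-+ m ms (sum ms) (mark-sum ms)

  mark-first : ∀ m ms → mark (m ∷ ms) m ≡ true
  mark-first m ms = subst (λ q → mark (m ∷ ms) q ≡ true) (ℕ.+-identityʳ m) (mark-+ m ms 0 (mark-0 ms))

  Between : ℕ → ℕ → ℕ → Set
  Between s M m = s ≤ m × m ≤ M

  -- The two spokes bounding the cell that contains the rim edge between the positions j and j + 1.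
  record Consecutive (s M : ℕ) (ms : List ℕ) (j : ℕ) : Set where
    constructor consecutive
    field
      u u' : ℕ
      mark-u : mark ms u ≡ true
      mark-u' : mark ms u' ≡ true
      u≤j : u ≤ j
      j<u' : j < u'
      apart : u + s ≤ u'
      near : u' ≤ u + M
      none-between : ∀ q → mark ms q ≡ true → q ≤ u ⊎ u' ≤ q

  marks-around : ∀ {s M ms} → All (Between s M) ms → ∀ {j} → j < sum ms → Consecutive s M ms j
  marks-around [] ()
  marks-around {s} {M} {m ∷ ms} ((s≤m , m≤M) ∷ bs) {j} j<sum with j ℕ.<? m
  ... | yes j<m = consecutive 0 m refl (mark-first m ms) z≤n j<m s≤m m≤M
    λ q h → [ (λ { refl → inj₁ z≤n }) , (λ { (q' , refl , _) → inj₂ (ℕ.m≤m+n m q') }) ]′ (mark-view m ms q h)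
  ... | no j≮m with marks-around bs {j ∸ m} (ℕ.+-cancelˡ-< m _ _ (subst (_< m + sum ms) (sym (ℕ.m+[n∸m]≡n (ℕ.≮⇒≥ j≮m))) j<sum))
  ... | consecutive u u' h h' u≤ <u' apart near none = consecutive (m + u) (m + u') (mark-+ m ms u h) (mark-+ m ms u' h')
    (lin 4 0 (λ m u j d → m ⊕ d ≡' j ⇒ u ≤' d ⇒ ⊢ m ⊕ u ≤' j) m u j (j ∸ m) d≡ u≤)
    (lin 4 0 (λ m u j d → m ⊕ d ≡' j ⇒ d <' u ⇒ ⊢ j <' m ⊕ u) m u' j (j ∸ m) d≡ <u')
    (lin 4 0 (λ m u u' s → u ⊕ s ≤' u' ⇒ ⊢ m ⊕ u ⊕ s ≤' m ⊕ u') m u u' s apart)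
    (lin 4 0 (λ m u u' M → u' ≤' u ⊕ M ⇒ ⊢ m ⊕ u' ≤' m ⊕ u ⊕ M) m u u' M near)
    λ q h → [ (λ { refl → inj₁ z≤n }) , (λ { (q' , refl , k) → [ (λ x → inj₁ (ℕ.+-monoʳ-≤ m x)) , (λ x → inj₂ (ℕ.+-monoʳ-≤ m x)) ]′ (none q' k) }) ]′ (mark-view m ms q h)
    where
    d≡ : m + (j ∸ m) ≡ j
    d≡ = ℕ.m+[n∸m]≡n (ℕ.≮⇒≥ j≮m)

  marks-apart : ∀ {s M ms} → All (Between s M) ms → ∀ {q q'} → mark ms q ≡ true → mark ms q' ≡ true → q < q' → q + s ≤ q'
  marks-apart [] {q} {suc q'} h () _
  marks-apart {s} {M} {m ∷ ms} ((s≤m , _) ∷ bs) {q} {q'} h h' q<q' = cases (mark-view m ms q h) (mark-view m ms q' h')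
    where
    cases : q ≡ 0 ⊎ (∃ λ r → q ≡ m + r × mark ms r ≡ true) → q' ≡ 0 ⊎ (∃ λ r → q' ≡ m + r × mark ms r ≡ true) → q + s ≤ q'
    cases _ (inj₁ refl) = ⊥-elim (ℕ.n≮0 q<q')
    cases (inj₁ refl) (inj₂ (r , refl , _)) = ℕ.≤-trans s≤m (ℕ.m≤m+n m r)
    cases (inj₂ (r , refl , k)) (inj₂ (r' , refl , k')) = subst (_≤ m + r') (sym (ℕ.+-assoc m r s))
      (ℕ.+-monoʳ-≤ m (marks-apart bs k k' (ℕ.+-cancelˡ-< m _ _ q<q')))

  -- The fan with rim 1, …, suc N and hub 0, which is joined to the rim vertices suc q with q marked
  -- and to the leaves suc q with N < q.
  module Labels (ms : List ℕ) where
    N : ℕ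
    N = sum ms

    spoke : ℕ → Bool
    spoke q = mark ms q ∨ (N <ᵇ q)

    rim : ℕ → ℕ → Bool
    rim q r = (r ≡ᵇ suc q) ∧ (r ≤ᵇ N)

    adjacent : ℕ → ℕ → Bool
    adjacent zero zero = false
    adjacent zero (suc q) = spoke q
    adjacent (suc q) zero = spoke q
    adjacent (suc q) (suc r) = rim q r ∨ rim r q

    adjacent-sym : ∀ l k → adjacent l k ≡ adjacent k l
    adjacent-sym zero zero = refl
    adjacent-sym zero (suc _) = refl
    adjacent-sym (suc _) zero = refl
    adjacent-sym (suc q) (suc r) = Bool.∨-comm (rim q r) (rim r q)

    adjacent-irrefl : ∀ l → adjacent l l ≡ false
    adjacent-irrefl zero = refl
    adjacent-irrefl (suc q) = cong (λ b → (b ∧ (q ≤ᵇ N)) ∨ (b ∧ (q ≤ᵇ N))) (≢ᵇsuc q)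
      where
      ≢ᵇsuc : ∀ q → (q ≡ᵇ suc q) ≡ false
      ≢ᵇsuc zero = refl
      ≢ᵇsuc (suc q) = ≢ᵇsuc q

    mark-spoke : ∀ {q} → mark ms q ≡ true → spoke q ≡ true
    mark-spoke h rewrite h = refl

    spoke-mark : ∀ {q} → q ≤ N → spoke q ≡ true → mark ms q ≡ true
    spoke-mark {q} q≤N h with mark ms q
    ... | true = refl
    ... | false = ⊥-elim (ℕ.<⇒≱ (ℕ.<ᵇ⇒< N q (≡⇒T h)) q≤N)

    rim-view : ∀ {q r} → rim q r ≡ true → r ≡ suc q × r ≤ N
    rim-view {q} {r} h with T-∧ {r ≡ᵇ suc q} (≡⇒T h)
    ... | x , y = ℕ.≡ᵇ⇒≡ r (suc q) x , ℕ.≤ᵇ⇒≤ r N y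

    adjacent-view : ∀ {q r} → adjacent (suc q) (suc r) ≡ true → (r ≡ suc q ⊎ q ≡ suc r) × q ≤ N × r ≤ N
    adjacent-view {q} {r} h with rim q r in eq
    ... | true = let (e , r≤N) = rim-view {q} {r} eq in inj₁ e , ℕ.≤-trans (ℕ.n≤1+n q) (subst (_≤ N) e r≤N) , r≤N
    ... | false = let (e , q≤N) = rim-view {r} {q} h in inj₂ e , q≤N , ℕ.≤-trans (ℕ.n≤1+n r) (subst (_≤ N) e q≤N)

    adjacent-rim : ∀ {q} → suc q ≤ N → adjacent (suc q) (suc (suc q)) ≡ true
    adjacent-rim {q} h rewrite T⇒≡ (ℕ.≡⇒≡ᵇ q q refl) | T⇒≡ (ℕ.≤⇒≤ᵇ h) = refl

    leaf-neighbour : ∀ {q l} → N < q → adjacent (suc q) l ≡ true → l ≡ 0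
    leaf-neighbour {l = zero} _ _ = refl
    leaf-neighbour {q} {suc r} N<q h = ⊥-elim (ℕ.<⇒≱ N<q (proj₁ (proj₂ (adjacent-view {q} {r} h))))

    Ascending Descending : (ℕ → ℕ) → ℕ → Set
    Ascending σ k = ∀ i → i ≤ k → σ i ≡ σ 0 + i
    Descending σ k = ∀ i → i ≤ k → σ i + i ≡ σ 0

    step-view : ∀ {l l'} → l ≢ 0 → l' ≢ 0 → adjacent l l' ≡ true → l' ≡ suc l ⊎ l ≡ suc l'
    step-view {zero} h _ _ = ⊥-elim (h refl)
    step-view {suc q} {zero} _ h _ = ⊥-elim (h refl)
    step-view {suc q} {suc r} _ _ h = [ (λ e → inj₁ (cong suc e)) , (λ e → inj₂ (cong suc e)) ]′ (proj₁ (adjacent-view {q} {r} h))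

    -- Away from the hub each step changes the label by one, and a simple path cannot turn back, so
    -- the first step fixes the direction.
    module Straight {σ : ℕ → ℕ} {k : ℕ} (nonzero : ∀ i → i ≤ k → σ i ≢ 0) (path : ∀ i → i < k → adjacent (σ i) (σ (suc i)) ≡ true)
                    (inj : ∀ i j → i < j → j ≤ k → σ i ≢ σ j) where
      view : ∀ i → i < k → σ (suc i) ≡ suc (σ i) ⊎ σ i ≡ suc (σ (suc i))
      view i i<k = step-view (nonzero i (ℕ.<⇒≤ i<k)) (nonzero (suc i) i<k) (path i i<k)

      up : σ 1 ≡ suc (σ 0) → ∀ i → i < k → σ (suc i) ≡ suc (σ i)
      up h zero _ = h
      up h (suc i) i<k = [ (λ e → e) , (λ e → ⊥-elim (inj i (suc (suc i)) (ℕ.n≤1+n (suc i)) i<k (ℕ.suc-injective (trans (sym (up h i (ℕ.<⇒≤ i<k))) e)))) ]′ (view (suc i) i<k)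

      down : σ 0 ≡ suc (σ 1) → ∀ i → i < k → σ i ≡ suc (σ (suc i))
      down h zero _ = h
      down h (suc i) i<k = [ (λ e → ⊥-elim (inj i (suc (suc i)) (ℕ.n≤1+n (suc i)) i<k (trans (down h i (ℕ.<⇒≤ i<k)) (sym e)))) , (λ e → e) ]′ (view (suc i) i<k)

      ascending : σ 1 ≡ suc (σ 0) → Ascending σ k
      ascending h zero _ = sym (ℕ.+-identityʳ (σ 0))
      ascending h (suc i) i<k = trans (up h i i<k) (trans (cong suc (ascending h i (ℕ.<⇒≤ i<k))) (sym (ℕ.+-suc (σ 0) i)))

      descending : σ 0 ≡ suc (σ 1) → Descending σ k
      descending h zero _ = ℕ.+-identityʳ (σ 0)
      descending h (suc i) i<k = trans (ℕ.+-suc (σ (suc i)) i) (trans (cong (_+ i) (sym (down h i i<k))) (descending h i (ℕ.<⇒≤ i<k)))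

      straight : 1 ≤ k → Ascending σ k ⊎ Descending σ k
      straight 1≤k = [ (λ e → inj₁ (ascending e)) , (λ e → inj₂ (descending e)) ]′ (view 0 1≤k)

  module Fan (n : ℕ) (ms : List ℕ) where
    open Labels ms

    fan : Graph n
    fan = record
      { adj = λ u v → adjacent (toℕ u) (toℕ v)
      ; symm = λ u v → adjacent-sym (toℕ u) (toℕ v)
      ; loopless = λ v → adjacent-irrefl (toℕ v) }

    open Graph fan
    open Metric fan
    open Sequences fan

    module Spanning {s M : ℕ} (2+N≤n : 2 + N ≤ n) (1≤N : 1 ≤ N) (gaps : All (Between s M) ms) where
      vertex : ∀ l → l < n → V
      vertex l h = fromℕ< h

      hub : V
      hub = vertex 0 (ℕ.≤-trans (s≤s z≤n) 2+N≤n)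

      toℕ-hub : toℕ hub ≡ 0
      toℕ-hub = Fin.toℕ-fromℕ< (ℕ.≤-trans (s≤s z≤n) 2+N≤n)

      adj-of : ∀ {u v l k} → toℕ u ≡ l → toℕ v ≡ k → adjacent l k ≡ true → adj u v ≡ true
      adj-of refl refl h = h

      to-hub : ∀ q v → toℕ v ≡ suc q → ∃ λ k → Walk fan k v hub
      to-hub q v e with q ℕ.≤? N
      ... | no q≰N = 1 , edgeʷ (adj-of e toℕ-hub (trans (cong (mark ms q ∨_) (T⇒≡ (ℕ.<⇒<ᵇ (ℕ.≰⇒> q≰N)))) (Bool.∨-zeroʳ (mark ms q))))
      to-hub zero v e | yes _ = 1 , edgeʷ (adj-of e toℕ-hub (mark-spoke {0} (mark-0 ms)))
      to-hub (suc q) v e | yes q<N = let (k , x) = to-hub q w (Fin.toℕ-fromℕ< l<n) in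
        suc k , adj-of e (Fin.toℕ-fromℕ< l<n) (trans (adjacent-sym (suc (suc q)) (suc q)) (adjacent-rim q<N)) ∷ x
        where
        l<n : suc q < n
        l<n = ℕ.≤-trans (s≤s (ℕ.≤-trans q<N (ℕ.n≤1+n N))) 2+N≤n
        w : V
        w = vertex (suc q) l<n

      walk-hub : ∀ v → ∃ λ k → Walk fan k v hub
      walk-hub v = go (toℕ v) refl
        where
        go : ∀ l → toℕ v ≡ l → ∃ λ k → Walk fan k v hub
        go zero e = 0 , subst (λ w → Walk fan 0 v w) (Fin.toℕ-injective (trans e (sym toℕ-hub))) []
        go (suc q) e = to-hub q v e

      connected : Connected fan
      connected u v = let (k , x) = walk-hub u ; (k' , y) = walk-hub v in k + k' , x ++ʷ reverseʷ y

      -- The cycle runs through the hub and the rim up to a spoke. The first mark after 0 yields the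
      -- girth, the last one the circumference.
      arc-cycle : ∀ q → 1 ≤ q → q ≤ N → mark ms q ≡ true → HasCycleOfLength fan (2 + q)
      arc-cycle q 1≤q q≤N m = suc q , refl , toCycle {s = s'} (s≤s 1≤q) path inj (adj-of (label (suc q) ℕ.≤-refl) (label 0 z≤n) (mark-spoke {q} m))
        where
        bounded : ∀ l → l ≤ suc q → l < n
        bounded l h = ℕ.≤-trans (s≤s (ℕ.≤-trans h (s≤s q≤N))) 2+N≤n
        s' : ℕ → V
        s' l with l ℕ.≤? suc q
        ... | yes h = vertex l (bounded l h)
        -- A default value beyond the end of the cycle.
        ... | no _ = hub
        label : ∀ l → l ≤ suc q → toℕ (s' l) ≡ l
        label l h with l ℕ.≤? suc q
        ... | yes h' = Fin.toℕ-fromℕ< (bounded l h')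
        ... | no ¬h = ⊥-elim (¬h h)
        path : Path s' (suc q)
        path zero h = adj-of (label 0 z≤n) (label 1 h) (mark-spoke {0} (mark-0 ms))
        path (suc l) h = adj-of (label (suc l) (ℕ.<⇒≤ h)) (label (suc (suc l)) h) (adjacent-rim (ℕ.≤-trans (ℕ.≤-pred h) q≤N))
        inj : Inj s' (suc q)
        inj i j i<j j≤ e = ℕ.<⇒≢ i<j (trans (sym (label i (ℕ.≤-trans (ℕ.<⇒≤ i<j) j≤))) (trans (cong toℕ e) (label j j≤)))

      module OfLoop {L : ℕ} (C : Loop L) where
        open Loop C

        -- The only neighbour of a leaf is the hub, whereas predecessor and successor on a cycle of
        -- length at least 3 are distinct.
        no-leaf : ∀ i → toℕ (w i) < 2 + N
        no-leaf i = ℕ.≰⇒> λ h → go L refl (toℕ (w i)) refl h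
          where
          go : ∀ L' → L' ≡ L → ∀ l → toℕ (w i) ≡ l → ¬ 2 + N ≤ l
          go zero refl _ _ _ = ℕ.n≮0 L≥3
          go (suc L') refl (suc q) e (s≤s N<q) = inj (suc i) (i + L')
            (lin 2 0 (λ i L → # 3 ≤' # 1 ⊕ L ⇒ ⊢ # 1 ⊕ i <' i ⊕ L) i L' L≥3)
            (lin 2 0 (λ i L → ⊢ i ⊕ L <' # 1 ⊕ i ⊕ (# 1 ⊕ L)) i L')
            (Fin.toℕ-injective (trans (leaf-neighbour N<q (subst (λ l → adjacent l (toℕ (w (suc i))) ≡ true) e (step i)))
              (sym (leaf-neighbour N<q (subst (λ l → adjacent l (toℕ (w (i + L'))) ≡ true) e (adj-sym {w (i + L')} {w i} (subst (λ v → adj (w (i + L')) v ≡ true) (trans (cong w (sym (ℕ.+-suc i L'))) (periodic i)) (step (i + L')))))))))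

        length≤ : L ≤ 2 + N
        length≤ = Fin.injective⇒≤ {f = λ x → fromℕ< (no-leaf (toℕ x))} λ {x} {y} e → index-inj x y
          (trans (sym (Fin.toℕ-fromℕ< (no-leaf (toℕ x)))) (trans (cong toℕ e) (Fin.toℕ-fromℕ< (no-leaf (toℕ y)))))
          where
          index-inj : ∀ (x y : Fin L) → toℕ (w (toℕ x)) ≡ toℕ (w (toℕ y)) → x ≡ y
          index-inj x y e with ℕ.<-cmp (toℕ x) (toℕ y)
          ... | tri< h _ _ = ⊥-elim (inj (toℕ x) (toℕ y) h (ℕ.≤-trans (Fin.toℕ<n y) (ℕ.m≤n+m L (toℕ x))) (Fin.toℕ-injective e))
          ... | tri≈ _ h _ = Fin.toℕ-injective h
          ... | tri> _ _ h = ⊥-elim (inj (toℕ y) (toℕ x) h (ℕ.≤-trans (Fin.toℕ<n x) (ℕ.m≤n+m L (toℕ y))) (Fin.toℕ-injective (sym e)))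

        private
          K : ℕ
          K = ℕ.pred L
          K≡ : suc K ≡ L
          K≡ = ℕ.suc-pred L {{ℕ.>-nonZero (ℕ.≤-trans (s≤s z≤n) L≥3)}}

        -- Without the hub the labels would run monotonically through K + 1 ≥ 3 vertices, and the
        -- closing edge could not change the label by just one.
        through-hub : ∃ λ i → toℕ (w i) ≡ 0
        through-hub with search≤ (λ i → toℕ (w i) ℕ.≟ 0) K
        ... | yes (i , _ , e) = i , e
        ... | no none = ⊥-elim (clash (straight 1≤K))
          where
          nonzero : ∀ i → i ≤ K → toℕ (w i) ≢ 0
          nonzero i h e = none (i , h , e)
          1≤K : 1 ≤ K
          1≤K = ℕ.≤-trans (s≤s z≤n) (ℕ.≤-pred (subst (3 ≤_) (sym K≡) L≥3))
          open Straight {λ i → toℕ (w i)} {K} nonzero (λ i _ → step i)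
            (λ i j i<j j≤K e → inj i j i<j (subst (j <_) (cong (i +_) K≡) (ℕ.≤-trans (s≤s j≤K) (ℕ.m≤n+m (suc K) i))) (Fin.toℕ-injective e))
          closing : toℕ (w 0) ≡ suc (toℕ (w K)) ⊎ toℕ (w K) ≡ suc (toℕ (w 0))
          closing = step-view (nonzero K ℕ.≤-refl) (nonzero 0 z≤n) (subst (λ v → adj (w K) v ≡ true) (trans (cong w K≡) (periodic 0)) (step K))
          2≤K : 2 ≤ K
          2≤K = ℕ.≤-pred (subst (3 ≤_) (sym K≡) L≥3)
          clash : Ascending (λ i → toℕ (w i)) K ⊎ Descending (λ i → toℕ (w i)) K → ⊥
          clash (inj₁ h) = [ (λ e → lin 3 0 (λ x y K → # 2 ≤' K ⇒ y ≡' x ⊕ K ⇒ x ≡' # 1 ⊕ y ⇒ ⊢ ⊥') (toℕ (w 0)) (toℕ (w K)) K 2≤K (h K ℕ.≤-refl) e)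
                           , (λ e → lin 3 0 (λ x y K → # 2 ≤' K ⇒ y ≡' x ⊕ K ⇒ y ≡' # 1 ⊕ x ⇒ ⊢ ⊥') (toℕ (w 0)) (toℕ (w K)) K 2≤K (h K ℕ.≤-refl) e) ]′ closing
          clash (inj₂ h) = [ (λ e → lin 3 0 (λ x y K → # 2 ≤' K ⇒ y ⊕ K ≡' x ⇒ x ≡' # 1 ⊕ y ⇒ ⊢ ⊥') (toℕ (w 0)) (toℕ (w K)) K 2≤K (h K ℕ.≤-refl) e)
                           , (λ e → lin 3 0 (λ x y K → # 2 ≤' K ⇒ y ⊕ K ≡' x ⇒ y ≡' # 1 ⊕ x ⇒ ⊢ ⊥') (toℕ (w 0)) (toℕ (w K)) K 2≤K (h K ℕ.≤-refl) e) ]′ closing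

        module AtHub (i : ℕ) (at-hub : toℕ (w i) ≡ 0) (k : ℕ) (L≡ : 3 + k ≡ L) where
          σ : ℕ → ℕ
          σ x = toℕ (w (suc i + x))
          nonzero : ∀ x → x ≤ suc k → σ x ≢ 0
          nonzero x h e = inj i (suc i + x) (ℕ.m≤m+n (suc i) x)
            (lin 4 0 (λ i x k L → # 3 ⊕ k ≡' L ⇒ x ≤' # 1 ⊕ k ⇒ ⊢ # 1 ⊕ i ⊕ x <' i ⊕ L) i x k L L≡ h) (Fin.toℕ-injective (trans at-hub (sym e)))
          path : ∀ x → adjacent (σ x) (σ (suc x)) ≡ true
          path x = subst (λ y → adjacent (σ x) (toℕ (w y)) ≡ true) (sym (ℕ.+-suc (suc i) x)) (step (suc i + x))
          open Straight {σ} {suc k} nonzero (λ x _ → path x)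
            (λ x y x<y y≤ e → inj (suc i + x) (suc i + y) (ℕ.+-monoʳ-< (suc i) x<y)
              (lin 5 0 (λ i x y k L → # 3 ⊕ k ≡' L ⇒ y ≤' # 1 ⊕ k ⇒ ⊢ # 1 ⊕ i ⊕ y <' # 1 ⊕ i ⊕ x ⊕ L) i x y k L L≡ y≤) (Fin.toℕ-injective e))

          first-spoke : adjacent 0 (σ 0) ≡ true
          first-spoke = subst₂ (λ l v → adjacent l (toℕ (w v)) ≡ true) at-hub (sym (ℕ.+-identityʳ (suc i))) (step i)

          last-spoke : adjacent (σ (suc k)) 0 ≡ true
          last-spoke = subst (λ l → adjacent (σ (suc k)) l ≡ true) (trans (cong toℕ (trans (cong w (lin 3 0 (λ i k L → # 3 ⊕ k ≡' L ⇒ ⊢ # 1 ⊕ (# 1 ⊕ i ⊕ (# 1 ⊕ k)) ≡' i ⊕ L) i k L L≡)) (periodic i))) at-hub) (step (suc i + suc k))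

          -- With the hub removed, the loop is a straight stretch of the rim between two distinct
          -- marks, and these are at least s apart.
          length≥ : s + 2 ≤ L
          length≥ = labels (σ 0) (σ (suc k)) refl refl (straight (s≤s z≤n))
            where
            labels : ∀ l l' → σ 0 ≡ l → σ (suc k) ≡ l' → Ascending σ (suc k) ⊎ Descending σ (suc k) → s + 2 ≤ L
            labels zero _ e _ _ = ⊥-elim (nonzero 0 z≤n e)
            labels _ zero _ e' _ = ⊥-elim (nonzero (suc k) ℕ.≤-refl e')
            labels (suc q) (suc q') e e' dir = [ up-case , down-case ]′ dir
              where
              -- The ends of the stretch have a neighbour other than the hub. They are thus no
              -- leaves, and their edges to the hub are marks.
              bound-first : q ≤ N
              bound-first = next (σ 1) refl
                where
                next : ∀ l → σ 1 ≡ l → q ≤ N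
                next zero f = ⊥-elim (nonzero 1 (s≤s z≤n) f)
                next (suc r) f = proj₁ (proj₂ (adjacent-view {q} {r} (subst₂ (λ a b → adjacent a b ≡ true) e f (path 0))))
              bound-last : q' ≤ N
              bound-last = previous (σ k) refl
                where
                previous : ∀ l → σ k ≡ l → q' ≤ N
                previous zero f = ⊥-elim (nonzero k (ℕ.n≤1+n k) f)
                previous (suc r) f = proj₂ (proj₂ (adjacent-view {r} {q'} (subst₂ (λ a b → adjacent a b ≡ true) f e' (path k))))
              mark-first' : mark ms q ≡ true
              mark-first' = spoke-mark bound-first (subst (λ l → adjacent 0 l ≡ true) e first-spoke)
              mark-last : mark ms q' ≡ true
              mark-last = spoke-mark bound-last (subst (λ l → adjacent l 0 ≡ true) e' last-spoke)
              up-case : Ascending σ (suc k) → s + 2 ≤ L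
              up-case h = lin 5 0 (λ s q q' k L → # 3 ⊕ k ≡' L ⇒ # 1 ⊕ q' ≡' # 1 ⊕ q ⊕ (# 1 ⊕ k) ⇒ q ⊕ s ≤' q' ⇒ ⊢ s ⊕ # 2 ≤' L) s q q' k L L≡ q+ (marks-apart gaps mark-first' mark-last
                (lin 3 0 (λ q q' k → # 1 ⊕ q' ≡' # 1 ⊕ q ⊕ (# 1 ⊕ k) ⇒ ⊢ q <' q') q q' k q+))
                where
                q+ : suc q' ≡ suc q + suc k
                q+ = trans (sym e') (trans (h (suc k) ℕ.≤-refl) (cong (_+ suc k) e))
              down-case : Descending σ (suc k) → s + 2 ≤ L
              down-case h = lin 5 0 (λ s q q' k L → # 3 ⊕ k ≡' L ⇒ # 1 ⊕ q' ⊕ (# 1 ⊕ k) ≡' # 1 ⊕ q ⇒ q' ⊕ s ≤' q ⇒ ⊢ s ⊕ # 2 ≤' L) s q q' k L L≡ q+ (marks-apart gaps mark-last mark-first'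
                (lin 3 0 (λ q q' k → # 1 ⊕ q' ⊕ (# 1 ⊕ k) ≡' # 1 ⊕ q ⇒ ⊢ q' <' q) q q' k q+))
                where
                q+ : suc q' + suc k ≡ suc q
                q+ = trans (cong (_+ suc k) (sym e')) (trans (h (suc k) ℕ.≤-refl) e)

        length≥ : s + 2 ≤ L
        length≥ = let (i , e) = through-hub in AtHub.length≥ i e (L ∸ 3) (ℕ.m+[n∸m]≡n L≥3)

      circumference : Circumference fan (2 + N)
      circumference = arc-cycle N 1≤N ℕ.≤-refl (mark-sum ms) , λ { _ (m , refl , C) → OfLoop.length≤ (unroll C) }

      girth≥ : ∀ k → HasCycleOfLength fan k → s + 2 ≤ k
      girth≥ _ (m , refl , C) = OfLoop.length≥ (unroll C)

      module Cells {ρ η : ℚ} (η>0 : 0ℚ ℚ.< η) (3≤s : 3 ≤ s) where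
        open Detours fan
        open Chords fan

        -- The edge of the detour containing p lies on the rim.
        module Rim (D : Detour ρ η) (j : ℕ) (end : toℕ (Detour.Γ D (Detour.K D)) ≡ suc (suc j)) (start : toℕ (Detour.Γ D 0) ≡ suc j) where
          open Detour D
          open Estimates η>0 D

          K≥2 : 2 ≤ K
          K≥2 = s≤s (ℕ.≤-trans (s≤s z≤n) (ℕ.m≤n+m (suc (q₀ + ky)) kx))

          -- Both start with the edge of p, σ going on along the front and τ along the back. The
          -- labels on that edge fix the directions: σ descends and τ ascends until the hub is met.
          σ τ : ℕ → V
          σ zero = Γ K
          σ (suc i) = Γ i
          τ zero = Γ 0
          τ (suc i) = Γ (K ∸ i)

          σ-path : ∀ i → i ≤ K → adj (σ i) (σ (suc i)) ≡ true
          σ-path zero _ = close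
          σ-path (suc i) h = path i h

          σ-inj : ∀ i i' → i < i' → i' ≤ K → toℕ (σ i) ≢ toℕ (σ i')
          σ-inj zero (suc i') _ h e = simple i' K h ℕ.≤-refl (sym (Fin.toℕ-injective e))
          σ-inj (suc i) (suc i') h h' e = simple i i' (ℕ.≤-pred h) (ℕ.<⇒≤ h') (Fin.toℕ-injective e)

          τ-path : ∀ i → i ≤ K → adj (τ i) (τ (suc i)) ≡ true
          τ-path zero _ = adj-sym {Γ K} {Γ 0} close
          τ-path (suc i) h = path-reverse {Γ} path i h

          τ-inj : ∀ i i' → i < i' → i' ≤ K → toℕ (τ i) ≢ toℕ (τ i')
          τ-inj zero (suc i') _ h e = simple 0 (K ∸ i') (ℕ.m<n⇒0<n∸m h) (ℕ.m∸n≤m K i') (Fin.toℕ-injective e)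
          τ-inj (suc i) (suc i') h h' e = simple (K ∸ i') (K ∸ i) (ℕ.∸-monoʳ-< (ℕ.≤-pred h) (ℕ.<⇒≤ h')) (ℕ.m∸n≤m K i) (sym (Fin.toℕ-injective e))

          1+j≤N : suc j ≤ N
          1+j≤N = proj₁ (proj₂ (adjacent-view {suc j} {j} (subst₂ (λ l l' → adjacent l l' ≡ true) end start close)))

          descends : ∀ k → 1 ≤ k → k ≤ K → (∀ i → i ≤ k → toℕ (σ i) ≢ 0) → Descending (λ i → toℕ (σ i)) k
          descends k 1≤k k≤K nonzero = descending (trans end (cong suc (sym start)))
            where open Straight {λ i → toℕ (σ i)} {k} nonzero (λ i h → σ-path i (ℕ.≤-trans (ℕ.<⇒≤ h) k≤K)) (λ i i' h h' → σ-inj i i' h (ℕ.≤-trans h' k≤K))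

          ascends : ∀ k → 1 ≤ k → k ≤ K → (∀ i → i ≤ k → toℕ (τ i) ≢ 0) → Ascending (λ i → toℕ (τ i)) k
          ascends k 1≤k k≤K nonzero = ascending (trans end (cong suc (sym start)))
            where open Straight {λ i → toℕ (τ i)} {k} nonzero (λ i h → τ-path i (ℕ.≤-trans (ℕ.<⇒≤ h) k≤K)) (λ i i' h h' → τ-inj i i' h (ℕ.≤-trans h' k≤K))

          -- Otherwise the labels would descend all the way from Γ K, and the last step, back to Γ
          -- K, could not change the label by just one.
          no-hub : ¬ (∀ i → i ≤ K → toℕ (Γ i) ≢ 0)
          no-hub none = last K refl
            where
            nonzero : ∀ i → i ≤ K → toℕ (σ i) ≢ 0
            nonzero zero _ = none K ℕ.≤-refl
            nonzero (suc i) h = none i (ℕ.<⇒≤ h)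
            last : ∀ K' → K' ≡ K → ⊥
            last zero e = ℕ.n≮0 (subst (2 ≤_) (sym e) K≥2)
            last (suc K₁) e = [ (λ f → lin 3 0 (λ x K j → # 2 ≤' # 1 ⊕ K ⇒ x ⊕ (# 1 ⊕ K) ≡' # 2 ⊕ j ⇒ # 2 ⊕ j ≡' # 1 ⊕ x ⇒ ⊢ ⊥') x K₁ j 2≤ x+ (trans (sym end) f))
                              , (λ f → lin 3 0 (λ x K j → # 2 ≤' # 1 ⊕ K ⇒ x ⊕ (# 1 ⊕ K) ≡' # 2 ⊕ j ⇒ x ≡' # 3 ⊕ j ⇒ ⊢ ⊥') x K₁ j 2≤ x+ (trans f (cong suc end))) ]′
                (step-view (none K₁ K₁≤) (none K ℕ.≤-refl) (subst (λ i → adj (Γ K₁) (Γ i) ≡ true) e (path K₁ (subst (K₁ <_) e ℕ.≤-refl))))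
              where
              x : ℕ
              x = toℕ (Γ K₁)
              K₁≤ : K₁ ≤ K
              K₁≤ = subst (K₁ ≤_) e (ℕ.n≤1+n K₁)
              2≤ : 2 ≤ suc K₁
              2≤ = subst (2 ≤_) (sym e) K≥2
              x+ : x + suc K₁ ≡ 2 + j
              x+ = trans (descends (suc K₁) (s≤s z≤n) (ℕ.≤-reflexive e) (λ i h → nonzero i (ℕ.≤-trans h (ℕ.≤-reflexive e))) (suc K₁) ℕ.≤-refl) end

          module WithHub (h : ℕ) (1+h<K : suc h < K) (at-hub : toℕ (Γ (suc h)) ≡ 0) where
            e : ℕ
            e = K ∸ suc (suc h)
            h+e : suc (suc h) + e ≡ K
            h+e = ℕ.m+[n∸m]≡n 1+h<K

            only-hub : ∀ i → i ≤ K → i ≢ suc h → toℕ (Γ i) ≢ 0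
            only-hub i i≤ i≢ z = i≢ (inj-both simple i≤ (ℕ.<⇒≤ 1+h<K) (Fin.toℕ-injective (trans z (sym at-hub))))

            front : ∀ i → i ≤ h → toℕ (Γ i) + i ≡ suc j
            front i i≤h = ℕ.suc-injective (trans (sym (ℕ.+-suc (toℕ (Γ i)) i)) (trans (descends (suc h) (s≤s z≤n) (ℕ.<⇒≤ 1+h<K) nonzero (suc i) (s≤s i≤h)) end))
              where
              nonzero : ∀ i → i ≤ suc h → toℕ (σ i) ≢ 0
              nonzero zero _ = only-hub K ℕ.≤-refl (λ { refl → ℕ.<-irrefl refl 1+h<K })
              nonzero (suc i) le = only-hub i (ℕ.≤-trans (ℕ.≤-pred le) (ℕ.≤-trans (ℕ.n≤1+n h) (ℕ.<⇒≤ 1+h<K))) (ℕ.<⇒≢ le)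

            e<K : suc e ≤ K
            e<K = lin 3 0 (λ h e K → # 2 ⊕ h ⊕ e ≡' K ⇒ ⊢ # 1 ⊕ e ≤' K) h e K h+e

            τ-nonzero : ∀ i → i ≤ suc e → toℕ (τ i) ≢ 0
            τ-nonzero zero _ = only-hub 0 z≤n (λ ())
            τ-nonzero (suc i) le = only-hub (K ∸ i) (ℕ.m∸n≤m K i) λ f → lin 5 0 (λ h e i K x → # 2 ⊕ h ⊕ e ≡' K ⇒ i ≤' e ⇒ i ⊕ x ≡' K ⇒ x ≡' # 1 ⊕ h ⇒ ⊢ ⊥') h e i K (K ∸ i) h+e (ℕ.≤-pred le)
              (ℕ.m+[n∸m]≡n (ℕ.≤-trans (ℕ.≤-pred le) (ℕ.≤-trans (ℕ.n≤1+n e) e<K))) f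

            back : ∀ i → i ≤ e → toℕ (Γ (K ∸ i)) ≡ suc j + suc i
            back i i≤e = trans (ascends (suc e) (s≤s z≤n) e<K τ-nonzero (suc i) (s≤s i≤e)) (cong (_+ suc i) start)

            K∸e : K ∸ e ≡ suc (suc h)
            K∸e = trans (cong (_∸ e) (sym h+e)) (ℕ.m+n∸n≡m (suc (suc h)) e)

            mark-α : ∃ λ α → α + h ≡ j × mark ms α ≡ true
            mark-α = label (toℕ (Γ h)) refl
              where
              label : ∀ l → toℕ (Γ h) ≡ l → ∃ λ α → α + h ≡ j × mark ms α ≡ true
              label zero z = ⊥-elim (only-hub h (ℕ.≤-trans (ℕ.n≤1+n h) (ℕ.<⇒≤ 1+h<K)) (ℕ.<⇒≢ ℕ.≤-refl) z)
              label (suc α) z = α , α+h , spoke-mark (ℕ.≤-trans (ℕ.m+n≤o⇒m≤o α (ℕ.≤-reflexive α+h)) (ℕ.≤-trans (ℕ.n≤1+n j) 1+j≤N))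
                (subst₂ (λ l l' → adjacent l l' ≡ true) z at-hub (path h (ℕ.≤-trans (ℕ.n≤1+n (suc h)) 1+h<K)))
                where
                α+h : α + h ≡ j
                α+h = ℕ.suc-injective (trans (cong (_+ h) (sym z)) (front h ℕ.≤-refl))

            mark-β : mark ms (suc j + e) ≡ true
            mark-β = spoke-mark β≤N (subst₂ (λ l l' → adjacent l l' ≡ true) β-label at-hub
              (adj-sym {Γ (suc h)} {Γ (K ∸ e)} (subst (λ i → adj (Γ (suc h)) (Γ i) ≡ true) (sym K∸e) (path (suc h) 1+h<K))))
              where
              β-label : toℕ (Γ (K ∸ e)) ≡ suc (suc j + e)
              β-label = trans (back e ℕ.≤-refl) (ℕ.+-suc (suc j) e)
              β≤N : suc j + e ≤ N
              β≤N = previous (toℕ (τ e)) refl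
                where
                previous : ∀ l → toℕ (τ e) ≡ l → suc j + e ≤ N
                previous zero z = ⊥-elim (τ-nonzero e (ℕ.n≤1+n e) z)
                previous (suc r) z = proj₂ (proj₂ (adjacent-view {r} {suc j + e} (subst₂ (λ l l' → adjacent l l' ≡ true) z β-label (τ-path e (ℕ.<⇒≤ e<K)))))

            -- The detour leaves the rim for the hub at marks α ≤ j and β > j. As u and u' are
            -- consecutive marks around j, it passes both of them on the way, at the indices a and K
            -- - b, and the spokes there are the hub edges required by `cell`. The cell has length
            -- u' - u + 2 = a + b + 3.
            bound : Consecutive s M ms j → Bound (M + 4)
            bound (consecutive u u' mark-u mark-u' u≤j j<u' apart near none) = bound-weaken
                (lin 6 0 (λ a b j u u' M → u ⊕ a ≡' j ⇒ # 1 ⊕ j ⊕ b ≡' u' ⇒ u' ≤' u ⊕ M ⇒ ⊢ a ⊕ b ⊕ # 5 ≤' M ⊕ # 4) a b j u u' M a≡ b≡ near)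
                (cell η>0 D {a} {b} {suc h} (s≤s a≤h) h+b<K
                  (adj-of {Γ a} {Γ (suc h)} a-label at-hub (mark-spoke {u} mark-u))
                  (adj-of {Γ (suc h)} {Γ (K ∸ b)} at-hub b-label (mark-spoke {u'} mark-u'))
                  (lin 6 0 (λ a b j u u' s → u ⊕ a ≡' j ⇒ # 1 ⊕ j ⊕ b ≡' u' ⇒ u ⊕ s ≤' u' ⇒ # 3 ≤' s ⇒ ⊢ # 3 ≤' # 1 ⊕ (a ⊕ b)) a b j u u' s a≡ b≡ apart 3≤s))
              where
              a b : ℕ
              a = j ∸ u
              b = u' ∸ suc j
              a≡ : u + a ≡ j
              a≡ = ℕ.m+[n∸m]≡n u≤j
              b≡ : suc j + b ≡ u'
              b≡ = ℕ.m+[n∸m]≡n j<u'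
              a≤h : a ≤ h
              a≤h = let (α , α+h , m) = mark-α in [ (λ α≤u → lin 5 0 (λ α h j u a → α ⊕ h ≡' j ⇒ u ⊕ a ≡' j ⇒ α ≤' u ⇒ ⊢ a ≤' h) α h j u a α+h a≡ α≤u)
                , (λ u'≤α → ⊥-elim (lin 4 0 (λ α h j u' → α ⊕ h ≡' j ⇒ j <' u' ⇒ u' ≤' α ⇒ ⊢ ⊥') α h j u' α+h j<u' u'≤α)) ]′ (none α m)
              b≤e : b ≤ e
              b≤e = [ (λ β≤u → ⊥-elim (lin 3 0 (λ j e u → u ≤' j ⇒ # 1 ⊕ j ⊕ e ≤' u ⇒ ⊢ ⊥') j e u u≤j β≤u))
                , (λ u'≤β → lin 4 0 (λ j e u' b → # 1 ⊕ j ⊕ b ≡' u' ⇒ u' ≤' # 1 ⊕ j ⊕ e ⇒ ⊢ b ≤' e) j e u' b b≡ u'≤β) ]′ (none (suc j + e) mark-β)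
              h+b<K : suc h + b < K
              h+b<K = lin 4 0 (λ h e b K → # 2 ⊕ h ⊕ e ≡' K ⇒ b ≤' e ⇒ ⊢ # 1 ⊕ h ⊕ b <' K) h e b K h+e b≤e
              a-label : toℕ (Γ a) ≡ suc u
              a-label = lin 4 0 (λ x a j u → x ⊕ a ≡' # 1 ⊕ j ⇒ u ⊕ a ≡' j ⇒ ⊢ x ≡' # 1 ⊕ u) (toℕ (Γ a)) a j u (front a a≤h) a≡
              b-label : toℕ (Γ (K ∸ b)) ≡ suc u'
              b-label = trans (back b b≤e) (trans (ℕ.+-suc (suc j) b) (cong suc b≡))

          bound : Bound (M + 4)
          bound = locate-hub (search≤ (λ i → toℕ (Γ i) ℕ.≟ 0) K)
            where
            locate-hub : Dec (∃ λ i → i ≤ K × toℕ (Γ i) ≡ 0) → Bound (M + 4)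
            locate-hub (no none) = ⊥-elim (no-hub (λ i h z → none (i , h , z)))
            locate-hub (yes (zero , _ , z)) = ⊥-elim (ℕ.0≢1+n (trans (sym z) start))
            locate-hub (yes (suc h , h≤ , z)) = WithHub.bound h (ℕ.≤∧≢⇒< h≤ (λ f → ℕ.0≢1+n (trans (sym z) (trans (cong (λ i → toℕ (Γ i)) f) end)))) z (marks-around gaps 1+j≤N)

        -- Since Γ K is the hub, the rest of the detour is a straight stretch of the rim from the
        -- mark π to another one; it passes the mark next to π in its direction, which closes a cell
        -- with the spoke of p.
        module Spoke (D : Detour ρ η) (π : ℕ) (end : toℕ (Detour.Γ D (Detour.K D)) ≡ 0) (start : toℕ (Detour.Γ D 0) ≡ suc π) where
          open Detour D
          open Estimates η>0 D

          k : ℕ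
          k = kx + (suc q₀ + ky)

          k≥1 : 1 ≤ k
          k≥1 = ℕ.≤-trans (s≤s z≤n) (ℕ.m≤n+m (suc (q₀ + ky)) kx)

          nonzero : ∀ i → i ≤ k → toℕ (Γ i) ≢ 0
          nonzero i h z = simple i K (s≤s h) ℕ.≤-refl (Fin.toℕ-injective (trans z (sym end)))

          open Straight {λ i → toℕ (Γ i)} {k} nonzero (λ i h → path i (ℕ.m≤n⇒m≤1+n h)) (λ i j h h' e → simple i j h (ℕ.m≤n⇒m≤1+n h') (Fin.toℕ-injective e))

          next-label : ∃ λ r → toℕ (Γ 1) ≡ suc r × adjacent (suc π) (suc r) ≡ true
          next-label = go (toℕ (Γ 1)) refl
            where
            go : ∀ l → toℕ (Γ 1) ≡ l → ∃ λ r → toℕ (Γ 1) ≡ suc r × adjacent (suc π) (suc r) ≡ true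
            go zero z = ⊥-elim (nonzero 1 k≥1 z)
            go (suc r) z = r , z , subst₂ (λ l l' → adjacent l l' ≡ true) start z (path 0 (s≤s z≤n))

          π≤N : π ≤ N
          π≤N = let (r , _ , h) = next-label in proj₁ (proj₂ (adjacent-view {π} {r} h))

          mark-π : mark ms π ≡ true
          mark-π = spoke-mark π≤N (subst₂ (λ l l' → adjacent l l' ≡ true) end start close)

          last-label : ∃ λ β → toℕ (Γ k) ≡ suc β × mark ms β ≡ true
          last-label = go (toℕ (Γ k)) refl
            where
            go : ∀ l → toℕ (Γ k) ≡ l → ∃ λ β → toℕ (Γ k) ≡ suc β × mark ms β ≡ true
            go zero z = ⊥-elim (nonzero k ℕ.≤-refl z)
            go (suc β) z = β , z , spoke-mark (β≤N k refl) (subst₂ (λ l l' → adjacent l l' ≡ true) z end (path k ℕ.≤-refl))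
              where
              previous : ∀ i → suc i ≡ k → ∀ l → toℕ (Γ i) ≡ l → β ≤ N
              previous i e zero z' = ⊥-elim (nonzero i (ℕ.≤-trans (ℕ.n≤1+n i) (ℕ.≤-reflexive e)) z')
              previous i e (suc r) z' = proj₂ (proj₂ (adjacent-view {r} {β} (subst₂ (λ l l' → adjacent l l' ≡ true) z' (trans (cong (λ x → toℕ (Γ x)) e) z)
                (path i (s≤s (ℕ.≤-trans (ℕ.n≤1+n i) (ℕ.≤-reflexive e)))))))
              β≤N : ∀ k' → k' ≡ k → β ≤ N
              β≤N zero e = ⊥-elim (ℕ.n≮0 (subst (1 ≤_) (sym e) k≥1))
              β≤N (suc i) e = previous i e (toℕ (Γ i)) refl

          finish : ∀ a u → s ≤ a → a ≤ M → a ≤ k → toℕ (Γ a) ≡ suc u → mark ms u ≡ true → Bound (M + 4)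
          finish a u s≤a a≤M a≤k label m = bound-weaken (ℕ.+-monoˡ-≤ 4 a≤M)
            (spoke-cell {a} (ℕ.≤-trans (s≤s (s≤s z≤n)) (ℕ.≤-trans 3≤s s≤a)) (s≤s a≤k) (adj-of {Γ a} {Γ K} label end (mark-spoke {u} m)))

          up-bound : Ascending (λ i → toℕ (Γ i)) k → Bound (M + 4)
          up-bound asc = use (marks-around gaps π<N)
            where
            β : ℕ
            β = proj₁ last-label
            mark-β : mark ms β ≡ true
            mark-β = proj₂ (proj₂ last-label)
            β≡ : β ≡ π + k
            β≡ = ℕ.suc-injective (trans (sym (proj₁ (proj₂ last-label))) (trans (asc k ℕ.≤-refl) (cong (_+ k) start)))
            π<N : π < N
            π<N = let (r , z , h) = next-label in subst (_≤ N) (ℕ.suc-injective (trans (sym z) (trans (asc 1 k≥1) (trans (cong (_+ 1) start) (ℕ.+-comm (suc π) 1))))) (proj₂ (proj₂ (adjacent-view {π} {r} h)))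
            use : Consecutive s M ms π → Bound (M + 4)
            use (consecutive u u' _ mark-u' u≤π π<u' apart near none) = finish a u'
                (lin 5 0 (λ a π u u' s → π ⊕ a ≡' u' ⇒ π ≡' u ⇒ u ⊕ s ≤' u' ⇒ ⊢ s ≤' a) a π u u' s a≡ π≡u apart)
                (lin 5 0 (λ a π u u' M → π ⊕ a ≡' u' ⇒ π ≡' u ⇒ u' ≤' u ⊕ M ⇒ ⊢ a ≤' M) a π u u' M a≡ π≡u near)
                a≤k (trans (asc a a≤k) (trans (cong (_+ a) start) (cong suc a≡))) mark-u'
              where
              a : ℕ
              a = u' ∸ π
              a≡ : π + a ≡ u'
              a≡ = ℕ.m+[n∸m]≡n (ℕ.<⇒≤ π<u')
              π≡u : π ≡ u
              π≡u = [ (λ h → ℕ.≤-antisym h u≤π) , (λ h → ⊥-elim (ℕ.<⇒≱ π<u' h)) ]′ (none π mark-π)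
              a≤k : a ≤ k
              a≤k = [ (λ h → ⊥-elim (lin 4 0 (λ π β u k → # 1 ≤' k ⇒ β ≡' π ⊕ k ⇒ u ≤' π ⇒ β ≤' u ⇒ ⊢ ⊥') π β u k k≥1 β≡ u≤π h))
                , (λ h → lin 5 0 (λ a π β u' k → π ⊕ a ≡' u' ⇒ β ≡' π ⊕ k ⇒ u' ≤' β ⇒ ⊢ a ≤' k) a π β u' k a≡ β≡ h) ]′ (none β mark-β)

          down-bound : Descending (λ i → toℕ (Γ i)) k → Bound (M + 4)
          down-bound desc = below π refl
            where
            α : ℕ
            α = proj₁ last-label
            mark-α : mark ms α ≡ true
            mark-α = proj₂ (proj₂ last-label)
            α≡ : α + k ≡ π
            α≡ = ℕ.suc-injective (trans (cong (_+ k) (sym (proj₁ (proj₂ last-label)))) (trans (desc k ℕ.≤-refl) start))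
            below : ∀ π' → π' ≡ π → Bound (M + 4)
            below zero e = ⊥-elim (ℕ.n≮0 (subst (1 ≤_) (ℕ.m+n≡0⇒n≡0 α (trans α≡ (sym e))) k≥1))
            -- Going down, the cell is the one below π: it contains the rim edge between π - 1 and
            -- π, and π is its upper mark.
            below (suc π') e = use (marks-around gaps (subst (_≤ N) (sym e) π≤N))
              where
              use : Consecutive s M ms π' → Bound (M + 4)
              use (consecutive u u' mark-u _ u≤π' π'<u' apart near none) = finish a u
                  (lin 5 0 (λ a π u u' s → u ⊕ a ≡' π ⇒ u' ≡' π ⇒ u ⊕ s ≤' u' ⇒ ⊢ s ≤' a) a π u u' s a≡ u'≡π apart)
                  (lin 5 0 (λ a π u u' M → u ⊕ a ≡' π ⇒ u' ≡' π ⇒ u' ≤' u ⊕ M ⇒ ⊢ a ≤' M) a π u u' M a≡ u'≡π near)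
                  a≤k (lin 4 0 (λ x a π u → x ⊕ a ≡' # 1 ⊕ π ⇒ u ⊕ a ≡' π ⇒ ⊢ x ≡' # 1 ⊕ u) (toℕ (Γ a)) a π u (trans (desc a a≤k) start) a≡) mark-u
                where
                u≤π : u ≤ π
                u≤π = subst (u ≤_) e (ℕ.m≤n⇒m≤1+n u≤π')
                a : ℕ
                a = π ∸ u
                a≡ : u + a ≡ π
                a≡ = ℕ.m+[n∸m]≡n u≤π
                u'≡π : u' ≡ π
                u'≡π = [ (λ h → ⊥-elim (ℕ.<⇒≱ (subst (u <_) e (s≤s u≤π')) h)) , (λ h → ℕ.≤-antisym h (subst (_≤ u') e π'<u')) ]′ (none π mark-π)
                a≤k : a ≤ k
                a≤k = [ (λ h → lin 5 0 (λ a π α u k → u ⊕ a ≡' π ⇒ α ⊕ k ≡' π ⇒ α ≤' u ⇒ ⊢ a ≤' k) a π α u k a≡ α≡ h)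
                  , (λ h → ⊥-elim (lin 4 0 (λ α π u' k → # 1 ≤' k ⇒ α ⊕ k ≡' π ⇒ u' ≡' π ⇒ u' ≤' α ⇒ ⊢ ⊥') α π u' k k≥1 α≡ u'≡π h)) ]′ (none α mark-α)

          bound : Bound (M + 4)
          bound = [ up-bound , down-bound ]′ (straight k≥1)

        module _ (D : Detour ρ η) where
          open Detour D
          open Estimates η>0 D using (Bound)

          private
            D' : Detour ρ η
            D' = reverse-detour D

            end' : Detour.Γ D' (Detour.K D') ≡ Γ 0
            end' = cong Γ (trans (cong (K ∸_) (lin 3 0 (λ kx q ky → ⊢ # 1 ⊕ ky ⊕ (# 1 ⊕ q ⊕ kx) ≡' # 1 ⊕ kx ⊕ (# 1 ⊕ q ⊕ ky)) kx q₀ ky)) (ℕ.n∸n≡0 K))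

          cell-bound : Bound (M + 4)
          cell-bound = by-labels (toℕ (Γ K)) (toℕ (Γ 0)) refl refl close
            where
            by-labels : ∀ l l' → toℕ (Γ K) ≡ l → toℕ (Γ 0) ≡ l' → adjacent l l' ≡ true → Bound (M + 4)
            by-labels zero (suc π) e e' _ = Spoke.bound D π e e'
            -- With the hub, or the larger of two rim labels, at Γ 0, it is the reversed detour that
            -- has the required orientation.
            by-labels (suc π) zero e e' _ = Spoke.bound D' π (trans (cong toℕ end') e') e
            by-labels (suc q) (suc r) e e' h = [ (λ { refl → Rim.bound D' q (trans (cong toℕ end') e') e }) , (λ { refl → Rim.bound D r e e' }) ]′ (proj₁ (adjacent-view {q} {r} h))

open Fans

-- The three cases: choice of the gaps and comparison of the constants.

open import Data.Nat using (_≤_; _<_; _>_; _*_; _+_; _∸_)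
open import Data.Integer using (+_)
open import Data.Rational using (_/_)

eighths : ∀ a → let x = + a / 8 in x ℚ.+ x ℚ.+ (x ℚ.+ x) ℚ.+ (x ℚ.+ x ℚ.+ (x ℚ.+ x)) ≡ ι a
eighths a = trans (trans (lin 0 1 (λ x → ⊢ x ⊕ x ⊕ (x ⊕ x) ⊕ (x ⊕ x ⊕ (x ⊕ x)) ≡' x ⊕ (x ⊕ (x ⊕ (x ⊕ (x ⊕ (x ⊕ (x ⊕ (x ⊕ ♯ 0)))))))) x) (×ℚ-ι 8 x)) (*-cancel-/ a 7)
  where x = + a / 8

quadruple : ℚ → ℚ
quadruple r = r ℚ.+ r ℚ.+ (r ℚ.+ r)

1<-of-quadruple : ∀ m r → 5 ≤ m → ι m ℚ.≤ quadruple r → 1ℚ ℚ.< r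
1<-of-quadruple m r = lin 1 1 (λ m r → # 5 ≤' m ⇒ ↑ m ≤' r ⊕ r ⊕ (r ⊕ r) ⇒ ⊢ ♯ 1 <' r) m r

quarters-≥ : ∀ {m} a → m ≤ a → ι m ℚ.≤ quadruple (+ a / 4)
quarters-≥ a h = ℚ.≤-trans (ι-mono h) (ℚ.≤-reflexive (sym (quarters a)))

eighths-≥ : ∀ m a → 2 * m ≤ a → ι m ℚ.≤ quadruple (+ a / 8)
eighths-≥ m a = lin 2 1 (λ m a x → x ⊕ x ⊕ (x ⊕ x) ⊕ (x ⊕ x ⊕ (x ⊕ x)) ≡' ↑ a ⇒ 2 · m ≤' a ⇒ ⊢ ↑ m ≤' x ⊕ x ⊕ (x ⊕ x)) m a (+ a / 8) (eighths a)

lower-bound : ∀ g c {n} (G : Graph n) → InClass g c n G → δ≥ G (+ g / 4)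
lower-bound g c G (_ , ((m , refl , C) , minimal) , _) = GirthCycle.girth/4≤δ G (Sequences.unroll G C) minimal

circumference-bound : ∀ {n c} (G : Graph n) → Connected G → (∀ k → HasCycleOfLength G k → k ≤ c) →
                      ∀ r → 5 ≤ c → ι c ℚ.≤ quadruple r → δ≤ G r
circumference-bound {c = c} G connected longest r 5≤c c≤4r =
  Thin.Triangles.thin G connected r (1<-of-quadruple c r 5≤c c≤4r) λ {ρ} {η} η>0 _ D →
    let open Detours.Detour D ; open Chords.Estimates G η>0 D in
    ℚ.≤-trans bound-cycle (ℚ.+-monoˡ-≤ 8η (ℚ.≤-trans (ι-mono (longest (suc K) (K , refl ,
      Sequences.toCycle G {Γ} (s≤s (ℕ.≤-trans (s≤s z≤n) (ℕ.m≤n+m (suc (q₀ + ky)) kx))) path simple close))) c≤4r))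

-- A gap m bounds a cell of length m + 2, so that s = g - 2, the gaps add up to c - 2, and ℓ + 2
-- becomes M + 4. The leading gap s supplies the shortest cycle.
fan-bound : ∀ {s M ms n} → 3 ≤ s → All (Between s M) (s ∷ ms) → 2 + sum (s ∷ ms) ≤ n → ∀ r → ι (M + 4) ℚ.≤ quadruple r →
            ∃ λ (G : Graph n) → InClass (2 + s) (2 + sum (s ∷ ms)) n G × δ≤ G r
fan-bound {s} {M} {ms} {n} 3≤s gaps@((_ , s≤M) ∷ _) ≤n r M≤4r = fan , (connected , (girth-cycle , λ k h → subst (_≤ k) (ℕ.+-comm s 2) (girth≥ k h)) , circumference) ,
  Thin.Triangles.thin fan connected r
    (1<-of-quadruple (M + 4) r (ℕ.≤-trans (s≤s (s≤s (s≤s (s≤s (s≤s z≤n))))) (ℕ.+-monoˡ-≤ 4 (ℕ.≤-trans 3≤s s≤M))) M≤4r)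
    λ {ρ} {η} η>0 _ D → ℚ.≤-trans (Cells.cell-bound η>0 3≤s D) (ℚ.+-monoˡ-≤ (Chords.Estimates.8η fan η>0 D) M≤4r)
  where
  open Fan n (s ∷ ms)
  1≤s : 1 ≤ s
  1≤s = ℕ.≤-trans (s≤s z≤n) 3≤s
  s≤N : s ≤ sum (s ∷ ms)
  s≤N = ℕ.m≤m+n s (sum ms)
  open Spanning ≤n (ℕ.≤-trans 1≤s s≤N) gaps
  girth-cycle : HasCycleOfLength fan (2 + s)
  girth-cycle = arc-cycle s 1≤s s≤N (mark-first s ms)

-- Gaps of size s are split off until less than 3s is left, and two gaps share this remainder
-- equally up to rounding. This is the origin of 3s/2.
split-gaps : ∀ s d → 1 ≤ s → ∃ λ ms → sum ms ≡ s + s + d × All (Between s ⌊ 3 * s /2⌋) ms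
split-gaps s d 1≤s = go d (<-wellFounded d)
  where
  M : ℕ
  M = ⌊ 3 * s /2⌋
  ≤M : ∀ m → m + m ≤ 3 * s → m ≤ M
  ≤M m h = subst (_≤ M) (sym (ℕ.n≡⌊n+n/2⌋ m)) (ℕ.⌊n/2⌋-mono h)
  go : ∀ d → Acc _<_ d → ∃ λ ms → sum ms ≡ s + s + d × All (Between s M) ms
  go d (acc rec) = [ two , more ]′ (ℕ.<-≤-connex d s)
    where
    two : d < s → ∃ λ ms → sum ms ≡ s + s + d × All (Between s M) ms
    two d<s = s + ⌊ d /2⌋ ∷ s + ⌈ d /2⌉ ∷ [] ,
      lin 4 0 (λ s d a b → a ⊕ b ≡' d ⇒ ⊢ s ⊕ a ⊕ (s ⊕ b ⊕ # 0) ≡' s ⊕ s ⊕ d) s d ⌊ d /2⌋ ⌈ d /2⌉ (ℕ.⌊n/2⌋+⌈n/2⌉≡n d) ,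
      (ℕ.m≤m+n s _ , ≤M _ (lin 4 0 (λ s d a b → a ⊕ b ≡' d ⇒ a ≤' b ⇒ d <' s ⇒ ⊢ s ⊕ a ⊕ (s ⊕ a) ≤' 3 · s) s d ⌊ d /2⌋ ⌈ d /2⌉ (ℕ.⌊n/2⌋+⌈n/2⌉≡n d) (ℕ.⌊n/2⌋≤⌈n/2⌉ d) d<s)) ∷
      -- By definition ⌈d/2⌉ is ⌊(d + 1)/2⌋, so its double is at most d + 1 ≤ s.
      (ℕ.m≤m+n s _ , ≤M _ (lin 4 0 (λ s d b b' → b ⊕ b' ≡' # 1 ⊕ d ⇒ b ≤' b' ⇒ d <' s ⇒ ⊢ s ⊕ b ⊕ (s ⊕ b) ≤' 3 · s) s d ⌈ d /2⌉ ⌈ suc d /2⌉ (ℕ.⌊n/2⌋+⌈n/2⌉≡n (suc d)) (ℕ.⌈n/2⌉-mono (ℕ.n≤1+n d)) d<s)) ∷ []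
    more : s ≤ d → ∃ λ ms → sum ms ≡ s + s + d × All (Between s M) ms
    more s≤d = let (ms , sum≡ , bs) = go (d ∸ s) (rec (ℕ.∸-monoʳ-< 1≤s s≤d)) in
      s ∷ ms , lin 4 0 (λ s d x S → s ⊕ x ≡' d ⇒ S ≡' s ⊕ s ⊕ x ⇒ ⊢ s ⊕ S ≡' s ⊕ s ⊕ d) s d (d ∸ s) (sum ms) (ℕ.m+[n∸m]≡n s≤d) sum≡ ,
      (ℕ.≤-refl , ≤M s (lin 1 0 (λ s → ⊢ s ⊕ s ≤' 3 · s) s)) ∷ bs

2M≤3s : ∀ s → 2 * ⌊ 3 * s /2⌋ ≤ 3 * s
2M≤3s s = lin 3 0 (λ a b t → a ⊕ b ≡' t ⇒ a ≤' b ⇒ ⊢ 2 · a ≤' t) ⌊ 3 * s /2⌋ ⌈ 3 * s /2⌉ (3 * s) (ℕ.⌊n/2⌋+⌈n/2⌉≡n (3 * s)) (ℕ.⌊n/2⌋≤⌈n/2⌉ (3 * s))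

Upper : (g c n : ℕ) → ℚ → Set
Upper g c n r = ∃ λ (G : Graph n) → InClass g c n G × δ≤ G r

fan-upper : ∀ {s N n} ms M → 3 ≤ s → sum (s ∷ ms) ≡ N → All (Between s M) (s ∷ ms) → 2 + N ≤ n →
            ∀ r → ι (M + 4) ℚ.≤ quadruple r → Upper (2 + s) (2 + N) n r
fan-upper ms M 3≤s refl gaps ≤n r h = fan-bound 3≤s gaps ≤n r h

small-upper : ∀ {s N n} → 3 ≤ s → s ≤ N → 2 + N ≤ n → VAdmissible (2 + s) (2 + N) n → N < 3 * s →
              ∀ a → a + 1 ≡ 2 * (2 + s) → Upper (2 + s) (2 + N) n (+ a / 4)
small-upper {s} {N} {n} 3≤s s≤N ≤n (G , class@(connected , _ , _ , longest)) N<3s a a≡ = [ short , long ]′ (ℕ.<-≤-connex N (2 * s))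
  where
  short : N < 2 * s → Upper (2 + s) (2 + N) n (+ a / 4)
  -- The rim is too short for two gaps of size at least s; the graph supplied by admissibility is
  -- the witness.
  short N<2s = G , class , circumference-bound G connected longest (+ a / 4) (s≤s (s≤s (ℕ.≤-trans 3≤s s≤N)))
    (quarters-≥ a (lin 3 0 (λ s N a → a ⊕ # 1 ≡' 2 · (# 2 ⊕ s) ⇒ N <' 2 · s ⇒ ⊢ # 2 ⊕ N ≤' a) s N a a≡ N<2s))
  long : 2 * s ≤ N → Upper (2 + s) (2 + N) n (+ a / 4)
  -- The second gap N - s is at most 2s - 1, and (2s - 1) + 4 = 2g - 1.
  long 2s≤N = fan-upper (N ∸ s ∷ []) (N ∸ s) 3≤s (trans (cong (ℕ._+_ s) (ℕ.+-identityʳ (N ∸ s))) s+x)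
    ((ℕ.≤-refl , s≤x) ∷ (s≤x , ℕ.≤-refl) ∷ []) ≤n (+ a / 4)
    (quarters-≥ a (lin 4 0 (λ s N x a → a ⊕ # 1 ≡' 2 · (# 2 ⊕ s) ⇒ s ⊕ x ≡' N ⇒ N <' 3 · s ⇒ ⊢ x ⊕ # 4 ≤' a) s N (N ∸ s) a a≡ s+x N<3s))
    where
    s+x : s + (N ∸ s) ≡ N
    s+x = ℕ.m+[n∸m]≡n s≤N
    s≤x : s ≤ N ∸ s
    s≤x = lin 3 0 (λ s N x → s ⊕ x ≡' N ⇒ 2 · s ≤' N ⇒ ⊢ s ≤' x) s N (N ∸ s) s+x 2s≤N

middle-upper : ∀ {s N n} → 3 ≤ s → 2 + N ≤ n → N ≡ 3 * s → ∀ a → s + 4 ≤ a → Upper (2 + s) (2 + N) n (+ a / 4)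
middle-upper {s} 3≤s ≤n refl a h = fan-upper (s ∷ s ∷ []) s 3≤s refl
  ((ℕ.≤-refl , ℕ.≤-refl) ∷ (ℕ.≤-refl , ℕ.≤-refl) ∷ (ℕ.≤-refl , ℕ.≤-refl) ∷ []) ≤n (+ a / 4) (quarters-≥ a h)

-- The threshold 3s + 8 = 3g + 2 is 2(ℓ + 2) for ℓ = 3s/2 + 2; both numerators 3g + 5 and 3g + 7 lie
-- above it.
large-upper : ∀ {s N n} → 3 ≤ s → 2 + N ≤ n → 3 * s ≤ N → ∀ a → 3 * s + 8 ≤ a → Upper (2 + s) (2 + N) n (+ a / 8)
large-upper {s} {N} {n} 3≤s ≤n 3s≤N a h = build (split-gaps s (N ∸ 3 * s) (ℕ.≤-trans (s≤s z≤n) 3≤s))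
  where
  build : (∃ λ ms → sum ms ≡ s + s + (N ∸ 3 * s) × All (Between s ⌊ 3 * s /2⌋) ms) → Upper (2 + s) (2 + N) n (+ a / 8)
  build (ms , sum≡ , bs) = fan-upper ms ⌊ 3 * s /2⌋ 3≤s
    (lin 4 0 (λ s N x S → 3 · s ⊕ x ≡' N ⇒ S ≡' s ⊕ s ⊕ x ⇒ ⊢ s ⊕ S ≡' N) s N (N ∸ 3 * s) (sum ms) (ℕ.m+[n∸m]≡n 3s≤N) sum≡)
    ((ℕ.≤-refl , subst (_≤ ⌊ 3 * s /2⌋) (sym (ℕ.n≡⌊n+n/2⌋ s)) (ℕ.⌊n/2⌋-mono (lin 1 0 (λ s → ⊢ s ⊕ s ≤' 3 · s) s))) ∷ bs) ≤n (+ a / 8)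
    (eighths-≥ (⌊ 3 * s /2⌋ + 4) a (lin 3 0 (λ s M a → 2 · M ≤' 3 · s ⇒ 3 · s ⊕ # 8 ≤' a ⇒ ⊢ 2 · (M ⊕ # 4) ≤' a) s ⌊ 3 * s /2⌋ a (2M≤3s s) h))

theorem3p11 : ∀ (g c n : ℕ) → 5 ≤ g → g ≤ c → c ≤ n → VAdmissible g c n →
    (c < 3 * g ∸ 4 → ABounds g c n (+ g / 4) (+ (2 * g ∸ 1) / 4))
    × (c ≡ 3 * g ∸ 4 →
    (2 ∣ g → ABounds g c n (+ g / 4) (+ (g + 2) / 4))
    × (¬ 2 ∣ g → ABounds g c n (+ g / 4) (+ (g + 3) / 4)))
    × (c > 3 * g ∸ 4 →
    (2 ∣ g → ABounds g c n (+ g / 4) (+ (3 * g + 5) / 8))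
    × (¬ 2 ∣ g → ABounds g c n (+ g / 4) (+ (3 * g + 7) / 8)))
theorem3p11 g@(suc (suc s)) c@(suc (suc N)) n (s≤s (s≤s 3≤s)) (s≤s (s≤s s≤N)) c≤n admissible =
    (λ h → lower-bound g c , small-upper 3≤s s≤N c≤n admissible
      (lin 3 0 (λ s N x → # 4 ⊕ x ≡' 3 · (# 2 ⊕ s) ⇒ # 2 ⊕ N <' x ⇒ ⊢ N <' 3 · s) s N (3 * g ∸ 4) 3g-4 h)
      (2 * g ∸ 1) (ℕ.m∸n+n≡m {2 * g} {1} (s≤s z≤n)))
  , (λ h → let N≡ = lin 3 0 (λ s N x → # 4 ⊕ x ≡' 3 · (# 2 ⊕ s) ⇒ # 2 ⊕ N ≡' x ⇒ ⊢ N ≡' 3 · s) s N (3 * g ∸ 4) 3g-4 h in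
      (λ _ → lower-bound g c , middle-upper 3≤s c≤n N≡ (g + 2) (lin 1 0 (λ s → ⊢ s ⊕ # 4 ≤' # 2 ⊕ s ⊕ # 2) s))
    , (λ _ → lower-bound g c , middle-upper 3≤s c≤n N≡ (g + 3) (lin 1 0 (λ s → ⊢ s ⊕ # 4 ≤' # 2 ⊕ s ⊕ # 3) s)))
  , (λ h → let 3s≤N = lin 3 0 (λ s N x → # 4 ⊕ x ≡' 3 · (# 2 ⊕ s) ⇒ x <' # 2 ⊕ N ⇒ ⊢ 3 · s ≤' N) s N (3 * g ∸ 4) 3g-4 h in
      (λ _ → lower-bound g c , large-upper 3≤s c≤n 3s≤N (3 * g + 5) (lin 1 0 (λ s → ⊢ 3 · s ⊕ # 8 ≤' 3 · (# 2 ⊕ s) ⊕ # 5) s))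
    , (λ _ → lower-bound g c , large-upper 3≤s c≤n 3s≤N (3 * g + 7) (lin 1 0 (λ s → ⊢ 3 · s ⊕ # 8 ≤' 3 · (# 2 ⊕ s) ⊕ # 7) s)))
  where
  3g-4 : 4 + (3 * g ∸ 4) ≡ 3 * g
  3g-4 = ℕ.m+[n∸m]≡n {4} {3 * g} (lin 1 0 (λ s → ⊢ # 4 ≤' 3 · (# 2 ⊕ s)) s)
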